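{- Let $q>2$ be a prime power and $n\ge 3$. Let $\Omega$ be the set of points of the elliptic quadric $\mathsf{Q}^-(2n-1,q)$ not contained in a fixed hyperplane $\Pi$ whose section with the quadric is nondegenerate, and let $\sigma:\Omega\to\Omega$ be as in the context. Define relations on $\Omega$: $R_0=\{(X,Y):X=Y\}$, $R_1=\{(X,Y):Y\not\sim X\text{ and }X\sim Y^\sigma\}$, $R_2=\{(X,Y):Y\not\sim X\text{ and }X\not\sim Y^\sigma\}$, $R_3=\{(X,Y):Y\sim X\text{ and }X\not\sim Y^\sigma\}$, $R_4=\{(X,Y):X=Y^\sigma\}$. Then $(\Omega,\{R_0,\dots,R_4\})$ is an association scheme, and its minimal idempotents can be ordered $E_0,\dots,E_4$ so that its matrix of eigenvalues is \[ \begin{bmatrix} 1 & ( q^{n-2}-1)(q^{n-1}+1) & q^{n-2} ( q-2) (q^{n-1}+1) & ( q^{n-2}-1)(q^{n-1}+1) & 1\\ 1 & {q}^{n-1}+1 & 0 & -( {q}^{n-1}+1) & -1\\ 1 & q^{n-2}-1 & -2q^{n-2} & q^{n-2}-1 & 1\\ 1 & -( q^{n-2}-1) & 0 & q^{n-2}-1 & -1\\ 1 &-q^{n - 2}(q - 2)-1& 2q^{n-2}( q-2) & -q^{n - 2}(q - 2)-1& 1 \end{bmatrix}. \]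
   Context: Let $\perp$ be the polarity of $\mathsf{PG}(2n-1,q)$ associated with the quadric $\mathsf{Q}^-(2n-1,q)$ and $\Pi^\perp$ the pole of $\Pi$ (a point not on the quadric). For $P\in\Omega$, the line through $P$ and $\Pi^\perp$ meets the quadric in exactly two points, both outside $\Pi$; $\sigma(P)=P^\sigma$ is the one different from $P$ (so $\sigma$ is an involution of $\Omega$). For points $X,Y$, $X\sim Y$ means $X\ne Y$ and $X,Y$ are collinear in the quadric (the line $XY$ lies on the quadric). The matrix of eigenvalues has entry in row $i$, column $\ell$ equal to the eigenvalue of the adjacency matrix of $R_\ell$ on the column space of $E_i$; $E_0=\frac{1}{|\Omega|}J$. Note $|\Omega|=q^{n-1}(q^{n-1}-1)$.
   Formalization: "X ≁ Y" is read as "X ≠ Y and X, Y not collinear": with the plain negation of ∼, R_2 would contain R_0 and R_4 (e.g. (X,X)), so the relations would not partition Ω×Ω; only R_2 is affected. -}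

module Defs where

open import Data.Nat as ℕ using (ℕ; zero; suc; _^_; _∸_)
open import Data.Fin as Fin using (Fin; _≟_)
open import Data.Bool using (Bool; true; false; if_then_else_; _∧_; _∨_; not)
open import Data.Product using (Σ; ∃; ∃-syntax; _×_; _,_; proj₁; proj₂)
open import Data.List as List using (List; []; _∷_; length; filter; allFin; map; concatMap; cartesianProduct; foldr)
import Data.Bool.ListAction as BL
open import Data.List.Membership.Propositional using (_∈_)
open import Data.Vec as Vec using (Vec; []; _∷_; zipWith)
open import Data.Integer as ℤ using (ℤ; +_)
open import Data.Rational as ℚ using (ℚ; 0ℚ; 1ℚ)
open import Relation.Nullary using (¬_)
open import Relation.Nullary.Decidable using (⌊_⌋)
open import Relation.Binary.PropositionalEquality using (_≡_; _≢_)
open import Algebra.Structures using (IsCommutativeRing)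
open import Data.Nat.Primality using (Prime)

IsPrimePower : ℕ → Set
IsPrimePower q = ∃[ p ] ∃[ k ] (Prime p × q ≡ p ^ suc k)

-- A finite field with q elements, carrier Fin q (every finite field of
-- order q is isomorphic to such a structure).

record FiniteField (q : ℕ) : Set where
  infixl 6 _+_
  infixl 7 _*_
  infix 8 -_
  field
    _+_ _*_ : Fin q → Fin q → Fin q
    -_      : Fin q → Fin q
    0# 1#   : Fin q
    isCommutativeRing : IsCommutativeRing _≡_ _+_ _*_ -_ 0# 1#
    0≢1     : 0# ≢ 1#
    inverse : ∀ x → x ≢ 0# → ∃[ y ] (x * y ≡ 1#)

-- Generic notions: symmetric association schemes and eigenmatrices,
-- for relations on a finite set given by a duplicate-free list Ω.

module Scheme {A : Set} (Ω : List A) where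

  count : (A → Bool) → ℕ
  count p = length (filter (λ z → Data.Bool._≟_ (p z) true) Ω)
    where import Data.Bool

  record IsAssociationScheme (d : ℕ) (R : Fin (suc d) → A → A → Bool) : Set where
    field
      covers    : ∀ X Y → X ∈ Ω → Y ∈ Ω → ∃[ i ] (R i X Y ≡ true)
      disjoint  : ∀ X Y → X ∈ Ω → Y ∈ Ω → ∀ i j →
                  R i X Y ≡ true → R j X Y ≡ true → i ≡ j
      R₀-diag   : ∀ X Y → X ∈ Ω → Y ∈ Ω → (R Fin.zero X Y ≡ true → X ≡ Y) × (X ≡ Y → R Fin.zero X Y ≡ true)
      symmetric : ∀ X Y → X ∈ Ω → Y ∈ Ω → ∀ i → R i X Y ≡ R i Y X
      intersection : ∀ i j k → ∃[ p ] (∀ X Y → X ∈ Ω → Y ∈ Ω → R k X Y ≡ true →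
                     count (λ Z → R i X Z ∧ R j Z Y) ≡ p)

  Mat : Set
  Mat = A → A → ℚ

  _≈_ : Mat → Mat → Set
  M ≈ N = ∀ X Y → X ∈ Ω → Y ∈ Ω → M X Y ≡ N X Y

  sumΩ : (A → ℚ) → ℚ
  sumΩ f = foldr (λ z acc → f z ℚ.+ acc) 0ℚ Ω

  _·_ : Mat → Mat → Mat
  (M · N) X Y = sumΩ (λ Z → M X Z ℚ.* N Z Y)

  sumFin : ∀ {m} → (Fin m → ℚ) → ℚ
  sumFin {zero}  f = 0ℚ
  sumFin {suc m} f = f Fin.zero ℚ.+ sumFin (λ i → f (Fin.suc i))

  lincomb : ∀ {m} → (Fin m → ℚ) → (Fin m → Mat) → Mat
  lincomb c M X Y = sumFin (λ i → c i ℚ.* M i X Y)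

  zeroM : Mat
  zeroM _ _ = 0ℚ

  module _ (_≟A_ : (x y : A) → Bool) where
    idM : Mat
    idM X Y = if X ≟A Y then 1ℚ else 0ℚ

  adjacency : (A → A → Bool) → Mat
  adjacency r X Y = if r X Y then 1ℚ else 0ℚ

  δ : ∀ {m} → Fin m → Fin m → Bool
  δ i j = ⌊ i ≟ j ⌋

  -- E : Fin (suc d) → Mat are the minimal idempotents of the Bose-Mesner
  -- algebra, with E 0 = J/|Ω|, and P is the matrix of eigenvalues:
  -- entry (i , l) is the eigenvalue of A_l on the column space of E_i.
  record HasEigenmatrix (d : ℕ) (eqA : A → A → Bool) (R : Fin (suc d) → A → A → Bool)
                        (P : Fin (suc d) → Fin (suc d) → ℚ) (E : Fin (suc d) → Mat) : Set where
    field
      E-in-algebra : ∀ i → ∃[ c ] (E i ≈ lincomb c (λ l → adjacency (R l)))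
      E-nonzero    : ∀ i → ∃[ X ] ∃[ Y ] (X ∈ Ω × Y ∈ Ω × E i X Y ≢ 0ℚ)
      E-orthogonal : ∀ i j → (E i · E j) ≈ (if δ i j then E i else zeroM)
      E-sum        : lincomb (λ _ → 1ℚ) E ≈ idM eqA
      E₀-J/|Ω|     : ∀ X Y → X ∈ Ω → Y ∈ Ω →
                     E Fin.zero X Y ℚ.* (+ length Ω ℚ./ 1) ≡ 1ℚ
      eigen        : ∀ l → adjacency (R l) ≈ lincomb (λ i → P i l) E

-- The geometry: PG(2n-1,q) with the elliptic quadric Q^-(2n-1,q).
-- Vectors of F^(2n) are stored as n coordinate pairs.
-- Canonical form  Q(x) = x₁y₁ + ... + x_{n-1}y_{n-1} + (xₙ² + c xₙyₙ + d yₙ²)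
-- with t² + c t + d irreducible over F.

module Geometry {q : ℕ} (F : FiniteField q) (c d : Fin q) where
  open FiniteField F

  _==_ : Fin q → Fin q → Bool
  x == y = ⌊ x ≟ y ⌋

  Vector : ℕ → Set
  Vector m = Vec (Fin q × Fin q) m

  _==v_ : ∀ {m} → Vector m → Vector m → Bool
  [] ==v [] = true
  ((x , y) ∷ u) ==v ((x' , y') ∷ v) = (x == x') ∧ (y == y') ∧ (u ==v v)

  isZero : ∀ {m} → Vector m → Bool
  isZero [] = true
  isZero ((x , y) ∷ v) = (x == 0#) ∧ (y == 0#) ∧ isZero v

  _⊕_ : ∀ {m} → Vector m → Vector m → Vector m
  u ⊕ v = zipWith (λ a b → (proj₁ a + proj₁ b , proj₂ a + proj₂ b)) u v

  _⊙_ : ∀ {m} → Fin q → Vector m → Vector m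
  s ⊙ v = Vec.map (λ a → (s * proj₁ a , s * proj₂ a)) v

  Irreducible : Set
  Irreducible = ∀ t → (t * t + c * t) + d ≢ 0#

  Qf : ∀ {m} → Vector m → Fin q
  Qf [] = 0#
  Qf ((x , y) ∷ []) = (x * x + c * (x * y)) + d * (y * y)
  Qf ((x , y) ∷ v@(_ ∷ _)) = x * y + Qf v

  Bf : ∀ {m} → Vector m → Vector m → Fin q
  Bf u v = Qf (u ⊕ v) + (- (Qf u) + - (Qf v))

  dot : ∀ {m} → Vector m → Vector m → Fin q
  dot [] [] = 0#
  dot ((a , b) ∷ u) ((x , y) ∷ v) = (a * x + b * y) + dot u v

  allPairs : List (Fin q × Fin q)
  allPairs = cartesianProduct (allFin q) (allFin q)

  allVectors : ∀ m → List (Vector m)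
  allVectors zero = [] ∷ []
  allVectors (suc m) = concatMap (λ p → map (p ∷_) (allVectors m)) allPairs

  anyF : (Fin q → Bool) → Bool
  anyF f = BL.any f (allFin q)

  allF : (Fin q → Bool) → Bool
  allF f = BL.all f (allFin q)

  -- points of PG(2m-1,q): normalized representatives
  -- (nonzero vectors whose first nonzero coordinate equals 1)
  isPoint : ∀ {m} → Vector m → Bool
  isPoint [] = false
  isPoint ((x , y) ∷ v) =
    if x == 0# then (if y == 0# then isPoint v else y == 1#) else x == 1#

  module Hyperplane {n : ℕ} (a : Vector n) where
    inΠ : Vector n → Bool
    inΠ x = dot a x == 0#

    -- the section Π ∩ Q^- is nondegenerate (has no singular point)
    NondegenerateSection : Set
    NondegenerateSection = ∀ x → inΠ x ≡ true → isZero x ≡ false → Qf x ≡ 0# →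
                           ∃[ y ] (inΠ y ≡ true × Bf x y ≢ 0#)

    onQuadric : Vector n → Bool
    onQuadric x = isPoint x ∧ (Qf x == 0#)

    inΩ : Vector n → Bool
    inΩ x = onQuadric x ∧ not (inΠ x)

    Ω : List (Vector n)
    Ω = filter (λ x → Data.Bool._≟_ (inΩ x) true) (allVectors n)
      where import Data.Bool

    _∼_ : Vector n → Vector n → Bool
    X ∼ Y = not (X ==v Y) ∧ allF (λ s → allF (λ t → Qf ((s ⊙ X) ⊕ (t ⊙ Y)) == 0#))

    _≁_ : Vector n → Vector n → Bool
    X ≁ Y = not (X ==v Y) ∧ not (X ∼ Y)

    isPole : Vector n → Bool
    isPole p = isPoint p ∧ BL.all (λ x → if inΠ x then Bf p x == 0# else true) (allVectors n)

    -- Y = P^σ : Y is the point of the quadric, different from P, on the line P Π^⊥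
    isSigma : Vector n → Vector n → Bool
    isSigma P Y = onQuadric Y ∧ not (Y ==v P) ∧
      BL.any (λ p → isPole p ∧ anyF (λ s → anyF (λ t → Y ==v ((s ⊙ P) ⊕ (t ⊙ p)))))
               (allVectors n)

    simσ : Vector n → Vector n → Bool
    simσ X Y = BL.any (λ Z → isSigma Y Z ∧ (X ∼ Z)) (allVectors n)

    nsimσ : Vector n → Vector n → Bool
    nsimσ X Y = BL.any (λ Z → isSigma Y Z ∧ (X ≁ Z)) (allVectors n)

    R : Fin 5 → Vector n → Vector n → Bool
    R Fin.zero X Y = X ==v Y
    R (Fin.suc Fin.zero) X Y = (Y ≁ X) ∧ simσ X Y
    R (Fin.suc (Fin.suc Fin.zero)) X Y = (Y ≁ X) ∧ nsimσ X Y
    R (Fin.suc (Fin.suc (Fin.suc Fin.zero))) X Y = (Y ∼ X) ∧ nsimσ X Y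
    R (Fin.suc (Fin.suc (Fin.suc (Fin.suc Fin.zero)))) X Y = isSigma Y X

eigenmatrix : (q n : ℕ) → Fin 5 → Fin 5 → ℚ
eigenmatrix q n i l = toℚ (entry i l)
  where
    toℚ : ℤ → ℚ
    toℚ z = z ℚ./ 1
    a b Q : ℤ
    a = + (q ^ (n ∸ 2))
    b = + (q ^ (n ∸ 1)) ℤ.+ ℤ.1ℤ
    Q = + q
    entry : Fin 5 → Fin 5 → ℤ
    entry Fin.zero Fin.zero = ℤ.1ℤ
    entry Fin.zero (Fin.suc Fin.zero) = (a ℤ.- ℤ.1ℤ) ℤ.* b
    entry Fin.zero (Fin.suc (Fin.suc Fin.zero)) = a ℤ.* (Q ℤ.- + 2) ℤ.* b
    entry Fin.zero (Fin.suc (Fin.suc (Fin.suc Fin.zero))) = (a ℤ.- ℤ.1ℤ) ℤ.* b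
    entry Fin.zero (Fin.suc (Fin.suc (Fin.suc (Fin.suc Fin.zero)))) = ℤ.1ℤ
    entry (Fin.suc Fin.zero) Fin.zero = ℤ.1ℤ
    entry (Fin.suc Fin.zero) (Fin.suc Fin.zero) = b
    entry (Fin.suc Fin.zero) (Fin.suc (Fin.suc Fin.zero)) = ℤ.0ℤ
    entry (Fin.suc Fin.zero) (Fin.suc (Fin.suc (Fin.suc Fin.zero))) = ℤ.- b
    entry (Fin.suc Fin.zero) (Fin.suc (Fin.suc (Fin.suc (Fin.suc Fin.zero)))) = ℤ.-1ℤ
    entry (Fin.suc (Fin.suc Fin.zero)) Fin.zero = ℤ.1ℤ
    entry (Fin.suc (Fin.suc Fin.zero)) (Fin.suc Fin.zero) = a ℤ.- ℤ.1ℤ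
    entry (Fin.suc (Fin.suc Fin.zero)) (Fin.suc (Fin.suc Fin.zero)) = ℤ.- (+ 2 ℤ.* a)
    entry (Fin.suc (Fin.suc Fin.zero)) (Fin.suc (Fin.suc (Fin.suc Fin.zero))) = a ℤ.- ℤ.1ℤ
    entry (Fin.suc (Fin.suc Fin.zero)) (Fin.suc (Fin.suc (Fin.suc (Fin.suc Fin.zero)))) = ℤ.1ℤ
    entry (Fin.suc (Fin.suc (Fin.suc Fin.zero))) Fin.zero = ℤ.1ℤ
    entry (Fin.suc (Fin.suc (Fin.suc Fin.zero))) (Fin.suc Fin.zero) = ℤ.- (a ℤ.- ℤ.1ℤ)
    entry (Fin.suc (Fin.suc (Fin.suc Fin.zero))) (Fin.suc (Fin.suc Fin.zero)) = ℤ.0ℤ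
    entry (Fin.suc (Fin.suc (Fin.suc Fin.zero))) (Fin.suc (Fin.suc (Fin.suc Fin.zero))) = a ℤ.- ℤ.1ℤ
    entry (Fin.suc (Fin.suc (Fin.suc Fin.zero))) (Fin.suc (Fin.suc (Fin.suc (Fin.suc Fin.zero)))) = ℤ.-1ℤ
    entry (Fin.suc (Fin.suc (Fin.suc (Fin.suc Fin.zero)))) Fin.zero = ℤ.1ℤ
    entry (Fin.suc (Fin.suc (Fin.suc (Fin.suc Fin.zero)))) (Fin.suc Fin.zero) = ℤ.- (a ℤ.* (Q ℤ.- + 2)) ℤ.- ℤ.1ℤ
    entry (Fin.suc (Fin.suc (Fin.suc (Fin.suc Fin.zero)))) (Fin.suc (Fin.suc Fin.zero)) = + 2 ℤ.* a ℤ.* (Q ℤ.- + 2)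
    entry (Fin.suc (Fin.suc (Fin.suc (Fin.suc Fin.zero)))) (Fin.suc (Fin.suc (Fin.suc Fin.zero))) = ℤ.- (a ℤ.* (Q ℤ.- + 2)) ℤ.- ℤ.1ℤ
    entry (Fin.suc (Fin.suc (Fin.suc (Fin.suc Fin.zero)))) (Fin.suc (Fin.suc (Fin.suc (Fin.suc Fin.zero)))) = ℤ.1ℤ

{-# OPTIONS --safe #-}
module Submission where

-- Let p be the pole of Π, κ = Q(p) ≠ 0, and scale every point of Ω to a vector X with
-- B(X,p) = 1.  Then X and Y are equal or collinear iff B(X,Y) = 0, the point σ(X) is
-- p/κ − X, and X is equal or collinear to σ(Y) iff B(X,Y) = 1/κ.  Let C be the 0-1 matrix
-- of B(X,Y) = 0, S that of σ, D = CS, and a = q^(n−2).  Everything follows from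
--   C² = a²(q−1) I − a² S + a(2−q) C + a D + a(a−1) J,
-- an entry of which counts the singular vectors orthogonal to X and Y but not to p.
-- Averaging over translates by singular vectors settles all cases but the one where the
-- projection w of p to U = ⟨X,Y⟩^⊥ is nonsingular.  There one needs that w^⊥ ∩ U has
-- a² singular vectors; instead of classifying quadratic forms, the first two moments of
-- this number over all w ∈ U show that its variance over the nonsingular w vanishes.

-- The obstacle is a nonsingular `w`. Along a singular direction Q is affine in the parameter, so
-- each line meets the cone in one point, in none or in all; this is how the cone is averaged. Along
-- a nonsingular `w` the parameter enters quadratically, and the number of singular points would
-- depend on squares or, in characteristic 2, on traces. The moment argument is a Fourier transform
-- in disguise: the transform of the cone of U at w is an affine function of the wanted count,
-- orthogonality gives its first moment over U and Parseval its second, and its values at singular w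
-- are known. What remains for nonsingular w is a sum of squares, which vanishes identically in a
-- and q. Summing the characters over all nonzero scalars keeps the transform integer-valued, so no
-- roots of unity occur. Counts run over vectors, because translations act on them; passing to
-- points costs a factor q - 1, which is cancelled at the end. The counting never divides by 2 in
-- the field, so all characteristics are treated together.

open import Defs
open import Algebra.Bundles using (CommutativeRing)
open import Algebra.Bundles.Raw using (RawRing)
open import Algebra.Structures using (IsCommutativeRing)
open import Data.Bool as Bool using (Bool; true; false; if_then_else_; _∧_; not)
import Data.Bool.ListAction as BL
open import Data.Empty using (⊥-elim)
open import Data.Fin as Fin using (Fin; zero; suc; _≟_; punchOut)
import Data.Fin.Properties as Fin
open import Data.Integer as ℤ using (ℤ; -[1+_]; 0ℤ; 1ℤ) renaming (+_ to pos)
import Data.Integer.Properties as ℤ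
import Data.Integer.Solver
open import Data.Integer.Tactic.RingSolver using (solve-∀)
open import Data.List as List using (List; []; _∷_; length; _++_; map; concatMap; filter; cartesianProduct; allFin; tabulate; foldr)
open import Data.List.Membership.Propositional using (_∈_)
open import Data.List.Membership.Propositional.Properties using (∈-allFin; ∈-filter⁺; ∈-filter⁻)
import Data.List.Properties as List
open import Data.List.Relation.Unary.Any using (here; there)
open import Data.Maybe using (Maybe; just; nothing)
open import Data.Nat as ℕ using (ℕ; zero; suc; _^_; _<_; _≤_)
import Data.Nat.Properties as ℕ
open import Data.Product using (_×_; _,_; proj₁; proj₂; ∃-syntax)
import Data.Product.Properties as Product
open import Data.Rational as ℚ using (ℚ; 0ℚ; 1ℚ)
import Data.Rational.Properties as ℚ
import Data.Rational.Unnormalised as ℚᵘ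
import Data.Rational.Unnormalised.Properties as ℚᵘ
open import Data.Sum using (inj₁; inj₂)
open import Data.Vec as Vec using (Vec; []; _∷_)
import Data.Vec.Properties as Vec
open import Function using (id)
open import Function.Definitions using (Injective)
open import Level using (0ℓ)
open import Relation.Binary.Definitions using (DecidableEquality)
open import Relation.Binary.PropositionalEquality
open import Relation.Nullary using (¬_; Dec; yes; no)
open import Relation.Nullary.Decidable using (⌊_⌋)

-- Finite fields

module FieldLemmas {q : ℕ} (F : FiniteField q) where

  open FiniteField F public
  open IsCommutativeRing isCommutativeRing public
    using (+-assoc; +-comm; *-assoc; *-comm; +-identityˡ; +-identityʳ; *-identityˡ; *-identityʳ;
           zeroˡ; zeroʳ; -‿inverseʳ)

  ring : CommutativeRing _ _
  ring = record { isCommutativeRing = isCommutativeRing }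

  open import Algebra.Properties.Ring (CommutativeRing.ring ring) public
    using (-‿distribˡ-*; -‿distribʳ-*; -‿involutive; -0#≈0#)
    renaming (-‿anti-homo-+ to neg-+)
  open import Algebra.Properties.Semiring.Mult.TCOptimised (CommutativeRing.semiring ring)
    using (×-homo-+; ×1-homo-*; 1+×) renaming (_×_ to _·1_)

  private
    -- The ring homomorphism from the integers. It lets the ring solver take its coefficients from
    -- ℤ, where they compute; the operations of `F` are opaque.
    ⟦_⟧ : ℤ → Fin q
    ⟦ pos n ⟧      = n ·1 1#
    ⟦ -[1+ n ] ⟧ = - (suc n ·1 1#)

    module _ where
      open ≡-Reasoning

      cancel : ∀ x y z → (x + y) + - (x + z) ≡ y + - z
      cancel x y z = begin
        (x + y) + - (x + z) ≡⟨ cong₂ _+_ (+-comm x y) (neg-+ x z) ⟩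
        (y + x) + (- z + - x) ≡⟨ cong ((y + x) +_) (+-comm (- z) (- x)) ⟩
        (y + x) + (- x + - z) ≡⟨ +-assoc y x _ ⟩
        y + (x + (- x + - z)) ≡⟨ cong (y +_) (sym (+-assoc x (- x) (- z))) ⟩
        y + ((x + - x) + - z) ≡⟨ cong (λ t → y + (t + - z)) (-‿inverseʳ x) ⟩
        y + (0# + - z) ≡⟨ cong (y +_) (+-identityˡ _) ⟩
        y + - z ∎

      ⊖-homo : ∀ m n → ⟦ m ℤ.⊖ n ⟧ ≡ m ·1 1# + - (n ·1 1#)
      ⊖-homo zero    zero    = sym (trans (cong (0# +_) -0#≈0#) (+-identityˡ 0#))
      ⊖-homo zero    (suc n) = sym (+-identityˡ _)
      ⊖-homo (suc m) zero    = sym (trans (cong (suc m ·1 1# +_) -0#≈0#) (+-identityʳ _))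
      ⊖-homo (suc m) (suc n) = begin
        ⟦ suc m ℤ.⊖ suc n ⟧ ≡⟨ cong ⟦_⟧ (ℤ.[1+m]⊖[1+n]≡m⊖n m n) ⟩
        ⟦ m ℤ.⊖ n ⟧ ≡⟨ ⊖-homo m n ⟩
        m ·1 1# + - (n ·1 1#) ≡⟨ sym (cancel 1# _ _) ⟩
        (1# + m ·1 1#) + - (1# + n ·1 1#) ≡⟨ cong₂ (λ x y → x + - y) (sym (1+× m 1#)) (sym (1+× n 1#)) ⟩
        suc m ·1 1# + - (suc n ·1 1#) ∎

      +-homo : ∀ i j → ⟦ i ℤ.+ j ⟧ ≡ ⟦ i ⟧ + ⟦ j ⟧
      +-homo (pos m)      (pos n)      = ×-homo-+ 1# m n
      +-homo (pos m)      -[1+ n ]   = ⊖-homo m (suc n)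
      +-homo -[1+ m ]   (pos n)      = trans (⊖-homo n (suc m)) (+-comm _ _)
      +-homo -[1+ m ]   -[1+ n ]   = begin
        - (suc (suc (m ℕ.+ n)) ·1 1#) ≡⟨ cong (λ k → - (suc k ·1 1#)) (sym (ℕ.+-suc m n)) ⟩
        - ((suc m ℕ.+ suc n) ·1 1#) ≡⟨ cong -_ (×-homo-+ 1# (suc m) (suc n)) ⟩
        - (suc m ·1 1# + suc n ·1 1#) ≡⟨ neg-+ _ _ ⟩
        - (suc n ·1 1#) + - (suc m ·1 1#) ≡⟨ +-comm _ _ ⟩
        - (suc m ·1 1#) + - (suc n ·1 1#) ∎

      *-homo : ∀ i j → ⟦ i ℤ.* j ⟧ ≡ ⟦ i ⟧ * ⟦ j ⟧
      *-homo (pos m)      (pos n)      = trans (cong ⟦_⟧ (sym (ℤ.pos-* m n))) (×1-homo-* m n)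
      *-homo (pos zero)   -[1+ n ]   = sym (zeroˡ _)
      *-homo (pos (suc m))  -[1+ n ]   = trans (cong -_ (×1-homo-* (suc m) (suc n))) (-‿distribʳ-* _ _)
      *-homo -[1+ m ]   (pos zero)   = trans (cong ⟦_⟧ (ℤ.*-zeroʳ -[1+ m ])) (sym (zeroʳ _))
      *-homo -[1+ m ]   (pos (suc n))  = trans (cong -_ (×1-homo-* (suc m) (suc n))) (-‿distribˡ-* _ _)
      *-homo -[1+ m ]   -[1+ n ]   = begin
        (suc m ℕ.* suc n) ·1 1# ≡⟨ ×1-homo-* (suc m) (suc n) ⟩
        (suc m ·1 1#) * (suc n ·1 1#) ≡⟨ sym (-‿involutive _) ⟩
        - - ((suc m ·1 1#) * (suc n ·1 1#)) ≡⟨ cong -_ (-‿distribˡ-* _ _) ⟩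
        - (- (suc m ·1 1#) * (suc n ·1 1#)) ≡⟨ -‿distribʳ-* _ _ ⟩
        - (suc m ·1 1#) * - (suc n ·1 1#) ∎

      neg-homo : ∀ i → ⟦ ℤ.- i ⟧ ≡ - ⟦ i ⟧
      neg-homo (pos zero)   = sym -0#≈0#
      neg-homo (pos (suc n))  = refl
      neg-homo -[1+ n ]   = sym (-‿involutive _)

    open import Algebra.Solver.Ring.AlmostCommutativeRing using (fromCommutativeRing; _-Raw-AlmostCommutative⟶_)

    morphism : CommutativeRing.rawRing ℤ.+-*-commutativeRing -Raw-AlmostCommutative⟶ fromCommutativeRing ring
    morphism = record
      { ⟦_⟧ = ⟦_⟧ ; +-homo = +-homo ; *-homo = *-homo ; -‿homo = neg-homo ; 0-homo = refl ; 1-homo = refl }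

    -- Only a sufficient test: distinct integers may agree in `F`, and then the answer is `nothing`.
    -- The solver thus works uniformly in the characteristic.
    _coeff≟_ : ∀ i j → Maybe (⟦ i ⟧ ≡ ⟦ j ⟧)
    i coeff≟ j with i ℤ.≟ j
    ... | yes eq = just (cong ⟦_⟧ eq)
    ... | no _   = nothing

  import Algebra.Solver.Ring
  module Solver = Algebra.Solver.Ring
    (CommutativeRing.rawRing ℤ.+-*-commutativeRing) (fromCommutativeRing ring) morphism _coeff≟_

  open Solver using (solve; _:+_; _:*_; :-_; _:=_; con)

  𝟘 𝟙 : ∀ {n} → Solver.Polynomial n
  𝟘 = con (pos 0)
  𝟙 = con (pos 1)

  1≢0 : 1# ≢ 0#
  1≢0 eq = 0≢1 (sym eq)

  -- The default value at `0#` makes normalisations such as `norm` and `hat` total functions on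
  -- vectors; the cancellation laws ask for a nonzero argument.
  inv : Fin q → Fin q
  inv x with x ≟ 0#
  ... | yes _  = 0#
  ... | no x≢0 = proj₁ (inverse x x≢0)

  inv-right : ∀ {x} → x ≢ 0# → x * inv x ≡ 1#
  inv-right {x} x≢0 with x ≟ 0#
  ... | yes x≡0  = ⊥-elim (x≢0 x≡0)
  ... | no  x≢0′ = proj₂ (inverse x x≢0′)

  inv-left : ∀ {x} → x ≢ 0# → inv x * x ≡ 1#
  inv-left x≢0 = trans (*-comm _ _) (inv-right x≢0)

  *-cancel-0 : ∀ {x y} → x ≢ 0# → x * y ≡ 0# → y ≡ 0#
  *-cancel-0 {x} {y} x≢0 xy≡0 = begin
    y ≡⟨ sym (*-identityˡ y) ⟩
    1# * y ≡⟨ cong (_* y) (sym (inv-left x≢0)) ⟩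
    inv x * x * y ≡⟨ *-assoc _ x y ⟩
    inv x * (x * y) ≡⟨ cong (inv x *_) xy≡0 ⟩
    inv x * 0# ≡⟨ zeroʳ _ ⟩
    0# ∎
    where open ≡-Reasoning

  inv≢0 : ∀ {x} → x ≢ 0# → inv x ≢ 0#
  inv≢0 x≢0 eq = 1≢0 (trans (sym (inv-right x≢0)) (trans (cong (_ *_) eq) (zeroʳ _)))

  *≢0 : ∀ {x y} → x ≢ 0# → y ≢ 0# → x * y ≢ 0#
  *≢0 x≢0 y≢0 eq = y≢0 (*-cancel-0 x≢0 eq)

  x-y≡0 : ∀ {x y} → x + - y ≡ 0# → x ≡ y
  x-y≡0 {x} {y} eq = trans (solve 2 (λ x y → x := (x :+ :- y) :+ y) refl x y) (trans (cong (_+ y) eq) (+-identityˡ y))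

-- The algebra of the scheme in coordinates

pattern 0F = zero
pattern 1F = suc zero
pattern 2F = suc (suc zero)
pattern 3F = suc (suc (suc zero))
pattern 4F = suc (suc (suc (suc zero)))

-- Elements of the algebra spanned by I, S, C, D = C S and J are given by their
-- coordinates, where S is the permutation matrix of σ, C = I + A₃, and
--   C² = a²(q−1) I − a² S + a(2−q) C + a D + a(a−1) J,  C J = valency J,  J² = order J.
-- The k-th character sends S to sign k, C to root k and J to weight k.  Working
-- over a raw ring lets the same formulas be read as polynomials by the solver.
module CoefficientAlgebra (𝓡 : RawRing 0ℓ 0ℓ) (a q : RawRing.Carrier 𝓡) where

  open RawRing 𝓡

  Coefficients : Set
  Coefficients = Fin 5 → Carrier

  coefficients : Carrier → Carrier → Carrier → Carrier → Carrier → Coefficients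
  coefficients i s c d j 0F = i
  coefficients i s c d j 1F = s
  coefficients i s c d j 2F = c
  coefficients i s c d j 3F = d
  coefficients i s c d j 4F = j

  -- The row sum of C, the size of Ω, and a common denominator of the projections: the root gaps are
  -- a(q + 1) where S = -1 and a(q - 1) where S = 1, the projections (I ± S)/2 give the 2, and J
  -- brings in `order`.
  2# valency order denominator : Carrier
  2#          = 1# + 1#
  valency     = a * (a * q + - q + 1#)
  order       = a * q * (a * q + - 1#)
  denominator = 2# * a * q * (q + - 1#) * (q + 1#) * (a * q + - 1#)

  -- Right multiplication by S and by C. Since S² = I, the former exchanges I with S and C with D;
  -- the latter is the formula for C², used also with a factor S.
  swap timesC : Coefficients → Coefficients
  swap t   = coefficients (t 1F) (t 0F) (t 3F) (t 2F) (t 4F)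
  timesC t = coefficients
    (a * a * (q + - 1#) * t 2F + - (a * a) * t 3F)
    (- (a * a) * t 2F + a * a * (q + - 1#) * t 3F)
    (t 0F + (a * (2# + - q) * t 2F + a * t 3F))
    (t 1F + (a * t 2F + a * (2# + - q) * t 3F))
    (a * (a + - 1#) * (t 2F + t 3F) + valency * t 4F)

  total : Coefficients → Carrier
  total t = t 0F + t 1F + valency * (t 2F + t 3F) + order * t 4F

  _⊛_ : Coefficients → Coefficients → Coefficients
  (t ⊛ u) k = u 0F * t k + u 1F * swap t k + u 2F * timesC t k + u 3F * swap (timesC t) k
              + u 4F * coefficients 0# 0# 0# 0# (total t) k

  -- Off the all-one vector the formula for C² factors: as (C - a)(C + a(q - 2)) = 0 where S = 1,
  -- and as (C - a)(C + aq) = 0 where S = -1. The order of the five entries is that of the rows of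
  -- the eigenmatrix.
  sign root weight : Fin 5 → Carrier
  sign = coefficients 1# (- 1#) 1# (- 1#) 1#
  root = coefficients valency (- (a * q)) a a (- (a * (q + - 2#)))
  weight = coefficients order 0# 0# 0# 0#

  character : Fin 5 → Coefficients → Carrier
  character k t = (t 0F + sign k * t 1F) + (t 2F + sign k * t 3F) * root k + t 4F * weight k

  -- denominator times the k-th minimal idempotent
  idempotent : Fin 5 → Coefficients
  idempotent 0F l = 2# * (q + - 1#) * (q + 1#) * coefficients 0# 0# 0# 0# 1# l
  idempotent 1F l = q * (q + - 1#) * (a * q + - 1#) * coefficients a (- a) (- 1#) 1# 0# l
  idempotent 2F l = (q + 1#) * (a * q + - 1#) * coefficients (a * q * (q + - 2#)) (a * q * (q + - 2#)) q q (- 2#) l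
  idempotent 3F l = q * (q + - 1#) * (a * q + - 1#) * coefficients (a * q) (- (a * q)) 1# (- 1#) 0# l
  idempotent 4F l = q * (q + 1#) * coefficients (a * (a * q + - 1#)) (a * (a * q + - 1#)) (- (a * q + - 1#)) (- (a * q + - 1#)) (2# * (a + - 1#)) l

  adjacency : Fin 5 → Coefficients
  adjacency 0F = coefficients 1# 0# 0# 0# 0#
  adjacency 1F = coefficients 0# (- 1#) 0# 1# 0#
  adjacency 2F = coefficients 0# 0# (- 1#) (- 1#) 1#
  adjacency 3F = coefficients (- 1#) 0# 1# 0# 0#
  adjacency 4F = coefficients 0# 1# 0# 0# 0#

  expansion : Coefficients → Coefficients
  expansion t l = character 0F t * idempotent 0F l + (character 1F t * idempotent 1F l + (character 2F t * idempotent 2F l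
                  + (character 3F t * idempotent 3F l + (character 4F t * idempotent 4F l + 0#))))

module _ where

  open Data.Integer.Solver.+-*-Solver using (Polynomial; solve; _:=_; _:+_; _:*_; :-_; con)

  polynomials : ℕ → RawRing 0ℓ 0ℓ
  polynomials n = record
    { Carrier = Polynomial n ; _≈_ = _≡_ ; _+_ = _:+_ ; _*_ = _:*_ ; -_ = :-_ ; 0# = con 0ℤ ; 1# = con 1ℤ }

  private
    eigenform : Fin 5 → Fin 5 → (a q i s c d j : Polynomial 7) → Polynomial 7 × Polynomial 7
    eigenform k l a q i s c d j = (idempotent k ⊛ u) l := character k u :* idempotent k l
      where
      open CoefficientAlgebra (polynomials 7) a q
      u = coefficients i s c d j

    expandform : Fin 5 → (a q i s c d j : Polynomial 7) → Polynomial 7 × Polynomial 7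
    expandform l a q i s c d j = expansion u l := denominator :* u l
      where
      open CoefficientAlgebra (polynomials 7) a q
      u = coefficients i s c d j

    orthoform : Fin 5 → Fin 5 → (a q : Polynomial 2) → Polynomial 2 × Polynomial 2
    orthoform k l a q = character k (idempotent l) := (if ⌊ k Fin.≟ l ⌋ then denominator else con 0ℤ)
      where open CoefficientAlgebra (polynomials 2) a q

  module ℤCoefficients (a q : ℤ) where

    open CoefficientAlgebra (CommutativeRing.rawRing ℤ.+-*-commutativeRing) a q public

    -- Together with `character-idempotent` this gives orthogonality. The cases are spelled out
    -- because `idempotent` and `coefficients` reduce only at concrete indices.
    idempotent-⊛ : ∀ k l u → (idempotent k ⊛ u) l ≡ character k u ℤ.* idempotent k l
    idempotent-⊛ 0F 0F u = solve 7 (eigenform 0F 0F) refl a q (u 0F) (u 1F) (u 2F) (u 3F) (u 4F)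
    idempotent-⊛ 0F 1F u = solve 7 (eigenform 0F 1F) refl a q (u 0F) (u 1F) (u 2F) (u 3F) (u 4F)
    idempotent-⊛ 0F 2F u = solve 7 (eigenform 0F 2F) refl a q (u 0F) (u 1F) (u 2F) (u 3F) (u 4F)
    idempotent-⊛ 0F 3F u = solve 7 (eigenform 0F 3F) refl a q (u 0F) (u 1F) (u 2F) (u 3F) (u 4F)
    idempotent-⊛ 0F 4F u = solve 7 (eigenform 0F 4F) refl a q (u 0F) (u 1F) (u 2F) (u 3F) (u 4F)
    idempotent-⊛ 1F 0F u = solve 7 (eigenform 1F 0F) refl a q (u 0F) (u 1F) (u 2F) (u 3F) (u 4F)
    idempotent-⊛ 1F 1F u = solve 7 (eigenform 1F 1F) refl a q (u 0F) (u 1F) (u 2F) (u 3F) (u 4F)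
    idempotent-⊛ 1F 2F u = solve 7 (eigenform 1F 2F) refl a q (u 0F) (u 1F) (u 2F) (u 3F) (u 4F)
    idempotent-⊛ 1F 3F u = solve 7 (eigenform 1F 3F) refl a q (u 0F) (u 1F) (u 2F) (u 3F) (u 4F)
    idempotent-⊛ 1F 4F u = solve 7 (eigenform 1F 4F) refl a q (u 0F) (u 1F) (u 2F) (u 3F) (u 4F)
    idempotent-⊛ 2F 0F u = solve 7 (eigenform 2F 0F) refl a q (u 0F) (u 1F) (u 2F) (u 3F) (u 4F)
    idempotent-⊛ 2F 1F u = solve 7 (eigenform 2F 1F) refl a q (u 0F) (u 1F) (u 2F) (u 3F) (u 4F)
    idempotent-⊛ 2F 2F u = solve 7 (eigenform 2F 2F) refl a q (u 0F) (u 1F) (u 2F) (u 3F) (u 4F)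
    idempotent-⊛ 2F 3F u = solve 7 (eigenform 2F 3F) refl a q (u 0F) (u 1F) (u 2F) (u 3F) (u 4F)
    idempotent-⊛ 2F 4F u = solve 7 (eigenform 2F 4F) refl a q (u 0F) (u 1F) (u 2F) (u 3F) (u 4F)
    idempotent-⊛ 3F 0F u = solve 7 (eigenform 3F 0F) refl a q (u 0F) (u 1F) (u 2F) (u 3F) (u 4F)
    idempotent-⊛ 3F 1F u = solve 7 (eigenform 3F 1F) refl a q (u 0F) (u 1F) (u 2F) (u 3F) (u 4F)
    idempotent-⊛ 3F 2F u = solve 7 (eigenform 3F 2F) refl a q (u 0F) (u 1F) (u 2F) (u 3F) (u 4F)
    idempotent-⊛ 3F 3F u = solve 7 (eigenform 3F 3F) refl a q (u 0F) (u 1F) (u 2F) (u 3F) (u 4F)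
    idempotent-⊛ 3F 4F u = solve 7 (eigenform 3F 4F) refl a q (u 0F) (u 1F) (u 2F) (u 3F) (u 4F)
    idempotent-⊛ 4F 0F u = solve 7 (eigenform 4F 0F) refl a q (u 0F) (u 1F) (u 2F) (u 3F) (u 4F)
    idempotent-⊛ 4F 1F u = solve 7 (eigenform 4F 1F) refl a q (u 0F) (u 1F) (u 2F) (u 3F) (u 4F)
    idempotent-⊛ 4F 2F u = solve 7 (eigenform 4F 2F) refl a q (u 0F) (u 1F) (u 2F) (u 3F) (u 4F)
    idempotent-⊛ 4F 3F u = solve 7 (eigenform 4F 3F) refl a q (u 0F) (u 1F) (u 2F) (u 3F) (u 4F)
    idempotent-⊛ 4F 4F u = solve 7 (eigenform 4F 4F) refl a q (u 0F) (u 1F) (u 2F) (u 3F) (u 4F)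

    -- Holds already for coordinate vectors, before any matrix is formed; evaluating both sides on Ω
    -- gives the spectral decomposition.
    expansion-correct : ∀ u l → expansion u l ≡ denominator ℤ.* u l
    expansion-correct u 0F = solve 7 (expandform 0F) refl a q (u 0F) (u 1F) (u 2F) (u 3F) (u 4F)
    expansion-correct u 1F = solve 7 (expandform 1F) refl a q (u 0F) (u 1F) (u 2F) (u 3F) (u 4F)
    expansion-correct u 2F = solve 7 (expandform 2F) refl a q (u 0F) (u 1F) (u 2F) (u 3F) (u 4F)
    expansion-correct u 3F = solve 7 (expandform 3F) refl a q (u 0F) (u 1F) (u 2F) (u 3F) (u 4F)
    expansion-correct u 4F = solve 7 (expandform 4F) refl a q (u 0F) (u 1F) (u 2F) (u 3F) (u 4F)

    character-idempotent : ∀ k l → character k (idempotent l) ≡ (if ⌊ k Fin.≟ l ⌋ then denominator else 0ℤ)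
    character-idempotent 0F 0F = solve 2 (orthoform 0F 0F) refl a q
    character-idempotent 0F 1F = solve 2 (orthoform 0F 1F) refl a q
    character-idempotent 0F 2F = solve 2 (orthoform 0F 2F) refl a q
    character-idempotent 0F 3F = solve 2 (orthoform 0F 3F) refl a q
    character-idempotent 0F 4F = solve 2 (orthoform 0F 4F) refl a q
    character-idempotent 1F 0F = solve 2 (orthoform 1F 0F) refl a q
    character-idempotent 1F 1F = solve 2 (orthoform 1F 1F) refl a q
    character-idempotent 1F 2F = solve 2 (orthoform 1F 2F) refl a q
    character-idempotent 1F 3F = solve 2 (orthoform 1F 3F) refl a q
    character-idempotent 1F 4F = solve 2 (orthoform 1F 4F) refl a q
    character-idempotent 2F 0F = solve 2 (orthoform 2F 0F) refl a q
    character-idempotent 2F 1F = solve 2 (orthoform 2F 1F) refl a q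
    character-idempotent 2F 2F = solve 2 (orthoform 2F 2F) refl a q
    character-idempotent 2F 3F = solve 2 (orthoform 2F 3F) refl a q
    character-idempotent 2F 4F = solve 2 (orthoform 2F 4F) refl a q
    character-idempotent 3F 0F = solve 2 (orthoform 3F 0F) refl a q
    character-idempotent 3F 1F = solve 2 (orthoform 3F 1F) refl a q
    character-idempotent 3F 2F = solve 2 (orthoform 3F 2F) refl a q
    character-idempotent 3F 3F = solve 2 (orthoform 3F 3F) refl a q
    character-idempotent 3F 4F = solve 2 (orthoform 3F 4F) refl a q
    character-idempotent 4F 0F = solve 2 (orthoform 4F 0F) refl a q
    character-idempotent 4F 1F = solve 2 (orthoform 4F 1F) refl a q
    character-idempotent 4F 2F = solve 2 (orthoform 4F 2F) refl a q
    character-idempotent 4F 3F = solve 2 (orthoform 4F 3F) refl a q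
    character-idempotent 4F 4F = solve 2 (orthoform 4F 4F) refl a q

open import Data.Integer using (_+_; _*_; _-_; -_)

-- Finite sums

-- With integer-valued indicators, intersections become products and complements differences from 1,
-- so counting reduces to ring identities.
ι : Bool → ℤ
ι true  = 1ℤ
ι false = 0ℤ

module _ {P : Set} where

  ι-yes : (d : Dec P) → P → ι ⌊ d ⌋ ≡ 1ℤ
  ι-yes (yes _) p = refl
  ι-yes (no ¬p) p = ⊥-elim (¬p p)

  ι-no : (d : Dec P) → ¬ P → ι ⌊ d ⌋ ≡ 0ℤ
  ι-no (yes p) ¬p = ⊥-elim (¬p p)
  ι-no (no _)  ¬p = refl

ι-⇔ : {P Q : Set} (d : Dec P) (e : Dec Q) → (P → Q) → (Q → P) → ι ⌊ d ⌋ ≡ ι ⌊ e ⌋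
ι-⇔ (yes p) e f g = sym (ι-yes e (f p))
ι-⇔ (no ¬p) e f g = sym (ι-no e (λ q → ¬p (g q)))

ι-∧ : ∀ x y → ι (x ∧ y) ≡ ι x * ι y
ι-∧ true  y = sym (ℤ.*-identityˡ _)
ι-∧ false y = refl

ι-not : ∀ x → ι (not x) ≡ 1ℤ - ι x
ι-not true  = refl
ι-not false = refl

ι-idem : ∀ x → ι x * ι x ≡ ι x
ι-idem true  = refl
ι-idem false = refl

module _ {A : Set} where

  ∑ : List A → (A → ℤ) → ℤ
  ∑ []       f = 0ℤ
  ∑ (x ∷ xs) f = f x + ∑ xs f

  ∑-cong∈ : ∀ xs {f g : A → ℤ} → (∀ x → x ∈ xs → f x ≡ g x) → ∑ xs f ≡ ∑ xs g
  ∑-cong∈ []       eq = refl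
  ∑-cong∈ (x ∷ xs) eq = cong₂ _+_ (eq x (here refl)) (∑-cong∈ xs (λ y y∈ → eq y (there y∈)))

  ∑-cong : ∀ xs {f g : A → ℤ} → (∀ x → f x ≡ g x) → ∑ xs f ≡ ∑ xs g
  ∑-cong xs eq = ∑-cong∈ xs (λ x _ → eq x)

  ∑-+ : ∀ xs (f g : A → ℤ) → ∑ xs (λ x → f x + g x) ≡ ∑ xs f + ∑ xs g
  ∑-+ []       f g = refl
  ∑-+ (x ∷ xs) f g = trans (cong (f x + g x +_) (∑-+ xs f g)) (shuffle (f x) (g x) (∑ xs f) (∑ xs g))
    where
    shuffle : ∀ a b c d → a + b + (c + d) ≡ a + c + (b + d)
    shuffle = solve-∀

  ∑-*ˡ : ∀ xs c (f : A → ℤ) → ∑ xs (λ x → c * f x) ≡ c * ∑ xs f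
  ∑-*ˡ []       c f = sym (ℤ.*-zeroʳ c)
  ∑-*ˡ (x ∷ xs) c f = trans (cong (c * f x +_) (∑-*ˡ xs c f)) (sym (ℤ.*-distribˡ-+ c (f x) _))

  ∑-*ʳ : ∀ xs c (f : A → ℤ) → ∑ xs (λ x → f x * c) ≡ ∑ xs f * c
  ∑-*ʳ xs c f = trans (∑-cong xs (λ x → ℤ.*-comm (f x) c)) (trans (∑-*ˡ xs c f) (ℤ.*-comm c _))

  ∑-const : ∀ xs c → ∑ xs (λ _ → c) ≡ pos (length xs) * c
  ∑-const []       c = refl
  ∑-const (x ∷ xs) c = trans (cong (c +_) (∑-const xs c)) (sym (ℤ.suc-* (pos (length xs)) c))

  ∑-zero : ∀ xs → ∑ xs (λ _ → 0ℤ) ≡ 0ℤ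
  ∑-zero xs = trans (∑-const xs 0ℤ) (ℤ.*-zeroʳ (pos (length xs)))

  ∑-++ : ∀ xs ys (f : A → ℤ) → ∑ (xs ++ ys) f ≡ ∑ xs f + ∑ ys f
  ∑-++ []       ys f = sym (ℤ.+-identityˡ _)
  ∑-++ (x ∷ xs) ys f = trans (cong (f x +_) (∑-++ xs ys f)) (sym (ℤ.+-assoc (f x) _ _))

  ∑-nonneg : ∀ xs {f : A → ℤ} → (∀ x → 0ℤ ℤ.≤ f x) → 0ℤ ℤ.≤ ∑ xs f
  ∑-nonneg []       f≥0 = ℤ.≤-refl
  ∑-nonneg (x ∷ xs) f≥0 = ℤ.+-mono-≤ (f≥0 x) (∑-nonneg xs f≥0)

  -- Serves two purposes: a vanishing variance forces every deviation to vanish, and five relation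
  -- indicators of total 1 leave no room for a second relation.
  ∑≡0⇒≡0 : ∀ xs {f : A → ℤ} → (∀ x → 0ℤ ℤ.≤ f x) → ∑ xs f ≡ 0ℤ → ∀ {x} → x ∈ xs → f x ≡ 0ℤ
  ∑≡0⇒≡0 (y ∷ xs) {f} f≥0 eq = λ where
      (here refl) → head≡0
      (there x∈)  → ∑≡0⇒≡0 xs f≥0 (trans (sym (trans (cong (_+ ∑ xs f) head≡0) (ℤ.+-identityˡ _))) eq) x∈
    where
    head≡0 : f y ≡ 0ℤ
    head≡0 = ℤ.≤-antisym
      (subst (f y ℤ.≤_) eq (subst (ℤ._≤ f y + ∑ xs f) (ℤ.+-identityʳ (f y)) (ℤ.+-monoʳ-≤ (f y) (∑-nonneg xs f≥0))))
      (f≥0 y)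

  ∑-filter : (p : A → Bool) → ∀ xs (f : A → ℤ) →
             ∑ (filter (λ x → p x Bool.≟ true) xs) f ≡ ∑ xs (λ x → ι (p x) * f x)
  ∑-filter p []       f = refl
  ∑-filter p (x ∷ xs) f with p x
  ... | true  = cong₂ _+_ (sym (ℤ.*-identityˡ (f x))) (∑-filter p xs f)
  ... | false = trans (∑-filter p xs f) (sym (ℤ.+-identityˡ _))

  length-filter : (p : A → Bool) → ∀ xs →
                  pos (length (filter (λ x → p x Bool.≟ true) xs)) ≡ ∑ xs (λ x → ι (p x))
  length-filter p xs =
    trans (sym (ℤ.*-identityʳ _))
      (trans (sym (∑-const (filter (λ x → p x Bool.≟ true) xs) 1ℤ))
        (trans (∑-filter p xs (λ _ → 1ℤ)) (∑-cong xs (λ x → ℤ.*-identityʳ _))))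

module _ {A B : Set} where

  ∑-swap : ∀ (xs : List A) (ys : List B) (f : A → B → ℤ) →
           ∑ xs (λ x → ∑ ys (f x)) ≡ ∑ ys (λ y → ∑ xs (λ x → f x y))
  ∑-swap []       ys f = sym (∑-zero ys)
  ∑-swap (x ∷ xs) ys f = trans (cong (∑ ys (f x) +_) (∑-swap xs ys f)) (sym (∑-+ ys (f x) _))

  ∑-map : ∀ (g : A → B) xs (f : B → ℤ) → ∑ (map g xs) f ≡ ∑ xs (λ x → f (g x))
  ∑-map g []       f = refl
  ∑-map g (x ∷ xs) f = cong (f (g x) +_) (∑-map g xs f)

  ∑-concatMap : ∀ (g : A → List B) xs (f : B → ℤ) → ∑ (concatMap g xs) f ≡ ∑ xs (λ x → ∑ (g x) f)
  ∑-concatMap g []       f = refl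
  ∑-concatMap g (x ∷ xs) f = trans (∑-++ (g x) _ f) (cong (∑ (g x) f +_) (∑-concatMap g xs f))

module _ {A B : Set} where

  ∑-cartesianProduct : ∀ (xs : List A) (ys : List B) (f : A × B → ℤ) →
                       ∑ (cartesianProduct xs ys) f ≡ ∑ xs (λ x → ∑ ys (λ y → f (x , y)))
  ∑-cartesianProduct []       ys f = refl
  ∑-cartesianProduct (x ∷ xs) ys f =
    trans (∑-++ (map (x ,_) ys) _ f) (cong₂ _+_ (∑-map (x ,_) ys f) (∑-cartesianProduct xs ys f))

-- `once` expresses completeness and absence of repetitions in one equation, in the form that
-- evaluates sums containing a delta.
record Enumeration (A : Set) : Set where
  infix 4 _≟ᵉ_
  field
    elements : List A
    _≟ᵉ_     : DecidableEquality A
    once     : ∀ x → ∑ elements (λ y → ι ⌊ y ≟ᵉ x ⌋) ≡ 1ℤ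

  open import Data.List.Membership.DecPropositional _≟ᵉ_ using (_∈?_)

  ∑-δ : ∀ x (f : A → ℤ) → ∑ elements (λ y → ι ⌊ y ≟ᵉ x ⌋ * f y) ≡ f x
  ∑-δ x f = begin
    ∑ elements (λ y → ι ⌊ y ≟ᵉ x ⌋ * f y) ≡⟨ ∑-cong elements at ⟩
    ∑ elements (λ y → ι ⌊ y ≟ᵉ x ⌋ * f x) ≡⟨ ∑-*ʳ elements (f x) _ ⟩
    ∑ elements (λ y → ι ⌊ y ≟ᵉ x ⌋) * f x ≡⟨ cong (_* f x) (once x) ⟩
    1ℤ * f x ≡⟨ ℤ.*-identityˡ (f x) ⟩
    f x ∎
    where
    open ≡-Reasoning
    at : ∀ y → ι ⌊ y ≟ᵉ x ⌋ * f y ≡ ι ⌊ y ≟ᵉ x ⌋ * f x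
    at y with y ≟ᵉ x
    ... | yes refl = refl
    ... | no _     = refl

  ∑-unique : ∀ x (f : A → ℤ) → (∀ y → y ≢ x → f y ≡ 0ℤ) → ∑ elements f ≡ f x
  ∑-unique x f vanish = trans (∑-cong elements at) (∑-δ x f)
    where
    at : ∀ y → f y ≡ ι ⌊ y ≟ᵉ x ⌋ * f y
    at y with y ≟ᵉ x
    ... | yes _  = sym (ℤ.*-identityˡ _)
    ... | no y≢x = vanish y y≢x

  -- Insert the delta y = π x and exchange the sums; for fixed y only x = π⁻¹ y is left.
  ∑-reindex : (π π⁻¹ : A → A) → (∀ x → π (π⁻¹ x) ≡ x) → (∀ x → π⁻¹ (π x) ≡ x) →
              ∀ (f : A → ℤ) → ∑ elements (λ x → f (π x)) ≡ ∑ elements f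
  ∑-reindex π π⁻¹ invʳ invˡ f = begin
    ∑ elements (λ x → f (π x))
      ≡⟨ ∑-cong elements (λ x → sym (∑-δ (π x) f)) ⟩
    ∑ elements (λ x → ∑ elements (λ y → ι ⌊ y ≟ᵉ π x ⌋ * f y))
      ≡⟨ ∑-swap elements elements _ ⟩
    ∑ elements (λ y → ∑ elements (λ x → ι ⌊ y ≟ᵉ π x ⌋ * f y))
      ≡⟨ ∑-cong elements (λ y → trans (∑-*ʳ elements (f y) _) (cong (_* f y)
           (∑-cong elements (λ x → ι-⇔ (y ≟ᵉ π x) (x ≟ᵉ π⁻¹ y)
             (λ e → trans (sym (invˡ x)) (cong π⁻¹ (sym e)))
             (λ e → trans (sym (invʳ y)) (cong π (sym e))))))) ⟩
    ∑ elements (λ y → ∑ elements (λ x → ι ⌊ x ≟ᵉ π⁻¹ y ⌋) * f y)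
      ≡⟨ ∑-cong elements (λ y → trans (cong (_* f y) (once (π⁻¹ y))) (ℤ.*-identityˡ (f y))) ⟩
    ∑ elements f ∎
    where open ≡-Reasoning

  listed : ∀ x → x ∈ elements
  listed x with x ∈? elements
  ... | yes x∈ = x∈
  ... | no x∉  = ⊥-elim (0≢1 (trans (sym absent) (once x)))
    where
    0≢1 : 0ℤ ≢ 1ℤ
    0≢1 ()
    absent : ∑ elements (λ y → ι ⌊ y ≟ᵉ x ⌋) ≡ 0ℤ
    absent = trans (∑-cong∈ elements (λ y y∈ → ι-no (y ≟ᵉ x) (λ eq → x∉ (subst (_∈ elements) eq y∈)))) (∑-zero elements)

-- Counting in quadratic spaces

allFin-once : ∀ n (x : Fin n) → ∑ (allFin n) (λ y → ι ⌊ y ≟ x ⌋) ≡ 1ℤ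
allFin-once (suc n) x = begin
  ι ⌊ Fin.zero ≟ x ⌋ + ∑ (tabulate Fin.suc) (λ y → ι ⌊ y ≟ x ⌋)
    ≡⟨ cong (λ l → ι ⌊ Fin.zero ≟ x ⌋ + ∑ l (λ y → ι ⌊ y ≟ x ⌋)) (sym (List.map-tabulate id Fin.suc)) ⟩
  ι ⌊ Fin.zero ≟ x ⌋ + ∑ (map Fin.suc (allFin n)) (λ y → ι ⌊ y ≟ x ⌋)
    ≡⟨ cong (ι ⌊ Fin.zero ≟ x ⌋ +_) (∑-map Fin.suc (allFin n) _) ⟩
  ι ⌊ Fin.zero ≟ x ⌋ + ∑ (allFin n) (λ y → ι ⌊ Fin.suc y ≟ x ⌋)
    ≡⟨ split x ⟩
  1ℤ ∎
  where
  open ≡-Reasoning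
  split : ∀ x → ι ⌊ Fin.zero ≟ x ⌋ + ∑ (allFin n) (λ y → ι ⌊ Fin.suc y ≟ x ⌋) ≡ 1ℤ
  split Fin.zero    = cong (1ℤ +_) (∑-zero (allFin n))
  split (Fin.suc x) = trans (ℤ.+-identityˡ _)
    (trans (∑-cong (allFin n) (λ y → ι-⇔ (Fin.suc y ≟ Fin.suc x) (y ≟ x) Fin.suc-injective (cong Fin.suc)))
           (allFin-once n x))

finEnumeration : ∀ n → Enumeration (Fin n)
finEnumeration n = record { elements = allFin n ; _≟ᵉ_ = _≟_ ; once = allFin-once n }

square-nonneg : ∀ i → 0ℤ ℤ.≤ i * i
square-nonneg (pos n)      = subst (0ℤ ℤ.≤_) (ℤ.pos-* n n) (ℤ.+≤+ ℕ.z≤n)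
square-nonneg ℤ.-[1+ n ]   = ℤ.+≤+ ℕ.z≤n

square≡0 : ∀ i → i * i ≡ 0ℤ → i ≡ 0ℤ
square≡0 i eq with ℤ.i*j≡0⇒i≡0∨j≡0 i eq
... | inj₁ p = p
... | inj₂ p = p

module FieldSums {q : ℕ} (F : FiniteField q) where

  open FieldLemmas F public
    renaming (_+_ to _+ᶠ_; _*_ to _*ᶠ_; -_ to -ᶠ_)
  open Solver using (solve; _:+_; _:*_; :-_; _:=_)

  private
    module 𝔽 = Enumeration (finEnumeration q)

  ∑F : (Fin q → ℤ) → ℤ
  ∑F = ∑ (allFin q)

  qz : ℤ
  qz = pos q

  z : Fin q → ℤ
  z x = ι ⌊ x ≟ 0# ⌋

  ∑F-const : ∀ c → ∑F (λ _ → c) ≡ qz * c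
  ∑F-const c = trans (∑-const (allFin q) c) (cong (λ k → pos k * c) (List.length-tabulate {n = q} id))

  -- The element `0#` of `Fin q` shows that q is a successor, and matching on it exposes the nonzero
  -- factor to be cancelled.
  q-cancel : ∀ {x y} → qz * x ≡ qz * y → x ≡ y
  q-cancel {x} {y} eq = go q 0# refl
    where
    go : ∀ k → Fin k → k ≡ q → x ≡ y
    go (suc k) _ refl = ℤ.*-cancelˡ-≡ qz x y eq

  z≡1 : ∀ {x} → x ≡ 0# → z x ≡ 1ℤ
  z≡1 {x} = ι-yes (x ≟ 0#)

  z≡0 : ∀ {x} → x ≢ 0# → z x ≡ 0ℤ
  z≡0 {x} = ι-no (x ≟ 0#)

  z-scale : ∀ {s} x → s ≢ 0# → z (s *ᶠ x) ≡ z x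
  z-scale {s} x s≢0 = ι-⇔ (s *ᶠ x ≟ 0#) (x ≟ 0#) (*-cancel-0 s≢0) (λ e → trans (cong (s *ᶠ_) e) (zeroʳ s))

  -- One root if b is nonzero, otherwise all or none according to a. Written as a polynomial in
  -- indicators it can be summed again; `hyperplane-sum`, `cone-sum` and `hyperbola` all rest on it.
  linear-roots : ∀ a b → ∑F (λ t → z (a +ᶠ t *ᶠ b)) ≡ (1ℤ - z b) + qz * (z b * z a)
  linear-roots a b with b ≟ 0#
  ... | yes refl = begin
      ∑F (λ t → z (a +ᶠ t *ᶠ 0#)) ≡⟨ ∑-cong (allFin q) (λ t → cong z (solve 2 (λ a t → a :+ t :* 𝟘 := a) refl a t)) ⟩
      ∑F (λ t → z a) ≡⟨ ∑F-const (z a) ⟩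
      qz * z a ≡⟨ ring₁ qz (z a) ⟩
      (1ℤ - 1ℤ) + qz * (1ℤ * z a) ∎
    where
    open ≡-Reasoning
    ring₁ : ∀ x y → x * y ≡ (1ℤ - 1ℤ) + x * (1ℤ * y)
    ring₁ = solve-∀
  ... | no b≢0 = begin
      ∑F (λ t → z (a +ᶠ t *ᶠ b)) ≡⟨ ∑-cong (allFin q) (λ t → ι-⇔ (a +ᶠ t *ᶠ b ≟ 0#) (t ≟ root) (to t) (from t)) ⟩
      ∑F (λ t → ι ⌊ t ≟ root ⌋) ≡⟨ 𝔽.once root ⟩
      1ℤ ≡⟨ ring₁ qz (z a) ⟩
      (1ℤ - 0ℤ) + qz * (0ℤ * z a) ∎
    where
    open ≡-Reasoning
    root : Fin q
    root = (-ᶠ a) *ᶠ inv b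
    ring₁ : ∀ x y → 1ℤ ≡ (1ℤ - 0ℤ) + x * (0ℤ * y)
    ring₁ = solve-∀
    to : ∀ t → a +ᶠ t *ᶠ b ≡ 0# → t ≡ root
    to t eq = begin
      t ≡⟨ sym (*-identityʳ t) ⟩
      t *ᶠ 1# ≡⟨ cong (t *ᶠ_) (sym (inv-right b≢0)) ⟩
      t *ᶠ (b *ᶠ inv b) ≡⟨ solve 4 (λ a t b i → t :* (b :* i) := (a :+ t :* b) :* i :+ (:- a) :* i) refl a t b (inv b) ⟩
      (a +ᶠ t *ᶠ b) *ᶠ inv b +ᶠ root ≡⟨ cong (λ x → x *ᶠ inv b +ᶠ root) eq ⟩
      0# *ᶠ inv b +ᶠ root ≡⟨ cong (_+ᶠ root) (zeroˡ _) ⟩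
      0# +ᶠ root ≡⟨ +-identityˡ root ⟩
      root ∎
    from : ∀ t → t ≡ root → a +ᶠ t *ᶠ b ≡ 0#
    from t refl = begin
      a +ᶠ (-ᶠ a) *ᶠ inv b *ᶠ b ≡⟨ solve 3 (λ a b i → a :+ (:- a) :* i :* b := a :+ :- (a :* (i :* b))) refl a b (inv b) ⟩
      a +ᶠ -ᶠ (a *ᶠ (inv b *ᶠ b)) ≡⟨ cong (λ x → a +ᶠ -ᶠ (a *ᶠ x)) (inv-left b≢0) ⟩
      a +ᶠ -ᶠ (a *ᶠ 1#) ≡⟨ solve 1 (λ a → a :+ :- (a :* 𝟙) := 𝟘) refl a ⟩
      0# ∎

  units-sum : ∑F (λ t → 1ℤ - z t) ≡ qz - 1ℤ
  units-sum = begin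
    ∑F (λ t → 1ℤ - z t) ≡⟨ ∑-+ (allFin q) (λ _ → 1ℤ) (λ t → - z t) ⟩
    ∑F (λ t → 1ℤ) + ∑F (λ t → - z t) ≡⟨ cong₂ _+_ (trans (∑F-const 1ℤ) (ℤ.*-identityʳ qz))
                                                 (trans (∑-cong (allFin q) (λ t → sym (ℤ.-1*i≡-i (z t)))) (∑-*ˡ (allFin q) ℤ.-1ℤ z)) ⟩
    qz + ℤ.-1ℤ * ∑F z ≡⟨ cong (λ x → qz + ℤ.-1ℤ * x) (𝔽.once 0#) ⟩
    qz - 1ℤ ∎
    where open ≡-Reasoning

-- The vector space laws appear only in the shapes in which the counting applies them; other vector
-- identities come from `nondegenerate` by comparing products. Q and B are separate data tied by
-- `Q-⊕` and `B-diagonal`, which suits characteristic 2.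
record QuadraticSpace {q : ℕ} (F : FiniteField q) : Set₁ where
  open FiniteField F using (0#; 1#) renaming (_+_ to _+ᶠ_; _*_ to _*ᶠ_; -_ to -ᶠ_)
  infixl 6 _⊕_
  infixr 7 _⊙_
  field
    V           : Set
    enumeration : Enumeration V
    _⊕_         : V → V → V
    _⊙_         : Fin q → V → V
    0v          : V
    Q           : V → Fin q
    B           : V → V → Fin q
    B-sym       : ∀ u v → B u v ≡ B v u
    B-⊕         : ∀ u v w → B (u ⊕ v) w ≡ B u w +ᶠ B v w
    B-⊙         : ∀ s v w → B (s ⊙ v) w ≡ s *ᶠ B v w
    B-0v        : ∀ w → B 0v w ≡ 0#
    B-diagonal  : ∀ v → B v v ≡ Q v +ᶠ Q v
    Q-⊕         : ∀ u v → Q (u ⊕ v) ≡ (Q u +ᶠ Q v) +ᶠ B u v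
    Q-⊙         : ∀ s v → Q (s ⊙ v) ≡ (s *ᶠ s) *ᶠ Q v
    Q-0v        : Q 0v ≡ 0#
    translate   : ∀ v t e → (v ⊕ t ⊙ e) ⊕ (-ᶠ t) ⊙ e ≡ v
    difference  : ∀ u s v → u ⊕ (-ᶠ s) ⊙ v ≡ 0v → u ≡ s ⊙ v
    cancel      : ∀ s v → s ⊙ v ⊕ (-ᶠ s) ⊙ v ≡ 0v
    ⊙-identity  : ∀ v → 1# ⊙ v ≡ v
    nondegenerate : ∀ v → v ≢ 0v → ∃[ e ] (B e v ≡ 1#)

module Counting {q : ℕ} {F : FiniteField q} (𝒱 : QuadraticSpace F) where

  open QuadraticSpace 𝒱 public
  open FieldSums F public
  open Solver using (solve; _:+_; _:*_; :-_; _:=_)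
  open Enumeration enumeration public using () renaming (_≟ᵉ_ to _≟ᵛ_)

  private
    module 𝕍 = Enumeration enumeration

  ∑V : (V → ℤ) → ℤ
  ∑V = ∑ 𝕍.elements

  Invariant : V → (V → ℤ) → Set
  Invariant e h = ∀ t v → h (v ⊕ t ⊙ e) ≡ h v

  translate′ : ∀ v t e → (v ⊕ (-ᶠ t) ⊙ e) ⊕ t ⊙ e ≡ v
  translate′ v t e = trans (cong (λ s → (v ⊕ (-ᶠ t) ⊙ e) ⊕ s ⊙ e) (sym (-‿involutive t))) (translate v (-ᶠ t) e)

  -- Each translation by t ⊙ e permutes the space; adding up the q translated sums gives the factor.
  average : ∀ e f → qz * ∑V f ≡ ∑V (λ v → ∑F (λ t → f (v ⊕ t ⊙ e)))
  average e f = begin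
    qz * ∑V f ≡⟨ sym (∑F-const (∑V f)) ⟩
    ∑F (λ t → ∑V f) ≡⟨ ∑-cong (allFin q) (λ t → sym (𝕍.∑-reindex (_⊕ t ⊙ e) (_⊕ (-ᶠ t) ⊙ e)
                                                   (λ v → translate′ v t e) (λ v → translate v t e) f)) ⟩
    ∑F (λ t → ∑V (λ v → f (v ⊕ t ⊙ e))) ≡⟨ ∑-swap (allFin q) 𝕍.elements _ ⟩
    ∑V (λ v → ∑F (λ t → f (v ⊕ t ⊙ e))) ∎
    where open ≡-Reasoning

  average-invariant : ∀ {e h} → Invariant e h → ∀ (f : V → ℤ) →
    qz * ∑V (λ v → h v * f v) ≡ ∑V (λ v → h v * ∑F (λ t → f (v ⊕ t ⊙ e)))
  average-invariant {e} {h} h-inv f = trans (average e _) (∑-cong 𝕍.elements (λ v →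
    trans (∑-cong (allFin q) (λ t → cong (_* f (v ⊕ t ⊙ e)) (h-inv t v))) (∑-*ˡ (allFin q) (h v) _)))

  B-line : ∀ v t e w → B (v ⊕ t ⊙ e) w ≡ B v w +ᶠ t *ᶠ B e w
  B-line v t e w = trans (B-⊕ v _ w) (cong (B v w +ᶠ_) (B-⊙ t e w))

  B-lineʳ : ∀ v t e w → B w (v ⊕ t ⊙ e) ≡ B w v +ᶠ t *ᶠ B w e
  B-lineʳ v t e w = trans (B-sym w _) (trans (B-line v t e w) (cong₂ (λ x y → x +ᶠ t *ᶠ y) (B-sym v w) (B-sym e w)))

  B-line-⊥ : ∀ {e w} → B e w ≡ 0# → ∀ t v → B (v ⊕ t ⊙ e) w ≡ B v w
  B-line-⊥ {e} {w} e⊥w t v = trans (B-line v t e w)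
    (trans (cong (λ x → B v w +ᶠ t *ᶠ x) e⊥w) (solve 2 (λ b t → b :+ t :* 𝟘 := b) refl (B v w) t))

  Q-line : ∀ {e} → Q e ≡ 0# → ∀ t v → Q (v ⊕ t ⊙ e) ≡ Q v +ᶠ t *ᶠ B v e
  Q-line {e} Qe t v = begin
    Q (v ⊕ t ⊙ e) ≡⟨ Q-⊕ v _ ⟩
    (Q v +ᶠ Q (t ⊙ e)) +ᶠ B v (t ⊙ e) ≡⟨ cong₂ (λ x y → (Q v +ᶠ x) +ᶠ y)
                                                  (trans (Q-⊙ t e) (cong (t *ᶠ t *ᶠ_) Qe))
                                                  (trans (B-sym v _) (trans (B-⊙ t e v) (cong (t *ᶠ_) (B-sym e v)))) ⟩
    (Q v +ᶠ t *ᶠ t *ᶠ 0#) +ᶠ t *ᶠ B v e ≡⟨ solve 3 (λ a t b → (a :+ t :* t :* 𝟘) :+ t :* b := a :+ t :* b) refl (Q v) t (B v e) ⟩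
    Q v +ᶠ t *ᶠ B v e ∎
    where open ≡-Reasoning

  B-self : ∀ {e} → Q e ≡ 0# → B e e ≡ 0#
  B-self {e} Qe = trans (B-diagonal e) (trans (cong₂ _+ᶠ_ Qe Qe) (+-identityˡ 0#))

  1-invariant : ∀ {e} → Invariant e (λ _ → 1ℤ)
  1-invariant t v = refl

  ⊥-invariant : ∀ {e w} → B e w ≡ 0# → Invariant e (λ v → z (B v w))
  ⊥-invariant e⊥w t v = cong z (B-line-⊥ e⊥w t v)

  *-invariant : ∀ {e h k} → Invariant e h → Invariant e k → Invariant e (λ v → h v * k v)
  *-invariant h-inv k-inv t v = cong₂ _*_ (h-inv t v) (k-inv t v)

  -- For singular e, Q (v + t e) = Q v + t B(v, e), which is Q v on e^⊥; off e^⊥ both products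
  -- vanish.
  cone-invariant : ∀ {e} → Q e ≡ 0# → Invariant e (λ v → z (B v e) * z (Q v))
  cone-invariant {e} Qe t v = go (B v e ≟ 0#)
    where
    shift : z (B (v ⊕ t ⊙ e) e) ≡ z (B v e)
    shift = ⊥-invariant (B-self Qe) t v
    go : _ → z (B (v ⊕ t ⊙ e) e) * z (Q (v ⊕ t ⊙ e)) ≡ z (B v e) * z (Q v)
    go (yes v⊥e) = cong₂ _*_ shift (cong z (trans (Q-line Qe t v)
      (trans (cong (λ x → Q v +ᶠ t *ᶠ x) v⊥e) (solve 2 (λ a t → a :+ t :* 𝟘 := a) refl (Q v) t))))
    go (no v⊥̸e)  = trans (cong (_* z (Q (v ⊕ t ⊙ e))) (trans shift (z≡0 v⊥̸e)))
      (sym (cong (_* z (Q v)) (z≡0 v⊥̸e)))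

  -- Every line in direction e meets w^⊥ exactly once, so w^⊥ carries one q-th of a weight that is
  -- constant on these lines.
  hyperplane-sum : ∀ {e w h} → Invariant e h → B e w ≢ 0# → qz * ∑V (λ v → h v * z (B v w)) ≡ ∑V h
  hyperplane-sum {e} {w} {h} h-inv e⊥̸w = trans (average-invariant h-inv _) (∑-cong 𝕍.elements at)
    where
    open ≡-Reasoning
    ring₁ : ∀ x q y → x * (1ℤ - 0ℤ + q * (0ℤ * y)) ≡ x
    ring₁ = solve-∀
    at : ∀ v → h v * ∑F (λ t → z (B (v ⊕ t ⊙ e) w)) ≡ h v
    at v = begin
      h v * ∑F (λ t → z (B (v ⊕ t ⊙ e) w)) ≡⟨ cong (h v *_) (∑-cong (allFin q) (λ t → cong z (B-line v t e w))) ⟩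
      h v * ∑F (λ t → z (B v w +ᶠ t *ᶠ B e w)) ≡⟨ cong (h v *_) (linear-roots (B v w) (B e w)) ⟩
      h v * (1ℤ - z (B e w) + qz * (z (B e w) * z (B v w))) ≡⟨ cong (λ x → h v * (1ℤ - x + qz * (x * z (B v w)))) (z≡0 e⊥̸w) ⟩
      h v * (1ℤ - 0ℤ + qz * (0ℤ * z (B v w))) ≡⟨ ring₁ (h v) qz (z (B v w)) ⟩
      h v ∎

  -- On a line in the singular direction e, Q is affine with slope B(v, e): one singular vector off
  -- e^⊥, all or none inside. This relates the cone to its part in e^⊥, and is used in both
  -- directions.
  cone-sum : ∀ {e h} → Q e ≡ 0# → Invariant e h →
    qz * ∑V (λ v → h v * z (Q v)) ≡ ∑V h - ∑V (λ v → h v * z (B v e)) + qz * ∑V (λ v → h v * (z (B v e) * z (Q v)))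
  cone-sum {e} {h} Qe h-inv = begin
    qz * ∑V (λ v → h v * z (Q v))
      ≡⟨ average-invariant h-inv _ ⟩
    ∑V (λ v → h v * ∑F (λ t → z (Q (v ⊕ t ⊙ e))))
      ≡⟨ ∑-cong 𝕍.elements (λ v → trans (cong (h v *_) (trans (∑-cong (allFin q) (λ t → cong z (Q-line Qe t v))) (linear-roots (Q v) (B v e))))
                                        (ring₁ (h v) (z (B v e)) qz (z (Q v)))) ⟩
    ∑V (λ v → (h v + ℤ.-1ℤ * (h v * z (B v e))) + qz * (h v * (z (B v e) * z (Q v))))
      ≡⟨ ∑-+ 𝕍.elements _ _ ⟩
    ∑V (λ v → h v + ℤ.-1ℤ * (h v * z (B v e))) + ∑V (λ v → qz * (h v * (z (B v e) * z (Q v))))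
      ≡⟨ cong₂ _+_ (trans (∑-+ 𝕍.elements _ _) (cong (∑V h +_) (trans (∑-*ˡ 𝕍.elements ℤ.-1ℤ _) (ℤ.-1*i≡-i _)))) (∑-*ˡ 𝕍.elements qz _) ⟩
    ∑V h - ∑V (λ v → h v * z (B v e)) + qz * ∑V (λ v → h v * (z (B v e) * z (Q v))) ∎
    where
    open ≡-Reasoning
    ring₁ : ∀ h b q c → h * (1ℤ - b + q * (b * c)) ≡ (h + ℤ.-1ℤ * (h * b)) + q * (h * (b * c))
    ring₁ = solve-∀

-- Elliptic spaces: sections of the cone and the moment argument

record IsElliptic {q : ℕ} {F : FiniteField q} (𝒱 : QuadraticSpace F) (a : ℤ) : Set where
  open Counting 𝒱
  field
    -- For m coordinate pairs and a = q^(m - 2) the sizes are q^(2m) and q^(2m-1) - q^m + q^(m-1),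
    -- zero vector included; the sign of the q^m term marks the elliptic type.
    vectors-size : ∑V (λ _ → 1ℤ) ≡ a * a * qz * qz * qz * qz
    cone-size    : ∑V (λ v → z (Q v)) ≡ a * a * qz * qz * qz - a * qz * qz + a * qz

module Elliptic {q : ℕ} {F : FiniteField q} (𝒱 : QuadraticSpace F) (a : ℤ) (elliptic : IsElliptic 𝒱 a) where

  open Counting 𝒱
  open IsElliptic elliptic
  open Solver using (solve; _:+_; _:*_; :-_; _:=_)
  private
    module 𝕍 = Enumeration enumeration
    Vs = 𝕍.elements

  rearrange : ∀ {x s t y} → x ≡ s - t + y → y ≡ x - s + t
  rearrange {_} {s} {t} {y} refl = ring₁ s t y
    where
    ring₁ : ∀ s t y → y ≡ s - t + y - s + t
    ring₁ = solve-∀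

  B-0vʳ : ∀ w → B w 0v ≡ 0#
  B-0vʳ w = trans (B-sym w 0v) (B-0v w)

  ≢0⇒≢0v : ∀ {x y} → B x y ≢ 0# → x ≢ 0v
  ≢0⇒≢0v {y = y} ne refl = ne (B-0v y)

  hyperplane-size : ∀ {w} → w ≢ 0v → ∑V (λ v → z (B v w)) ≡ a * a * qz * qz * qz
  hyperplane-size {w} w≢0 with nondegenerate w w≢0
  ... | e , e·w≡1 = q-cancel (begin
    qz * ∑V (λ v → z (B v w)) ≡⟨ cong (qz *_) (∑-cong Vs (λ v → sym (ℤ.*-identityˡ _))) ⟩
    qz * ∑V (λ v → 1ℤ * z (B v w)) ≡⟨ hyperplane-sum (1-invariant {e}) (λ eq → 1≢0 (trans (sym e·w≡1) eq)) ⟩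
    ∑V (λ v → 1ℤ) ≡⟨ vectors-size ⟩
    a * a * qz * qz * qz * qz ≡⟨ ℤ.*-comm _ qz ⟩
    qz * (a * a * qz * qz * qz) ∎)
    where open ≡-Reasoning

  -- `cone-sum` in direction x with constant weight, solved for the part of the cone in x^⊥.
  tangent-cone : ∀ {x} → Q x ≡ 0# → x ≢ 0v →
    ∑V (λ v → z (B v x) * z (Q v)) ≡ a * a * qz * qz - a * qz * qz + a * qz
  tangent-cone {x} Qx x≢0 = q-cancel (begin
    qz * ∑V (λ v → z (B v x) * z (Q v))
      ≡⟨ rearrange {t = ∑V (λ v → z (B v x))} (begin
           qz * ∑V (λ v → z (Q v)) ≡⟨ cong (qz *_) (∑-cong Vs (λ v → sym (ℤ.*-identityˡ _))) ⟩
           qz * ∑V (λ v → 1ℤ * z (Q v)) ≡⟨ cone-sum Qx (1-invariant {x}) ⟩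
           ∑V (λ _ → 1ℤ) - ∑V (λ v → 1ℤ * z (B v x)) + qz * ∑V (λ v → 1ℤ * (z (B v x) * z (Q v)))
             ≡⟨ cong₂ (λ s t → ∑V (λ _ → 1ℤ) - s + qz * t) (∑-cong Vs (λ v → ℤ.*-identityˡ _)) (∑-cong Vs (λ v → ℤ.*-identityˡ _)) ⟩
           ∑V (λ _ → 1ℤ) - ∑V (λ v → z (B v x)) + qz * ∑V (λ v → z (B v x) * z (Q v)) ∎) ⟩
    qz * ∑V (λ v → z (Q v)) - ∑V (λ _ → 1ℤ) + ∑V (λ v → z (B v x))
      ≡⟨ cong₂ (λ s t → qz * s - ∑V (λ _ → 1ℤ) + t) cone-size (hyperplane-size x≢0) ⟩
    qz * (a * a * qz * qz * qz - a * qz * qz + a * qz) - ∑V (λ _ → 1ℤ) + a * a * qz * qz * qz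
      ≡⟨ cong (λ s → qz * (a * a * qz * qz * qz - a * qz * qz + a * qz) - s + a * a * qz * qz * qz) vectors-size ⟩
    qz * (a * a * qz * qz * qz - a * qz * qz + a * qz) - a * a * qz * qz * qz * qz + a * a * qz * qz * qz
      ≡⟨ ring₁ a qz ⟩
    qz * (a * a * qz * qz - a * qz * qz + a * qz) ∎)
    where
    open ≡-Reasoning
    ring₁ : ∀ a q → q * (a * a * q * q * q - a * q * q + a * q) - a * a * q * q * q * q + a * a * q * q * q ≡ q * (a * a * q * q - a * q * q + a * q)
    ring₁ = solve-∀

  -- The cone inside x^⊥ is invariant under translation by x, which is not orthogonal to y, so y^⊥
  -- takes one q-th of it. Applied to a second singular vector and to `p`.
  hyperbolic-cone : ∀ {x y} → Q x ≡ 0# → B x y ≢ 0# →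
    ∑V (λ v → (z (B v x) * z (Q v)) * z (B v y)) ≡ a * a * qz - a * qz + a
  hyperbolic-cone {x} {y} Qx x⊥̸y = q-cancel (begin
    qz * ∑V (λ v → (z (B v x) * z (Q v)) * z (B v y)) ≡⟨ hyperplane-sum (cone-invariant Qx) x⊥̸y ⟩
    ∑V (λ v → z (B v x) * z (Q v)) ≡⟨ tangent-cone Qx (≢0⇒≢0v x⊥̸y) ⟩
    a * a * qz * qz - a * qz * qz + a * qz ≡⟨ ring₁ a qz ⟩
    qz * (a * a * qz - a * qz + a) ∎)
    where
    open ≡-Reasoning
    ring₁ : ∀ a q → a * a * q * q - a * q * q + a * q ≡ q * (a * a * q - a * q + a)
    ring₁ = solve-∀

  codimension-2 : ∀ {x e y} → x ≢ 0v → B e x ≡ 0# → B e y ≢ 0# →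
    ∑V (λ v → z (B v x) * z (B v y)) ≡ a * a * qz * qz
  codimension-2 x≢0 e⊥x e⊥̸y = q-cancel (trans (hyperplane-sum (⊥-invariant e⊥x) e⊥̸y)
    (trans (hyperplane-size x≢0) (ring₁ a qz)))
    where
    ring₁ : ∀ a q → a * a * q * q * q ≡ q * (a * a * q * q)
    ring₁ = solve-∀

  -- U is the orthogonal complement of the hyperbolic pair x, y, with indicator μ, and S is
  -- the indicator of its singular vectors.  By h-count below, the transform h w encodes the
  -- number of singular vectors of U orthogonal to w.
  module Complement {x y : V} (Qx : Q x ≡ 0#) (Qy : Q y ≡ 0#) (x⊥̸y : B x y ≢ 0#) where

    μ : V → ℤ
    μ v = z (B v x) * z (B v y)

    S : V → ℤ
    S v = μ v * z (Q v)

    size-U : ∑V μ ≡ a * a * qz * qz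
    size-U = codimension-2 {e = x} (≢0⇒≢0v x⊥̸y) (B-self Qx) x⊥̸y

    -- The size of an elliptic cone with one hyperbolic pair fewer, that is, with a/q in place of a.
    M : ℤ
    M = a * a * qz - a * qz + a

    size-S : ∑V S ≡ M
    size-S = trans (∑-cong Vs (λ v → ring₁ (z (B v x)) (z (B v y)) (z (Q v)))) (hyperbolic-cone Qx x⊥̸y)
      where
      ring₁ : ∀ x y q → x * y * q ≡ x * q * y
      ring₁ = solve-∀

    record _∈U (v : V) : Set where
      constructor _,_
      field
        ⊥x : B v x ≡ 0#
        ⊥y : B v y ≡ 0#
    open _∈U

    μ≡1 : ∀ {v} → v ∈U → μ v ≡ 1ℤ
    μ≡1 (v⊥x , v⊥y) = cong₂ _*_ (z≡1 v⊥x) (z≡1 v⊥y)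

    -- Sums over U are sums over V with the factor `μ`; under that factor membership in U may be
    -- assumed.
    μ-elim : ∀ {f g : V → ℤ} v → (v ∈U → f v ≡ g v) → μ v * f v ≡ μ v * g v
    μ-elim {f} {g} v eq with B v x ≟ 0# | B v y ≟ 0#
    ... | yes p | yes r = cong (1ℤ * 1ℤ *_) (eq (p , r))
    ... | yes p | no _  = refl
    ... | no _  | _     = refl

    μ-invariant : ∀ {e} → e ∈U → Invariant e μ
    μ-invariant (e⊥x , e⊥y) = *-invariant (⊥-invariant e⊥x) (⊥-invariant e⊥y)

    -- Project a dual vector of v to U: x pairs only with y and y only with x, so subtracting B(e₀,
    -- y)/β times x and B(e₀, x)/β times y suffices. The product with v is unchanged, since v lies
    -- in U.
    nondegenerate-U : ∀ {v} → v ∈U → v ≢ 0v → ∃[ e ] (e ∈U × B e v ≡ 1#)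
    nondegenerate-U {v} (v⊥x , v⊥y) v≢0 with nondegenerate v v≢0
    ... | e₀ , e₀·v≡1 = e , (e⊥x , e⊥y) , e·v≡1
      where
      open ≡-Reasoning
      β = B x y
      s = -ᶠ (inv β *ᶠ B e₀ y)
      t = -ᶠ (inv β *ᶠ B e₀ x)
      e = (e₀ ⊕ s ⊙ x) ⊕ t ⊙ y
      expand : ∀ w → B e w ≡ (B e₀ w +ᶠ s *ᶠ B x w) +ᶠ t *ᶠ B y w
      expand w = trans (B-line _ t y w) (cong (_+ᶠ t *ᶠ B y w) (B-line e₀ s x w))
      e⊥x : B e x ≡ 0#
      e⊥x = begin
        B e x ≡⟨ expand x ⟩
        (B e₀ x +ᶠ s *ᶠ B x x) +ᶠ t *ᶠ B y x ≡⟨ cong₂ (λ i j → (B e₀ x +ᶠ s *ᶠ i) +ᶠ t *ᶠ j) (B-self Qx) (B-sym y x) ⟩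
        (B e₀ x +ᶠ s *ᶠ 0#) +ᶠ t *ᶠ β ≡⟨ solve 4 (λ b s i β → (b :+ s :* 𝟘) :+ (:- (i :* b)) :* β := b :+ :- (b :* (i :* β))) refl (B e₀ x) s (inv β) β ⟩
        B e₀ x +ᶠ -ᶠ (B e₀ x *ᶠ (inv β *ᶠ β)) ≡⟨ cong (λ i → B e₀ x +ᶠ -ᶠ (B e₀ x *ᶠ i)) (inv-left x⊥̸y) ⟩
        B e₀ x +ᶠ -ᶠ (B e₀ x *ᶠ 1#) ≡⟨ solve 1 (λ b → b :+ :- (b :* 𝟙) := 𝟘) refl (B e₀ x) ⟩
        0# ∎
      e⊥y : B e y ≡ 0#
      e⊥y = begin
        B e y ≡⟨ expand y ⟩
        (B e₀ y +ᶠ s *ᶠ β) +ᶠ t *ᶠ B y y ≡⟨ cong (λ j → (B e₀ y +ᶠ s *ᶠ β) +ᶠ t *ᶠ j) (B-self Qy) ⟩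
        (B e₀ y +ᶠ s *ᶠ β) +ᶠ t *ᶠ 0# ≡⟨ solve 4 (λ b t i β → (b :+ (:- (i :* b)) :* β) :+ t :* 𝟘 := b :+ :- (b :* (i :* β))) refl (B e₀ y) t (inv β) β ⟩
        B e₀ y +ᶠ -ᶠ (B e₀ y *ᶠ (inv β *ᶠ β)) ≡⟨ cong (λ i → B e₀ y +ᶠ -ᶠ (B e₀ y *ᶠ i)) (inv-left x⊥̸y) ⟩
        B e₀ y +ᶠ -ᶠ (B e₀ y *ᶠ 1#) ≡⟨ solve 1 (λ b → b :+ :- (b :* 𝟙) := 𝟘) refl (B e₀ y) ⟩
        0# ∎
      e·v≡1 : B e v ≡ 1#
      e·v≡1 = begin
        B e v ≡⟨ expand v ⟩
        (B e₀ v +ᶠ s *ᶠ B x v) +ᶠ t *ᶠ B y v ≡⟨ cong₂ (λ i j → (B e₀ v +ᶠ s *ᶠ i) +ᶠ t *ᶠ j) (trans (B-sym x v) v⊥x) (trans (B-sym y v) v⊥y) ⟩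
        (B e₀ v +ᶠ s *ᶠ 0#) +ᶠ t *ᶠ 0# ≡⟨ solve 3 (λ b s t → (b :+ s :* 𝟘) :+ t :* 𝟘 := b) refl (B e₀ v) s t ⟩
        B e₀ v ≡⟨ e₀·v≡1 ⟩
        1# ∎

    -- The sum of ψ(t B(w, v)) over all t ≠ 0, for a nontrivial additive character ψ of the field.
    -- As the cone is closed under scalars, `h` is q - 1 times its Fourier transform.
    g : V → V → ℤ
    g v w = qz * z (B w v) - 1ℤ

    h : V → ℤ
    h w = ∑V (λ v → S v * g v w)

    -- The vanishing of a nontrivial character sum, obtained here from `hyperplane-sum`: v^⊥ carries
    -- one q-th of the weight k.
    g-orthogonal : ∀ {e v k} → Invariant e k → B e v ≡ 1# → ∑V (λ w → k w * g v w) ≡ 0ℤ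
    g-orthogonal {e} {v} {k} k-inv e·v≡1 = begin
      ∑V (λ w → k w * g v w) ≡⟨ ∑-cong Vs (λ w → ring₁ (k w) qz (z (B w v))) ⟩
      ∑V (λ w → qz * (k w * z (B w v)) + ℤ.-1ℤ * k w) ≡⟨ ∑-+ Vs _ _ ⟩
      ∑V (λ w → qz * (k w * z (B w v))) + ∑V (λ w → ℤ.-1ℤ * k w)
        ≡⟨ cong₂ _+_ (trans (∑-*ˡ Vs qz _) (hyperplane-sum k-inv (λ eq → 1≢0 (trans (sym e·v≡1) eq)))) (∑-*ˡ Vs ℤ.-1ℤ k) ⟩
      ∑V k + ℤ.-1ℤ * ∑V k ≡⟨ ring₂ (∑V k) ⟩
      0ℤ ∎
      where
      open ≡-Reasoning
      ring₁ : ∀ k q z → k * (q * z - 1ℤ) ≡ q * (k * z) + ℤ.-1ℤ * k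
      ring₁ = solve-∀
      ring₂ : ∀ k → k + ℤ.-1ℤ * k ≡ 0ℤ
      ring₂ = solve-∀

    0∈U : 0v ∈U
    0∈U = B-0v x , B-0v y

    S-0v : S 0v ≡ 1ℤ
    S-0v = cong₂ _*_ (μ≡1 0∈U) (z≡1 Q-0v)

    g-0v : ∀ w → g 0v w ≡ qz - 1ℤ
    g-0v w = trans (cong (λ i → qz * i - 1ℤ) (z≡1 (B-0vʳ w))) (cong (_- 1ℤ) (ℤ.*-identityʳ qz))

    μg-sum : ∀ v → S v * ∑V (λ w → μ w * g v w) ≡ ι ⌊ v ≟ᵛ 0v ⌋ * ((qz - 1ℤ) * ∑V μ)
    μg-sum v with v ≟ᵛ 0v
    ... | yes refl = begin
        S 0v * ∑V (λ w → μ w * g 0v w) ≡⟨ cong₂ _*_ S-0v (∑-cong Vs (λ w → trans (cong (μ w *_) (g-0v w)) (ℤ.*-comm (μ w) _))) ⟩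
        1ℤ * ∑V (λ w → (qz - 1ℤ) * μ w) ≡⟨ cong (1ℤ *_) (∑-*ˡ Vs (qz - 1ℤ) μ) ⟩
        1ℤ * ((qz - 1ℤ) * ∑V μ) ∎
      where open ≡-Reasoning
    ... | no v≢0 = begin
        S v * ∑V (λ w → μ w * g v w) ≡⟨ ring₁ (μ v) (z (Q v)) _ ⟩
        μ v * (z (Q v) * ∑V (λ w → μ w * g v w)) ≡⟨ μ-elim {λ v → z (Q v) * ∑V (λ w → μ w * g v w)} {λ _ → 0ℤ} v vanish ⟩
        μ v * 0ℤ ≡⟨ ℤ.*-zeroʳ (μ v) ⟩
        0ℤ ∎
      where
      open ≡-Reasoning
      ring₁ : ∀ m z s → m * z * s ≡ m * (z * s)
      ring₁ = solve-∀
      vanish : v ∈U → z (Q v) * ∑V (λ w → μ w * g v w) ≡ 0ℤ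
      vanish v∈U with nondegenerate-U v∈U v≢0
      ... | e , e∈U , e·v≡1 = trans (cong (z (Q v) *_) (g-orthogonal (μ-invariant e∈U) e·v≡1)) (ℤ.*-zeroʳ (z (Q v)))

    -- After exchanging the sums only v = 0 contributes: Fourier inversion at the origin.
    first-moment : ∑V (λ w → μ w * h w) ≡ (qz - 1ℤ) * ∑V μ
    first-moment = begin
      ∑V (λ w → μ w * h w) ≡⟨ ∑-cong Vs (λ w → sym (∑-*ˡ Vs (μ w) _)) ⟩
      ∑V (λ w → ∑V (λ v → μ w * (S v * g v w))) ≡⟨ ∑-swap Vs Vs _ ⟩
      ∑V (λ v → ∑V (λ w → μ w * (S v * g v w))) ≡⟨ ∑-cong Vs (λ v → trans (∑-cong Vs (λ w → ring₁ (μ w) (S v) (g v w))) (∑-*ˡ Vs (S v) _)) ⟩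
      ∑V (λ v → S v * ∑V (λ w → μ w * g v w)) ≡⟨ ∑-cong Vs μg-sum ⟩
      ∑V (λ v → ι ⌊ v ≟ᵛ 0v ⌋ * ((qz - 1ℤ) * ∑V μ)) ≡⟨ 𝕍.∑-δ 0v (λ _ → (qz - 1ℤ) * ∑V μ) ⟩
      (qz - 1ℤ) * ∑V μ ∎
      where
      open ≡-Reasoning
      ring₁ : ∀ m s g → m * (s * g) ≡ s * (m * g)
      ring₁ = solve-∀

    B-⊙ʳ : ∀ t u v → B u (t ⊙ v) ≡ t *ᶠ B u v
    B-⊙ʳ t u v = trans (B-sym u _) (trans (B-⊙ t v u) (cong (t *ᶠ_) (B-sym v u)))

    module _ {v e : V} (e∈U : e ∈U) (e·v≡1 : B e v ≡ 1#) where

      coordinate : ∀ {v′ t} → v′ ≡ t ⊙ v → B e v′ ≡ t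
      coordinate {t = t} refl = trans (B-⊙ʳ t e v) (trans (cong (t *ᶠ_) e·v≡1) (*-identityʳ t))

      g-square-sum : ∑V (λ w → μ w * (g v w * g v w)) ≡ (qz - 1ℤ) * ∑V μ
      g-square-sum = begin
        ∑V (λ w → μ w * (g v w * g v w))
          ≡⟨ ∑-cong Vs (λ w → trans (ring₁ (μ w) qz (z (B w v)))
               (trans (cong (λ i → qz * qz * (μ w * i) + (ℤ.- pos 2 * qz * (μ w * z (B w v)) + μ w)) (ι-idem ⌊ B w v ≟ 0# ⌋))
                      (ring₂ (μ w * z (B w v)) qz (μ w)))) ⟩
        ∑V (λ w → (qz * qz - pos 2 * qz) * (μ w * z (B w v)) + μ w)
          ≡⟨ trans (∑-+ Vs _ μ) (cong (_+ ∑V μ) (∑-*ˡ Vs (qz * qz - pos 2 * qz) _)) ⟩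
        (qz * qz - pos 2 * qz) * ∑V (λ w → μ w * z (B w v)) + ∑V μ
          ≡⟨ ring₃ qz _ (∑V μ) ⟩
        (qz - pos 2) * (qz * ∑V (λ w → μ w * z (B w v))) + ∑V μ
          ≡⟨ cong (λ i → (qz - pos 2) * i + ∑V μ) (hyperplane-sum (μ-invariant e∈U) (λ eq → 1≢0 (trans (sym e·v≡1) eq))) ⟩
        (qz - pos 2) * ∑V μ + ∑V μ
          ≡⟨ ring₄ qz (∑V μ) ⟩
        (qz - 1ℤ) * ∑V μ ∎
        where
        open ≡-Reasoning
        ring₁ : ∀ m q z → m * ((q * z - 1ℤ) * (q * z - 1ℤ)) ≡ q * q * (m * (z * z)) + (ℤ.- pos 2 * q * (m * z) + m)
        ring₁ = solve-∀
        ring₂ : ∀ mz q m → q * q * mz + (ℤ.- pos 2 * q * mz + m) ≡ (q * q - pos 2 * q) * mz + m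
        ring₂ = solve-∀
        ring₃ : ∀ q s m → (q * q - pos 2 * q) * s + m ≡ (q - pos 2) * (q * s) + m
        ring₃ = solve-∀
        ring₄ : ∀ q m → (q - pos 2) * m + m ≡ (q - 1ℤ) * m
        ring₄ = solve-∀

      -- Detects the nonzero multiples of v. As a sum over scalars it can be exchanged with the sum
      -- over v′ in `cone-line-sum`.
      line-indicator : V → ℤ
      line-indicator v′ = ∑F (λ t → (1ℤ - z t) * ι ⌊ v′ ≟ᵛ t ⊙ v ⌋)

      line-indicator-on : ∀ s → line-indicator (s ⊙ v) ≡ 1ℤ - z s
      line-indicator-on s = begin
        line-indicator (s ⊙ v) ≡⟨ 𝔽.∑-unique s _ off ⟩
        (1ℤ - z s) * ι ⌊ s ⊙ v ≟ᵛ s ⊙ v ⌋ ≡⟨ cong ((1ℤ - z s) *_) (ι-yes (s ⊙ v ≟ᵛ s ⊙ v) refl) ⟩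
        (1ℤ - z s) * 1ℤ ≡⟨ ℤ.*-identityʳ (1ℤ - z s) ⟩
        1ℤ - z s ∎
        where
        open ≡-Reasoning
        module 𝔽 = Enumeration (finEnumeration q)
        off : ∀ t → t ≢ s → (1ℤ - z t) * ι ⌊ s ⊙ v ≟ᵛ t ⊙ v ⌋ ≡ 0ℤ
        off t t≢s = trans (cong ((1ℤ - z t) *_) (ι-no (s ⊙ v ≟ᵛ t ⊙ v) (λ eq → t≢s (trans (sym (coordinate eq)) (coordinate refl)))))
          (ℤ.*-zeroʳ (1ℤ - z t))

      gram-on-line : ∀ s → ∑V (λ w → μ w * (g v w * g (s ⊙ v) w)) ≡ ((qz - 1ℤ) * ∑V μ) * (1ℤ - z s)
      gram-on-line s with s ≟ 0#
      ... | yes refl = begin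
          ∑V (λ w → μ w * (g v w * g (0# ⊙ v) w)) ≡⟨ ∑-cong Vs (λ w → trans (cong (λ i → μ w * (g v w * i)) (g-zero w)) (ring₁ (μ w) (g v w) (qz - 1ℤ))) ⟩
          ∑V (λ w → (qz - 1ℤ) * (μ w * g v w)) ≡⟨ ∑-*ˡ Vs (qz - 1ℤ) _ ⟩
          (qz - 1ℤ) * ∑V (λ w → μ w * g v w) ≡⟨ cong ((qz - 1ℤ) *_) (g-orthogonal (μ-invariant e∈U) e·v≡1) ⟩
          (qz - 1ℤ) * 0ℤ ≡⟨ ring₂ (qz - 1ℤ) ((qz - 1ℤ) * ∑V μ) ⟩
          ((qz - 1ℤ) * ∑V μ) * (1ℤ - 1ℤ) ∎
        where
        open ≡-Reasoning
        g-zero : ∀ w → g (0# ⊙ v) w ≡ qz - 1ℤ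
        g-zero w = trans (cong (λ i → qz * i - 1ℤ) (z≡1 (trans (B-⊙ʳ 0# w v) (zeroˡ _)))) (cong (_- 1ℤ) (ℤ.*-identityʳ qz))
        ring₁ : ∀ m g c → m * (g * c) ≡ c * (m * g)
        ring₁ = solve-∀
        ring₂ : ∀ c d → c * 0ℤ ≡ d * (1ℤ - 1ℤ)
        ring₂ = solve-∀
      ... | no s≢0 = begin
          ∑V (λ w → μ w * (g v w * g (s ⊙ v) w)) ≡⟨ ∑-cong Vs (λ w → cong (λ i → μ w * (g v w * (qz * i - 1ℤ))) (trans (cong z (B-⊙ʳ s w v)) (z-scale (B w v) s≢0))) ⟩
          ∑V (λ w → μ w * (g v w * g v w)) ≡⟨ g-square-sum ⟩
          (qz - 1ℤ) * ∑V μ ≡⟨ sym (ℤ.*-identityʳ ((qz - 1ℤ) * ∑V μ)) ⟩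
          ((qz - 1ℤ) * ∑V μ) * (1ℤ - 0ℤ) ∎
        where open ≡-Reasoning

      -- The kernels of v and v′ are orthogonal unless v′ is a nonzero multiple of v. Split off r =
      -- v′ - B(e, v′) v. If r = 0, `gram-on-line` applies; otherwise some f in U is orthogonal to v
      -- but not to v′, so `g v` is constant along f while `g v′` averages to 0.
      gram : ∀ {v′} → v ∈U → v′ ∈U →
             ∑V (λ w → μ w * (g v w * g v′ w)) ≡ ((qz - 1ℤ) * ∑V μ) * line-indicator v′
      gram {v′} v∈U v′∈U = go (r ≟ᵛ 0v)
        where
        open ≡-Reasoning
        s : Fin q
        s = B e v′
        r : V
        r = v′ ⊕ (-ᶠ s) ⊙ v
        r∈U : r ∈U
        r∈U = vanishes (⊥x v′∈U) (⊥x v∈U) , vanishes (⊥y v′∈U) (⊥y v∈U)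
          where
          vanishes : ∀ {u} → B v′ u ≡ 0# → B v u ≡ 0# → B r u ≡ 0#
          vanishes {u} p₁ p₂ = trans (B-line v′ (-ᶠ s) v u) (trans (cong₂ (λ i j → i +ᶠ (-ᶠ s) *ᶠ j) p₁ p₂)
            (solve 1 (λ s → 𝟘 :+ (:- s) :* 𝟘 := 𝟘) refl s))
        e⊥r : B e r ≡ 0#
        e⊥r = trans (B-lineʳ v′ (-ᶠ s) v e) (trans (cong (λ i → s +ᶠ (-ᶠ s) *ᶠ i) e·v≡1)
          (solve 1 (λ s → s :+ (:- s) :* 𝟙 := 𝟘) refl s))
        go : _ → ∑V (λ w → μ w * (g v w * g v′ w)) ≡ ((qz - 1ℤ) * ∑V μ) * line-indicator v′
        go (yes r≡0) = begin
          ∑V (λ w → μ w * (g v w * g v′ w)) ≡⟨ cong (λ u → ∑V (λ w → μ w * (g v w * g u w))) on-line ⟩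
          ∑V (λ w → μ w * (g v w * g (s ⊙ v) w)) ≡⟨ gram-on-line s ⟩
          ((qz - 1ℤ) * ∑V μ) * (1ℤ - z s) ≡⟨ cong (((qz - 1ℤ) * ∑V μ) *_) (sym (trans (cong line-indicator on-line) (line-indicator-on s))) ⟩
          ((qz - 1ℤ) * ∑V μ) * line-indicator v′ ∎
          where
          on-line : v′ ≡ s ⊙ v
          on-line = difference v′ s v r≡0
        go (no r≢0) with nondegenerate-U r∈U r≢0
        ... | e₂ , e₂∈U , e₂·r≡1 = begin
          ∑V (λ w → μ w * (g v w * g v′ w)) ≡⟨ ∑-cong Vs (λ w → sym (ℤ.*-assoc (μ w) (g v w) (g v′ w))) ⟩
          ∑V (λ w → (μ w * g v w) * g v′ w) ≡⟨ g-orthogonal (*-invariant (μ-invariant f∈U) g-inv) f·v′≡1 ⟩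
          0ℤ ≡⟨ sym (ℤ.*-zeroʳ ((qz - 1ℤ) * ∑V μ)) ⟩
          ((qz - 1ℤ) * ∑V μ) * 0ℤ ≡⟨ cong (((qz - 1ℤ) * ∑V μ) *_) (sym off-line) ⟩
          ((qz - 1ℤ) * ∑V μ) * line-indicator v′ ∎
          where
          t : Fin q
          t = B e₂ v
          -- Subtracting B(e₂, v) e makes f orthogonal to v and, because e ⊥ r, keeps its product
          -- with r.
          f : V
          f = e₂ ⊕ (-ᶠ t) ⊙ e
          f-at : ∀ u → B f u ≡ B e₂ u +ᶠ (-ᶠ t) *ᶠ B e u
          f-at = B-line e₂ (-ᶠ t) e
          f∈U : f ∈U
          f∈U = trans (f-at x) (trans (cong₂ (λ i j → i +ᶠ (-ᶠ t) *ᶠ j) (⊥x e₂∈U) (⊥x e∈U)) zero₁)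
              , trans (f-at y) (trans (cong₂ (λ i j → i +ᶠ (-ᶠ t) *ᶠ j) (⊥y e₂∈U) (⊥y e∈U)) zero₁)
            where
            zero₁ : 0# +ᶠ (-ᶠ t) *ᶠ 0# ≡ 0#
            zero₁ = solve 1 (λ s → 𝟘 :+ (:- s) :* 𝟘 := 𝟘) refl t
          f⊥v : B f v ≡ 0#
          f⊥v = trans (f-at v) (trans (cong (λ i → t +ᶠ (-ᶠ t) *ᶠ i) e·v≡1)
            (solve 1 (λ s → s :+ (:- s) :* 𝟙 := 𝟘) refl t))
          g-inv : Invariant f (g v)
          g-inv k w = cong (λ i → qz * i - 1ℤ) (⊥-invariant f⊥v k w)
          f·r≡1 : B f r ≡ 1#
          f·r≡1 = trans (f-at r) (trans (cong₂ (λ i j → i +ᶠ (-ᶠ t) *ᶠ j) e₂·r≡1 e⊥r)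
            (solve 1 (λ t → 𝟙 :+ (:- t) :* 𝟘 := 𝟙) refl t))
          f·v′≡1 : B f v′ ≡ 1#
          f·v′≡1 = begin
            B f v′ ≡⟨ solve 2 (λ b s → b := b :+ (:- s) :* 𝟘) refl (B f v′) s ⟩
            B f v′ +ᶠ (-ᶠ s) *ᶠ 0# ≡⟨ cong (λ i → B f v′ +ᶠ (-ᶠ s) *ᶠ i) (sym f⊥v) ⟩
            B f v′ +ᶠ (-ᶠ s) *ᶠ B f v ≡⟨ sym (B-lineʳ v′ (-ᶠ s) v f) ⟩
            B f r ≡⟨ f·r≡1 ⟩
            1# ∎
          off-line : line-indicator v′ ≡ 0ℤ
          off-line = trans (∑-cong (allFin q) (λ t → trans (cong ((1ℤ - z t) *_) (ι-no (v′ ≟ᵛ t ⊙ v) (off t))) (ℤ.*-zeroʳ (1ℤ - z t))))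
            (∑-zero (allFin q))
            where
            off : ∀ t → v′ ≢ t ⊙ v
            off t refl = r≢0 (subst (λ i → (t ⊙ v) ⊕ (-ᶠ i) ⊙ v ≡ 0v) (sym (coordinate refl)) (cancel t v))

    S-scale : ∀ {t} v → t ≢ 0# → S (t ⊙ v) ≡ S v
    S-scale {t} v t≢0 = cong₂ _*_
      (cong₂ _*_ (trans (cong z (B-⊙ t v x)) (z-scale (B v x) t≢0)) (trans (cong z (B-⊙ t v y)) (z-scale (B v y) t≢0)))
      (trans (cong z (Q-⊙ t v)) (z-scale (Q v) (*≢0 t≢0 t≢0)))

    -- The cone is closed under nonzero scalars, so all q - 1 multiples of v contribute `S v`.
    cone-line-sum : ∀ {v e} (e∈U : e ∈U) (e·v≡1 : B e v ≡ 1#) →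
      ∑V (λ v′ → S v′ * line-indicator e∈U e·v≡1 v′) ≡ (qz - 1ℤ) * S v
    cone-line-sum {v} e∈U e·v≡1 = begin
      ∑V (λ v′ → S v′ * ∑F (λ t → (1ℤ - z t) * ι ⌊ v′ ≟ᵛ t ⊙ v ⌋))
        ≡⟨ ∑-cong Vs (λ v′ → trans (sym (∑-*ˡ (allFin q) (S v′) _)) (∑-cong (allFin q) (λ t → ring₁ (S v′) (1ℤ - z t) (ι ⌊ v′ ≟ᵛ t ⊙ v ⌋)))) ⟩
      ∑V (λ v′ → ∑F (λ t → (1ℤ - z t) * (ι ⌊ v′ ≟ᵛ t ⊙ v ⌋ * S v′)))
        ≡⟨ ∑-swap Vs (allFin q) _ ⟩
      ∑F (λ t → ∑V (λ v′ → (1ℤ - z t) * (ι ⌊ v′ ≟ᵛ t ⊙ v ⌋ * S v′)))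
        ≡⟨ ∑-cong (allFin q) (λ t → trans (∑-*ˡ Vs (1ℤ - z t) _) (trans (cong ((1ℤ - z t) *_) (𝕍.∑-δ (t ⊙ v) S)) (scaled t))) ⟩
      ∑F (λ t → (1ℤ - z t) * S v)
        ≡⟨ trans (∑-*ʳ (allFin q) (S v) _) (cong (_* S v) units-sum) ⟩
      (qz - 1ℤ) * S v ∎
      where
      open ≡-Reasoning
      ring₁ : ∀ s c i → s * (c * i) ≡ c * (i * s)
      ring₁ = solve-∀
      scaled : ∀ t → (1ℤ - z t) * S (t ⊙ v) ≡ (1ℤ - z t) * S v
      scaled t with t ≟ 0#
      ... | yes _  = refl
      ... | no t≢0 = cong ((1ℤ - 0ℤ) *_) (S-scale v t≢0)

    -- Fourier inversion for the cone: by `gram` only the multiples of v survive in the inner sum.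
    transform-twice : ∀ {v} → v ∈U → ∑V (λ w → μ w * (g v w * h w)) ≡ (qz - 1ℤ) * ((qz - 1ℤ) * ∑V μ) * S v
    transform-twice {v} v∈U = go (v ≟ᵛ 0v)
      where
      open ≡-Reasoning
      go : _ → ∑V (λ w → μ w * (g v w * h w)) ≡ (qz - 1ℤ) * ((qz - 1ℤ) * ∑V μ) * S v
      -- The zero vector spans no line, so `gram` is replaced by the first moment: `g 0v` is
      -- constant.
      go (yes refl) = begin
        ∑V (λ w → μ w * (g 0v w * h w)) ≡⟨ ∑-cong Vs (λ w → trans (cong (λ i → μ w * (i * h w)) (g-0v w)) (ring₁ (μ w) (qz - 1ℤ) (h w))) ⟩
        ∑V (λ w → (qz - 1ℤ) * (μ w * h w)) ≡⟨ ∑-*ˡ Vs (qz - 1ℤ) _ ⟩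
        (qz - 1ℤ) * ∑V (λ w → μ w * h w) ≡⟨ cong ((qz - 1ℤ) *_) first-moment ⟩
        (qz - 1ℤ) * ((qz - 1ℤ) * ∑V μ) ≡⟨ sym (ℤ.*-identityʳ _) ⟩
        (qz - 1ℤ) * ((qz - 1ℤ) * ∑V μ) * 1ℤ ≡⟨ cong ((qz - 1ℤ) * ((qz - 1ℤ) * ∑V μ) *_) (sym S-0v) ⟩
        (qz - 1ℤ) * ((qz - 1ℤ) * ∑V μ) * S 0v ∎
        where
        ring₁ : ∀ m g c → m * (g * c) ≡ g * (m * c)
        ring₁ = solve-∀
      go (no v≢0) with nondegenerate-U v∈U v≢0
      ... | e , e∈U , e·v≡1 = begin
        ∑V (λ w → μ w * (g v w * h w))
          ≡⟨ ∑-cong Vs (λ w → trans (sym (ℤ.*-assoc (μ w) (g v w) (h w))) (sym (∑-*ˡ Vs (μ w * g v w) _))) ⟩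
        ∑V (λ w → ∑V (λ v′ → (μ w * g v w) * (S v′ * g v′ w)))
          ≡⟨ ∑-swap Vs Vs _ ⟩
        ∑V (λ v′ → ∑V (λ w → (μ w * g v w) * (S v′ * g v′ w)))
          ≡⟨ ∑-cong Vs (λ v′ → trans (∑-cong Vs (λ w → ring₁ (μ w) (g v w) (S v′) (g v′ w))) (∑-*ˡ Vs (S v′) _)) ⟩
        ∑V (λ v′ → S v′ * ∑V (λ w → μ w * (g v w * g v′ w)))
          ≡⟨ ∑-cong Vs at ⟩
        ∑V (λ v′ → K * (S v′ * L v′))
          ≡⟨ ∑-*ˡ Vs K _ ⟩
        K * ∑V (λ v′ → S v′ * L v′)
          ≡⟨ cong (K *_) (cone-line-sum e∈U e·v≡1) ⟩
        K * ((qz - 1ℤ) * S v)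
          ≡⟨ ring₃ K (qz - 1ℤ) (S v) ⟩
        (qz - 1ℤ) * K * S v ∎
        where
        K : ℤ
        K = (qz - 1ℤ) * ∑V μ
        L : V → ℤ
        L = line-indicator e∈U e·v≡1
        ring₁ : ∀ m g s g′ → (m * g) * (s * g′) ≡ s * (m * (g * g′))
        ring₁ = solve-∀
        ring₂ : ∀ m z k l → m * (z * (k * l)) ≡ k * (m * z * l)
        ring₂ = solve-∀
        ring₃ : ∀ k c s → k * (c * s) ≡ c * k * s
        ring₃ = solve-∀
        at : ∀ v′ → S v′ * ∑V (λ w → μ w * (g v w * g v′ w)) ≡ K * (S v′ * L v′)
        at v′ = begin
          S v′ * ∑V (λ w → μ w * (g v w * g v′ w)) ≡⟨ ℤ.*-assoc (μ v′) (z (Q v′)) _ ⟩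
          μ v′ * (z (Q v′) * ∑V (λ w → μ w * (g v w * g v′ w)))
            ≡⟨ μ-elim {λ v′ → z (Q v′) * ∑V (λ w → μ w * (g v w * g v′ w))} {λ v′ → z (Q v′) * (K * L v′)} v′
                 (λ v′∈U → cong (z (Q v′) *_) (gram e∈U e·v≡1 v∈U v′∈U)) ⟩
          μ v′ * (z (Q v′) * (K * L v′)) ≡⟨ ring₂ (μ v′) (z (Q v′)) K (L v′) ⟩
          K * (S v′ * L v′) ∎

    -- Parseval: expand one factor `h` and apply inversion to the other. As `S` takes the values 0
    -- and 1, its square sums to the size of the cone.
    second-moment : ∑V (λ w → μ w * (h w * h w)) ≡ (qz - 1ℤ) * ((qz - 1ℤ) * ∑V μ) * ∑V S
    second-moment = begin
      ∑V (λ w → μ w * (h w * h w))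
        ≡⟨ ∑-cong Vs (λ w → trans (ring₁ (μ w) (h w) (h w)) (sym (∑-*ˡ Vs (μ w * h w) _))) ⟩
      ∑V (λ w → ∑V (λ v → (μ w * h w) * (S v * g v w)))
        ≡⟨ ∑-swap Vs Vs _ ⟩
      ∑V (λ v → ∑V (λ w → (μ w * h w) * (S v * g v w)))
        ≡⟨ ∑-cong Vs (λ v → trans (∑-cong Vs (λ w → ring₂ (μ w) (h w) (S v) (g v w))) (∑-*ˡ Vs (S v) _)) ⟩
      ∑V (λ v → S v * ∑V (λ w → μ w * (g v w * h w)))
        ≡⟨ ∑-cong Vs at ⟩
      ∑V (λ v → K * S v)
        ≡⟨ ∑-*ˡ Vs K S ⟩
      K * ∑V S ∎
      where
      open ≡-Reasoning
      K : ℤ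
      K = (qz - 1ℤ) * ((qz - 1ℤ) * ∑V μ)
      ring₁ : ∀ m h k → m * (h * k) ≡ m * h * k
      ring₁ = solve-∀
      ring₂ : ∀ m h s g → (m * h) * (s * g) ≡ s * (m * (g * h))
      ring₂ = solve-∀
      ring₃ : ∀ m z k → m * (z * (k * (m * z))) ≡ k * (m * m * (z * z))
      ring₃ = solve-∀
      ring₄ : ∀ x y → (x * y) * (x * y) ≡ (x * x) * (y * y)
      ring₄ = solve-∀
      at : ∀ v → S v * ∑V (λ w → μ w * (g v w * h w)) ≡ K * S v
      at v = begin
        S v * ∑V (λ w → μ w * (g v w * h w)) ≡⟨ ℤ.*-assoc (μ v) (z (Q v)) _ ⟩
        μ v * (z (Q v) * ∑V (λ w → μ w * (g v w * h w)))
          ≡⟨ μ-elim {λ v → z (Q v) * ∑V (λ w → μ w * (g v w * h w))} {λ v → z (Q v) * (K * S v)} v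
               (λ v∈U → cong (z (Q v) *_) (transform-twice v∈U)) ⟩
        μ v * (z (Q v) * (K * S v)) ≡⟨ ring₃ (μ v) (z (Q v)) K ⟩
        K * (μ v * μ v * (z (Q v) * z (Q v)))
          ≡⟨ cong₂ (λ i j → K * (i * j))
               (trans (ring₄ (z (B v x)) (z (B v y))) (cong₂ _*_ (ι-idem ⌊ B v x ≟ 0# ⌋) (ι-idem ⌊ B v y ≟ 0# ⌋)))
               (ι-idem ⌊ Q v ≟ 0# ⌋) ⟩
        K * S v ∎

    orthogonal-singular : V → ℤ
    orthogonal-singular w = ∑V (λ v → S v * z (B v w))

    h-count : ∀ w → h w ≡ qz * orthogonal-singular w - M
    h-count w = begin
      ∑V (λ v → S v * g v w)
        ≡⟨ ∑-cong Vs (λ v → trans (cong (λ i → S v * (qz * z i - 1ℤ)) (B-sym w v)) (ring₁ (S v) qz (z (B v w)))) ⟩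
      ∑V (λ v → qz * (S v * z (B v w)) + ℤ.-1ℤ * S v)
        ≡⟨ trans (∑-+ Vs _ _) (cong₂ _+_ (∑-*ˡ Vs qz _) (∑-*ˡ Vs ℤ.-1ℤ S)) ⟩
      qz * orthogonal-singular w + ℤ.-1ℤ * ∑V S
        ≡⟨ cong (qz * orthogonal-singular w +_) (trans (ℤ.-1*i≡-i (∑V S)) (cong -_ size-S)) ⟩
      qz * orthogonal-singular w - M ∎
      where
      open ≡-Reasoning
      ring₁ : ∀ s q z → s * (q * z - 1ℤ) ≡ q * (s * z) + ℤ.-1ℤ * s
      ring₁ = solve-∀

    h-0v : h 0v ≡ (qz - 1ℤ) * M
    h-0v = begin
      h 0v ≡⟨ h-count 0v ⟩
      qz * orthogonal-singular 0v - M ≡⟨ cong (λ i → qz * i - M) (trans (∑-cong Vs (λ v →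
                                                      trans (cong (S v *_) (z≡1 (B-0vʳ v))) (ℤ.*-identityʳ (S v)))) size-S) ⟩
      qz * M - M ≡⟨ ring₁ qz M ⟩
      (qz - 1ℤ) * M ∎
      where
      open ≡-Reasoning
      ring₁ : ∀ q m → q * m - m ≡ (q - 1ℤ) * m
      ring₁ = solve-∀

    -- `cone-sum` within U in the direction w itself, which is where singularity of w enters.
    singular-drop : ∀ {w} → w ∈U → w ≢ 0v → Q w ≡ 0# → orthogonal-singular w ≡ M - a * a * qz + a * a
    singular-drop {w} w∈U w≢0 Qw with nondegenerate-U w∈U w≢0
    ... | e , e∈U , e·w≡1 = q-cancel (begin
      qz * orthogonal-singular w
        ≡⟨ cong (qz *_) (∑-cong Vs (λ v → ring₁ (μ v) (z (Q v)) (z (B v w)))) ⟩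
      qz * ∑V (λ v → μ v * (z (B v w) * z (Q v)))
        ≡⟨ rearrange {t = ∑V (λ v → μ v * z (B v w))} (cone-sum Qw (μ-invariant w∈U)) ⟩
      qz * ∑V S - ∑V μ + ∑V (λ v → μ v * z (B v w))
        ≡⟨ cong₂ (λ i j → qz * i - ∑V μ + j) size-S hyperplane ⟩
      qz * M - ∑V μ + a * a * qz
        ≡⟨ cong (λ i → qz * M - i + a * a * qz) size-U ⟩
      qz * M - a * a * qz * qz + a * a * qz
        ≡⟨ ring₃ a qz M ⟩
      qz * (M - a * a * qz + a * a) ∎)
      where
      open ≡-Reasoning
      ring₁ : ∀ m q b → m * q * b ≡ m * (b * q)
      ring₁ = solve-∀
      ring₂ : ∀ a q → a * a * q * q ≡ q * (a * a * q)
      ring₂ = solve-∀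
      ring₃ : ∀ a q m → q * m - a * a * q * q + a * a * q ≡ q * (m - a * a * q + a * a)
      ring₃ = solve-∀
      hyperplane : ∑V (λ v → μ v * z (B v w)) ≡ a * a * qz
      hyperplane = q-cancel (trans (hyperplane-sum (μ-invariant e∈U) (λ eq → 1≢0 (trans (sym e·w≡1) eq)))
        (trans size-U (ring₂ a qz)))

    -- `h₁` = q a² - M is the value of `h` that corresponds to the expected count a². `c₀` and `c₁`
    -- are the squared deviations from it at 0 and at the nonzero singular vectors.
    h₁ c₀ c₁ : ℤ
    h₁ = a * (qz - 1ℤ)
    c₀ = ((qz - 1ℤ) * M - h₁) * ((qz - 1ℤ) * M - h₁)
    c₁ = a * a * qz * qz * (qz - 1ℤ) * (qz - 1ℤ)

    deviation : V → ℤ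
    deviation w = (h w - h₁) * (h w - h₁)

    deviation-singular : ∀ w → S w * deviation w ≡ c₁ * S w + ι ⌊ w ≟ᵛ 0v ⌋ * (c₀ - c₁)
    deviation-singular w with w ≟ᵛ 0v
    ... | yes refl = begin
        S 0v * deviation 0v ≡⟨ cong₂ _*_ S-0v (cong (λ i → (i - h₁) * (i - h₁)) h-0v) ⟩
        1ℤ * c₀ ≡⟨ ring₁ c₀ c₁ ⟩
        c₁ * 1ℤ + 1ℤ * (c₀ - c₁) ≡⟨ cong (λ i → c₁ * i + 1ℤ * (c₀ - c₁)) (sym S-0v) ⟩
        c₁ * S 0v + 1ℤ * (c₀ - c₁) ∎
      where
      open ≡-Reasoning
      ring₁ : ∀ c d → 1ℤ * c ≡ d * 1ℤ + 1ℤ * (c - d)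
      ring₁ = solve-∀
    ... | no w≢0 = begin
        S w * deviation w ≡⟨ ℤ.*-assoc (μ w) (z (Q w)) _ ⟩
        μ w * (z (Q w) * deviation w) ≡⟨ μ-elim {λ w → z (Q w) * deviation w} {λ w → z (Q w) * c₁} w constant ⟩
        μ w * (z (Q w) * c₁) ≡⟨ ring₁ (μ w) (z (Q w)) c₁ (c₀ - c₁) ⟩
        c₁ * S w + 0ℤ * (c₀ - c₁) ∎
      where
      open ≡-Reasoning
      ring₁ : ∀ m z c d → m * (z * c) ≡ c * (m * z) + 0ℤ * d
      ring₁ = solve-∀
      ring₂ : ∀ a q → (q * (a * a * q - a * q + a - a * a * q + a * a) - (a * a * q - a * q + a) - a * (q - 1ℤ)) * (q * (a * a * q - a * q + a - a * a * q + a * a) - (a * a * q - a * q + a) - a * (q - 1ℤ))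
                      ≡ a * a * q * q * (q - 1ℤ) * (q - 1ℤ)
      ring₂ = solve-∀
      constant : w ∈U → z (Q w) * deviation w ≡ z (Q w) * c₁
      constant w∈U with Q w ≟ 0#
      ... | yes Qw = cong (1ℤ *_) (trans
              (cong (λ i → (i - h₁) * (i - h₁)) (trans (h-count w) (cong (λ i → qz * i - M) (singular-drop w∈U w≢0 Qw))))
              (ring₂ a qz))
      ... | no _   = refl

    -- The moments give the sum of the squared deviations over all of U; removing the share of 0 and
    -- of the nonzero singular vectors, known from `deviation-singular`, leaves a polynomial in a
    -- and q that is identically 0.
    variance : ∑V (λ w → μ w * (1ℤ - z (Q w)) * deviation w) ≡ 0ℤ
    variance = begin
      ∑V (λ w → μ w * (1ℤ - z (Q w)) * deviation w)
        ≡⟨ ∑-cong Vs (λ w → trans (ring₁ (μ w) (z (Q w)) (h w) h₁) (cong (λ i → μ w * (h w * h w) + (ℤ.- pos 2 * h₁ * (μ w * h w) + (h₁ * h₁ * μ w + ℤ.-1ℤ * i))) (deviation-singular w))) ⟩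
      ∑V (λ w → μ w * (h w * h w) + (ℤ.- pos 2 * h₁ * (μ w * h w) + (h₁ * h₁ * μ w + ℤ.-1ℤ * (c₁ * S w + ι ⌊ w ≟ᵛ 0v ⌋ * (c₀ - c₁)))))
        ≡⟨ ∑-+ Vs _ _ ⟩
      ∑V (λ w → μ w * (h w * h w)) + ∑V (λ w → ℤ.- pos 2 * h₁ * (μ w * h w) + (h₁ * h₁ * μ w + ℤ.-1ℤ * (c₁ * S w + ι ⌊ w ≟ᵛ 0v ⌋ * (c₀ - c₁))))
        ≡⟨ cong₂ _+_ (trans second-moment (cong₂ (λ i j → (qz - 1ℤ) * ((qz - 1ℤ) * i) * j) size-U size-S))
             (trans (∑-+ Vs _ _) (cong₂ _+_
               (trans (∑-*ˡ Vs (ℤ.- pos 2 * h₁) _) (cong (ℤ.- pos 2 * h₁ *_) (trans first-moment (cong ((qz - 1ℤ) *_) size-U))))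
               (trans (∑-+ Vs _ _) (cong₂ _+_ (trans (∑-*ˡ Vs (h₁ * h₁) μ) (cong (h₁ * h₁ *_) size-U))
                 (trans (∑-*ˡ Vs ℤ.-1ℤ _) (cong (ℤ.-1ℤ *_) (trans (∑-+ Vs _ _)
                   (cong₂ _+_ (trans (∑-*ˡ Vs c₁ S) (cong (c₁ *_) size-S)) (𝕍.∑-δ 0v (λ _ → c₀ - c₁)))))))))) ⟩
      (qz - 1ℤ) * ((qz - 1ℤ) * U) * M + (ℤ.- pos 2 * h₁ * ((qz - 1ℤ) * U) + (h₁ * h₁ * U + ℤ.-1ℤ * (c₁ * M + (c₀ - c₁))))
        ≡⟨ ring₂ a qz ⟩
      0ℤ ∎
      where
      open ≡-Reasoning
      U : ℤ
      U = a * a * qz * qz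
      ring₁ : ∀ m z h k → m * (1ℤ - z) * ((h - k) * (h - k)) ≡ m * (h * h) + (ℤ.- pos 2 * k * (m * h) + (k * k * m + ℤ.-1ℤ * (m * z * ((h - k) * (h - k)))))
      ring₁ = solve-∀
      ring₂ : ∀ a q → (q - 1ℤ) * ((q - 1ℤ) * (a * a * q * q)) * (a * a * q - a * q + a)
              + (ℤ.- pos 2 * (a * (q - 1ℤ)) * ((q - 1ℤ) * (a * a * q * q))
                 + (a * (q - 1ℤ) * (a * (q - 1ℤ)) * (a * a * q * q)
                    + ℤ.-1ℤ * (a * a * q * q * (q - 1ℤ) * (q - 1ℤ) * (a * a * q - a * q + a)
                       + (((q - 1ℤ) * (a * a * q - a * q + a) - a * (q - 1ℤ)) * ((q - 1ℤ) * (a * a * q - a * q + a) - a * (q - 1ℤ))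
                          - a * a * q * q * (q - 1ℤ) * (q - 1ℤ))))) ≡ 0ℤ
      ring₂ = solve-∀

    -- A sum of squares that vanishes vanishes termwise, so `h w` = `h₁`. The value a² is the size
    -- of the cone of a parabolic section.
    nonsingular-section : ∀ {w} → w ∈U → Q w ≢ 0# → orthogonal-singular w ≡ a * a
    nonsingular-section {w} w∈U Qw≢0 = q-cancel (begin
      qz * orthogonal-singular w ≡⟨ ring₁ (qz * orthogonal-singular w) M ⟩
      (qz * orthogonal-singular w - M) + M ≡⟨ cong (_+ M) (sym (h-count w)) ⟩
      h w + M ≡⟨ ring₂ (h w) h₁ M ⟩
      (h w - h₁) + h₁ + M ≡⟨ cong (λ i → i + h₁ + M) (square≡0 (h w - h₁) deviation≡0) ⟩
      0ℤ + h₁ + M ≡⟨ ring₃ a qz ⟩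
      qz * (a * a) ∎)
      where
      open ≡-Reasoning
      ring₁ : ∀ s m → s ≡ s - m + m
      ring₁ = solve-∀
      ring₂ : ∀ h k m → h + m ≡ h - k + k + m
      ring₂ = solve-∀
      ring₃ : ∀ a q → 0ℤ + a * (q - 1ℤ) + (a * a * q - a * q + a) ≡ q * (a * a)
      ring₃ = solve-∀
      nonneg : ∀ w → 0ℤ ℤ.≤ μ w * (1ℤ - z (Q w)) * deviation w
      nonneg w with B w x ≟ 0# | B w y ≟ 0# | Q w ≟ 0#
      ... | yes _ | yes _ | yes _ = ℤ.≤-refl
      ... | yes _ | yes _ | no _  = subst (0ℤ ℤ.≤_) (sym (ℤ.*-identityˡ (deviation w))) (square-nonneg (h w - h₁))
      ... | yes _ | no _  | _     = ℤ.≤-refl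
      ... | no _  | _     | _     = ℤ.≤-refl
      deviation≡0 : deviation w ≡ 0ℤ
      deviation≡0 = begin
        deviation w ≡⟨ sym (ℤ.*-identityˡ (deviation w)) ⟩
        1ℤ * (1ℤ - 0ℤ) * deviation w ≡⟨ cong₂ (λ i j → i * (1ℤ - j) * deviation w) (sym (μ≡1 w∈U)) (sym (z≡0 Qw≢0)) ⟩
        μ w * (1ℤ - z (Q w)) * deviation w ≡⟨ ∑≡0⇒≡0 Vs nonneg variance (𝕍.listed w) ⟩
        0ℤ ∎

-- The reflection in the pole and the entries of C²

module Reflection {q : ℕ} {F : FiniteField q} (𝒱 : QuadraticSpace F)
  (p : QuadraticSpace.V 𝒱) (κ≢0 : QuadraticSpace.Q 𝒱 p ≢ FiniteField.0# F) where

  open Counting 𝒱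
  open Solver using (solve; _:+_; _:*_; :-_; _:=_)

  κ⁻¹ : Fin q
  κ⁻¹ = inv (Q p)

  -- The reflection in p, for vectors v with B v p = 1, is v ↦ v − κ⁻¹ p; its
  -- negative again satisfies the normalisation.
  reflect : V → V
  reflect v = κ⁻¹ ⊙ p ⊕ (-ᶠ 1#) ⊙ v

  record Normalised (v : V) : Set where
    constructor _,_
    field
      singular : Q v ≡ 0#
      height   : B v p ≡ 1#

  -- Turns vector identities into field identities: a nonzero difference would have product 1 with
  -- some e.
  B-ext : ∀ {u v} → (∀ e → B e u ≡ B e v) → u ≡ v
  B-ext {u} {v} eq = go (r ≟ᵛ 0v)
    where
    r : V
    r = u ⊕ (-ᶠ 1#) ⊙ v
    go : _ → u ≡ v
    go (yes r≡0) = trans (difference u 1# v r≡0) (⊙-identity v)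
    go (no r≢0) with nondegenerate r r≢0
    ... | e , e·r≡1 = ⊥-elim (0≢1 (begin
      0# ≡⟨ solve 1 (λ b → 𝟘 := b :+ (:- 𝟙) :* b) refl (B e v) ⟩
      B e v +ᶠ (-ᶠ 1#) *ᶠ B e v ≡⟨ cong (_+ᶠ (-ᶠ 1#) *ᶠ B e v) (sym (eq e)) ⟩
      B e u +ᶠ (-ᶠ 1#) *ᶠ B e v ≡⟨ sym (B-lineʳ u (-ᶠ 1#) v e) ⟩
      B e r ≡⟨ e·r≡1 ⟩
      1# ∎))
      where open ≡-Reasoning

  B-reflect : ∀ v w → B w (reflect v) ≡ κ⁻¹ *ᶠ B w p +ᶠ -ᶠ B w v
  B-reflect v w = begin
    B w (reflect v) ≡⟨ B-lineʳ (κ⁻¹ ⊙ p) (-ᶠ 1#) v w ⟩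
    B w (κ⁻¹ ⊙ p) +ᶠ (-ᶠ 1#) *ᶠ B w v ≡⟨ cong (_+ᶠ (-ᶠ 1#) *ᶠ B w v) (trans (B-sym w _) (trans (B-⊙ κ⁻¹ p w) (cong (κ⁻¹ *ᶠ_) (B-sym p w)))) ⟩
    κ⁻¹ *ᶠ B w p +ᶠ (-ᶠ 1#) *ᶠ B w v ≡⟨ solve 3 (λ k b c → k :* b :+ (:- 𝟙) :* c := k :* b :+ :- c) refl κ⁻¹ (B w p) (B w v) ⟩
    κ⁻¹ *ᶠ B w p +ᶠ -ᶠ B w v ∎
    where open ≡-Reasoning

  B-reflect-normalised : ∀ {v w} → Normalised w → B w (reflect v) ≡ κ⁻¹ +ᶠ -ᶠ B w v
  B-reflect-normalised {v} {w} (_ , w·p≡1) = trans (B-reflect v w)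
    (trans (cong (λ i → κ⁻¹ *ᶠ i +ᶠ -ᶠ B w v) w·p≡1) (cong (_+ᶠ -ᶠ B w v) (*-identityʳ κ⁻¹)))

  -- Q of the image is κ⁻¹ - κ⁻¹, and since B(p, p) = 2κ its height is 2 - 1, in any characteristic.
  reflect-normalised : ∀ {v} → Normalised v → Normalised (reflect v)
  reflect-normalised {v} (Qv , v·p≡1) = Q-reflect , height
    where
    open ≡-Reasoning
    Q-reflect : Q (reflect v) ≡ 0#
    Q-reflect = begin
      Q (reflect v)
        ≡⟨ Q-line Qv (-ᶠ 1#) (κ⁻¹ ⊙ p) ⟩
      Q (κ⁻¹ ⊙ p) +ᶠ (-ᶠ 1#) *ᶠ B (κ⁻¹ ⊙ p) v
        ≡⟨ cong₂ (λ i j → i +ᶠ (-ᶠ 1#) *ᶠ j) (Q-⊙ κ⁻¹ p) (trans (B-⊙ κ⁻¹ p v) (cong (κ⁻¹ *ᶠ_) (trans (B-sym p v) v·p≡1))) ⟩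
      κ⁻¹ *ᶠ κ⁻¹ *ᶠ Q p +ᶠ (-ᶠ 1#) *ᶠ (κ⁻¹ *ᶠ 1#)
        ≡⟨ solve 2 (λ k i → i :* i :* k :+ (:- 𝟙) :* (i :* 𝟙) := i :* (i :* k) :+ :- i) refl (Q p) κ⁻¹ ⟩
      κ⁻¹ *ᶠ (κ⁻¹ *ᶠ Q p) +ᶠ -ᶠ κ⁻¹
        ≡⟨ cong (λ i → κ⁻¹ *ᶠ i +ᶠ -ᶠ κ⁻¹) (inv-left κ≢0) ⟩
      κ⁻¹ *ᶠ 1# +ᶠ -ᶠ κ⁻¹
        ≡⟨ solve 1 (λ i → i :* 𝟙 :+ :- i := 𝟘) refl κ⁻¹ ⟩
      0# ∎
    height : B (reflect v) p ≡ 1#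
    height = begin
      B (reflect v) p ≡⟨ B-sym _ p ⟩
      B p (reflect v) ≡⟨ B-reflect v p ⟩
      κ⁻¹ *ᶠ B p p +ᶠ -ᶠ B p v ≡⟨ cong₂ (λ i j → κ⁻¹ *ᶠ i +ᶠ -ᶠ j) (B-diagonal p) (trans (B-sym p v) v·p≡1) ⟩
      κ⁻¹ *ᶠ (Q p +ᶠ Q p) +ᶠ -ᶠ 1# ≡⟨ solve 2 (λ i k → i :* (k :+ k) :+ :- 𝟙 := i :* k :+ i :* k :+ :- 𝟙) refl κ⁻¹ (Q p) ⟩
      κ⁻¹ *ᶠ Q p +ᶠ κ⁻¹ *ᶠ Q p +ᶠ -ᶠ 1# ≡⟨ cong (λ i → i +ᶠ i +ᶠ -ᶠ 1#) (inv-left κ≢0) ⟩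
      1# +ᶠ 1# +ᶠ -ᶠ 1# ≡⟨ solve 0 (𝟙 :+ 𝟙 :+ :- 𝟙 := 𝟙) refl ⟩
      1# ∎

  reflect-involutive : ∀ v → reflect (reflect v) ≡ v
  reflect-involutive v = B-ext (λ e → trans (B-reflect (reflect v) e)
    (trans (cong (λ i → κ⁻¹ *ᶠ B e p +ᶠ -ᶠ i) (B-reflect v e))
      (solve 2 (λ k b → k :+ :- (k :+ :- b) := b) refl (κ⁻¹ *ᶠ B e p) (B e v))))

  -- The products of x with y and with `reflect y` add up to κ⁻¹, which is not 0. Hence C and D have
  -- disjoint supports.
  ≢reflect : ∀ {x y} → Normalised x → B x y ≡ 0# → B x (reflect y) ≢ 0#
  ≢reflect {x} {y} nx x⊥y eq = inv≢0 κ≢0 (trans (solve 1 (λ k → k := k :+ :- 𝟘) refl κ⁻¹)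
    (trans (cong (λ i → κ⁻¹ +ᶠ -ᶠ i) (sym x⊥y)) (trans (sym (B-reflect-normalised nx)) eq)))

module ReflectionCount {q : ℕ} {F : FiniteField q} (𝒱 : QuadraticSpace F) (a : ℤ) (elliptic : IsElliptic 𝒱 a)
  (p : QuadraticSpace.V 𝒱) (κ≢0 : QuadraticSpace.Q 𝒱 p ≢ FiniteField.0# F) where

  open Counting 𝒱
  open Elliptic 𝒱 a elliptic
  open Reflection 𝒱 p κ≢0 public
  open Solver using (solve; _:+_; _:*_; :-_; _:=_)
  private
    module 𝕍 = Enumeration enumeration
    Vs = 𝕍.elements

  -- For normalised x and y this is q - 1 times an entry of C², because it counts vectors where C²
  -- counts points.
  common : V → V → ℤ
  common x y = ∑V (λ v → (z (B v x) * z (B v y)) * z (Q v) * (1ℤ - z (B v p)))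

  ∑-complement : ∀ (f g : V → ℤ) → ∑V (λ v → f v * (1ℤ - g v)) ≡ ∑V f - ∑V (λ v → f v * g v)
  ∑-complement f g = trans (∑-cong Vs (λ v → ring₁ (f v) (g v))) (trans (∑-+ Vs f _)
    (cong (∑V f +_) (trans (∑-*ˡ Vs ℤ.-1ℤ _) (ℤ.-1*i≡-i (∑V (λ v → f v * g v))))))
    where
    ring₁ : ∀ f g → f * (1ℤ - g) ≡ f + ℤ.-1ℤ * (f * g)
    ring₁ = solve-∀

  1#≢0# : ∀ {x} → x ≡ 1# → x ≢ 0#
  1#≢0# eq eq′ = 1≢0 (trans (sym eq) eq′)

  common-same : ∀ {x} → Normalised x → common x x ≡ (qz - 1ℤ) * (a * a * qz - a * qz + a)
  common-same {x} (Qx , x·p≡1) = begin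
    common x x
      ≡⟨ ∑-cong Vs (λ v → cong (λ i → i * z (Q v) * (1ℤ - z (B v p))) (ι-idem ⌊ B v x ≟ 0# ⌋)) ⟩
    ∑V (λ v → z (B v x) * z (Q v) * (1ℤ - z (B v p)))
      ≡⟨ ∑-complement _ _ ⟩
    ∑V (λ v → z (B v x) * z (Q v)) - ∑V (λ v → z (B v x) * z (Q v) * z (B v p))
      ≡⟨ cong₂ _-_ (tangent-cone Qx (≢0⇒≢0v (1#≢0# x·p≡1))) (hyperbolic-cone Qx (1#≢0# x·p≡1)) ⟩
    a * a * qz * qz - a * qz * qz + a * qz - (a * a * qz - a * qz + a)
      ≡⟨ ring₁ a qz ⟩
    (qz - 1ℤ) * (a * a * qz - a * qz + a) ∎
    where
    open ≡-Reasoning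
    ring₁ : ∀ a q → a * a * q * q - a * q * q + a * q - (a * a * q - a * q + a) ≡ (q - 1ℤ) * (a * a * q - a * q + a)
    ring₁ = solve-∀

  -- With D = x - y the pair x, D has the same orthogonal complement as x, y, and D is singular and
  -- orthogonal to x and p. `cone-sum` along D counts the singular vectors there; translation by x,
  -- orthogonal to x and D but not to p, shows that p^⊥ takes one q-th of them.
  common-collinear : ∀ {x y} → Normalised x → Normalised y → x ≢ y → B x y ≡ 0# →
    common x y ≡ (qz - 1ℤ) * (a * a - a * qz + a)
  common-collinear {x} {y} (Qx , x·p≡1) (Qy , y·p≡1) x≢y x⊥y = q-cancel (begin
    qz * common x y
      ≡⟨ cong (qz *_) (trans (∑-cong Vs (λ v → cong (_* (1ℤ - z (B v p))) (via-D v))) (∑-complement h _)) ⟩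
    qz * (∑V h - ∑V (λ v → h v * z (B v p)))
      ≡⟨ ring₁ qz (∑V h) _ ⟩
    qz * ∑V h - qz * ∑V (λ v → h v * z (B v p))
      ≡⟨ cong (λ i → qz * ∑V h - i) (hyperplane-sum (*-invariant (cone-invariant Qx) (⊥-invariant x⊥D)) (1#≢0# x·p≡1)) ⟩
    qz * ∑V h - ∑V h
      ≡⟨ cong (λ i → qz * i - i) size-h ⟩
    qz * (a * a * qz - a * qz * qz + a * qz) - (a * a * qz - a * qz * qz + a * qz)
      ≡⟨ ring₂ a qz ⟩
    qz * ((qz - 1ℤ) * (a * a - a * qz + a)) ∎)
    where
    open ≡-Reasoning
    D : V
    D = x ⊕ (-ᶠ 1#) ⊙ y
    h : V → ℤ
    h v = z (B v x) * z (Q v) * z (B v D)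
    B-D : ∀ v → B v D ≡ B v x +ᶠ -ᶠ B v y
    B-D v = trans (B-lineʳ x (-ᶠ 1#) y v) (solve 2 (λ b c → b :+ (:- 𝟙) :* c := b :+ :- c) refl (B v x) (B v y))
    x⊥D : B x D ≡ 0#
    x⊥D = trans (B-D x) (trans (cong₂ (λ i j → i +ᶠ -ᶠ j) (B-self Qx) x⊥y) (solve 0 (𝟘 :+ :- 𝟘 := 𝟘) refl))
    p⊥D : B p D ≡ 0#
    p⊥D = trans (B-D p) (trans (cong₂ (λ i j → i +ᶠ -ᶠ j) (trans (B-sym p x) x·p≡1) (trans (B-sym p y) y·p≡1))
      (solve 0 (𝟙 :+ :- 𝟙 := 𝟘) refl))
    QD : Q D ≡ 0#
    QD = trans (Q-line Qy (-ᶠ 1#) x) (trans (cong₂ (λ i j → i +ᶠ (-ᶠ 1#) *ᶠ j) Qx x⊥y)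
      (solve 0 (𝟘 :+ (:- 𝟙) :* 𝟘 := 𝟘) refl))
    D≢0 : D ≢ 0v
    D≢0 eq = x≢y (trans (difference x 1# y eq) (⊙-identity y))
    via-D : ∀ v → (z (B v x) * z (B v y)) * z (Q v) ≡ h v
    via-D v with B v x ≟ 0#
    ... | yes v⊥x = trans (cong (λ i → 1ℤ * i * z (Q v)) (ι-⇔ (B v y ≟ 0#) (B v D ≟ 0#) to from)) (ring₃ (z (B v D)) (z (Q v)))
      where
      ring₃ : ∀ d q → 1ℤ * d * q ≡ 1ℤ * q * d
      ring₃ = solve-∀
      to : B v y ≡ 0# → B v D ≡ 0#
      to v⊥y = trans (B-D v) (trans (cong₂ (λ i j → i +ᶠ -ᶠ j) v⊥x v⊥y) (solve 0 (𝟘 :+ :- 𝟘 := 𝟘) refl))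
      from : B v D ≡ 0# → B v y ≡ 0#
      from v⊥D = trans (sym (x-y≡0 (trans (sym (B-D v)) v⊥D))) v⊥x
    ... | no _ = refl
    size-⊥ : ∑V (λ v → z (B v x) * z (B v D)) ≡ a * a * qz * qz
    size-⊥ with nondegenerate D D≢0
    -- Correcting e by a multiple of p makes it orthogonal to x, and since p ⊥ D its product with D
    -- stays 1.
    ... | e , e·D≡1 = codimension-2 {e = e ⊕ (-ᶠ B e x) ⊙ p} (≢0⇒≢0v (1#≢0# x·p≡1))
      (trans (B-line e (-ᶠ B e x) p x) (trans (cong (λ i → B e x +ᶠ (-ᶠ B e x) *ᶠ i) (trans (B-sym p x) x·p≡1))
        (solve 1 (λ b → b :+ (:- b) :* 𝟙 := 𝟘) refl (B e x))))
      (1#≢0# (trans (B-line-⊥ p⊥D (-ᶠ B e x) e) e·D≡1))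
    size-h : ∑V h ≡ a * a * qz - a * qz * qz + a * qz
    size-h = q-cancel (begin
      qz * ∑V h
        ≡⟨ cong (qz *_) (∑-cong Vs (λ v → ring₃ (z (B v x)) (z (Q v)) (z (B v D)))) ⟩
      qz * ∑V (λ v → z (B v x) * (z (B v D) * z (Q v)))
        ≡⟨ rearrange {t = ∑V (λ v → z (B v x) * z (B v D))} (cone-sum QD (⊥-invariant (trans (B-sym D x) x⊥D))) ⟩
      qz * ∑V (λ v → z (B v x) * z (Q v)) - ∑V (λ v → z (B v x)) + ∑V (λ v → z (B v x) * z (B v D))
        ≡⟨ cong₂ (λ i j → qz * i - ∑V (λ v → z (B v x)) + j) (tangent-cone Qx x≢0) size-⊥ ⟩
      qz * (a * a * qz * qz - a * qz * qz + a * qz) - ∑V (λ v → z (B v x)) + a * a * qz * qz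
        ≡⟨ cong (λ i → qz * (a * a * qz * qz - a * qz * qz + a * qz) - i + a * a * qz * qz) (hyperplane-size x≢0) ⟩
      qz * (a * a * qz * qz - a * qz * qz + a * qz) - a * a * qz * qz * qz + a * a * qz * qz
        ≡⟨ ring₄ a qz ⟩
      qz * (a * a * qz - a * qz * qz + a * qz) ∎)
      where
      x≢0 : x ≢ 0v
      x≢0 = ≢0⇒≢0v (1#≢0# x·p≡1)
      ring₃ : ∀ x q d → x * q * d ≡ x * (d * q)
      ring₃ = solve-∀
      ring₄ : ∀ a q → q * (a * a * q * q - a * q * q + a * q) - a * a * q * q * q + a * a * q * q ≡ q * (a * a * q - a * q * q + a * q)
      ring₄ = solve-∀
    ring₁ : ∀ q s t → q * (s - t) ≡ q * s - q * t
    ring₁ = solve-∀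
    ring₂ : ∀ a q → q * (a * a * q - a * q * q + a * q) - (a * a * q - a * q * q + a * q) ≡ q * ((q - 1ℤ) * (a * a - a * q + a))
    ring₂ = solve-∀

  -- A vector orthogonal to y and to `reflect y` is orthogonal to their sum κ⁻¹ p.
  common-opposite : ∀ y → common (reflect y) y ≡ 0ℤ
  common-opposite y = trans (∑-cong Vs at) (∑-zero Vs)
    where
    at : ∀ v → (z (B v (reflect y)) * z (B v y)) * z (Q v) * (1ℤ - z (B v p)) ≡ 0ℤ
    at v with B v (reflect y) ≟ 0# | B v y ≟ 0# | B v p ≟ 0#
    ... | no _  | _     | _      = refl
    ... | yes _ | no _  | _      = refl
    ... | yes _ | yes _ | yes _  = ℤ.*-zeroʳ (1ℤ * 1ℤ * z (Q v))
    ... | yes r | yes s | no v⊥̸p = ⊥-elim (v⊥̸p (*-cancel-0 (inv≢0 κ≢0) (begin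
        κ⁻¹ *ᶠ B v p ≡⟨ solve 2 (λ k b → k := k :+ :- b :+ b) refl (κ⁻¹ *ᶠ B v p) (B v y) ⟩
        κ⁻¹ *ᶠ B v p +ᶠ -ᶠ B v y +ᶠ B v y ≡⟨ cong₂ _+ᶠ_ (trans (sym (B-reflect y v)) r) s ⟩
        0# +ᶠ 0# ≡⟨ +-identityˡ 0# ⟩
        0# ∎)))
      where open ≡-Reasoning

  module _ {x y : V} (nx : Normalised x) (ny : Normalised y) (x⊥̸y : B x y ≢ 0#) where
    open Normalised nx renaming (singular to Qx; height to x·p≡1)
    open Normalised ny renaming (singular to Qy; height to y·p≡1)
    open Complement Qx Qy x⊥̸y
    private
      β : Fin q
      β = B x y
      w : V
      -- Both x and y have product 1 with p and β with each other, so this makes w orthogonal to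
      -- both.
      w = p ⊕ (-ᶠ inv β) ⊙ (x ⊕ y)

    B-w : ∀ v → B v w ≡ B v p +ᶠ (-ᶠ inv β) *ᶠ (B v x +ᶠ B v y)
    B-w v = trans (B-lineʳ p (-ᶠ inv β) (x ⊕ y) v) (cong (λ i → B v p +ᶠ (-ᶠ inv β) *ᶠ i)
      (trans (B-sym v _) (trans (B-⊕ x y v) (cong₂ _+ᶠ_ (B-sym x v) (B-sym y v)))))

    w∈U : w ∈U
    w∈U = trans (B-sym w x) (trans (B-w x) (trans (cong₂ (λ i j → i +ᶠ (-ᶠ inv β) *ᶠ (j +ᶠ β)) x·p≡1 (B-self Qx))
            (trans (solve 2 (λ i b → 𝟙 :+ (:- i) :* (𝟘 :+ b) := 𝟙 :+ :- (i :* b)) refl (inv β) β) cancels)))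
        , trans (B-sym w y) (trans (B-w y) (trans (cong₂ (λ i j → i +ᶠ (-ᶠ inv β) *ᶠ j) y·p≡1 (cong₂ _+ᶠ_ (B-sym y x) (B-self Qy)))
            (trans (solve 2 (λ i b → 𝟙 :+ (:- i) :* (b :+ 𝟘) := 𝟙 :+ :- (i :* b)) refl (inv β) β) cancels)))
      where
      cancels : 1# +ᶠ -ᶠ (inv β *ᶠ β) ≡ 0#
      cancels = trans (cong (λ i → 1# +ᶠ -ᶠ i) (inv-left x⊥̸y)) (-‿inverseʳ 1#)

    -- The correction contributes β⁻¹ through Q and -2β⁻¹ through B. Hence w is singular exactly
    -- when β = κ⁻¹, that is when x ⊥ `reflect y`; this separates `common-tangent` from
    -- `common-generic`.
    Q-w : Q w ≡ Q p +ᶠ -ᶠ inv β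
    Q-w = begin
      Q w
        ≡⟨ Q-⊕ p _ ⟩
      Q p +ᶠ Q (i ⊙ (x ⊕ y)) +ᶠ B p (i ⊙ (x ⊕ y))
        ≡⟨ cong₂ (λ s t → Q p +ᶠ s +ᶠ t)
             (trans (Q-⊙ i (x ⊕ y)) (cong (i *ᶠ i *ᶠ_) (trans (Q-⊕ x y) (cong₂ (λ s t → s +ᶠ t +ᶠ β) Qx Qy))))
             (trans (B-⊙ʳ i p (x ⊕ y)) (cong (i *ᶠ_) (trans (B-sym p _) (trans (B-⊕ x y p) (cong₂ _+ᶠ_ x·p≡1 y·p≡1))))) ⟩
      Q p +ᶠ i *ᶠ i *ᶠ (0# +ᶠ 0# +ᶠ β) +ᶠ i *ᶠ (1# +ᶠ 1#)
        ≡⟨ solve 3 (λ k j b → k :+ (:- j) :* (:- j) :* (𝟘 :+ 𝟘 :+ b) :+ (:- j) :* (𝟙 :+ 𝟙)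
                           := k :+ j :* (j :* b) :+ :- (j :+ j)) refl (Q p) (inv β) β ⟩
      Q p +ᶠ inv β *ᶠ (inv β *ᶠ β) +ᶠ -ᶠ (inv β +ᶠ inv β)
        ≡⟨ cong (λ s → Q p +ᶠ inv β *ᶠ s +ᶠ -ᶠ (inv β +ᶠ inv β)) (inv-left x⊥̸y) ⟩
      Q p +ᶠ inv β *ᶠ 1# +ᶠ -ᶠ (inv β +ᶠ inv β)
        ≡⟨ solve 2 (λ k j → k :+ j :* 𝟙 :+ :- (j :+ j) := k :+ :- j) refl (Q p) (inv β) ⟩
      Q p +ᶠ -ᶠ inv β ∎
      where
      open ≡-Reasoning
      i : Fin q
      i = -ᶠ inv β

    common-complement : common x y ≡ M - orthogonal-singular w
    common-complement = trans (∑-complement S _) (cong₂ _-_ size-S (∑-cong Vs at))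
      where
      at : ∀ v → S v * z (B v p) ≡ S v * z (B v w)
      at v = trans (ℤ.*-assoc (μ v) (z (Q v)) _) (trans
        (μ-elim {λ v → z (Q v) * z (B v p)} {λ v → z (Q v) * z (B v w)} v (λ v∈U → cong (λ i → z (Q v) * z i) (sym (B-w-U v∈U))))
        (sym (ℤ.*-assoc (μ v) (z (Q v)) _)))
        where
        B-w-U : v ∈U → B v w ≡ B v p
        B-w-U (v⊥x , v⊥y) = trans (B-w v) (trans (cong₂ (λ i j → B v p +ᶠ (-ᶠ inv β) *ᶠ (i +ᶠ j)) v⊥x v⊥y)
          (solve 2 (λ b i → b :+ (:- i) :* (𝟘 :+ 𝟘) := b) refl (B v p) (inv β)))

    private
      B-xy : B x (reflect y) ≡ κ⁻¹ +ᶠ -ᶠ β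
      B-xy = B-reflect-normalised nx

    common-tangent : x ≢ reflect y → B x (reflect y) ≡ 0# → common x y ≡ (qz - 1ℤ) * (a * a)
    common-tangent x≢ry x⊥ry = trans common-complement
      (trans (cong (λ i → M - i) (singular-drop w∈U w≢0 Qw≡0)) (ring₁ a qz M))
      where
      ring₁ : ∀ a q m → m - (m - a * a * q + a * a) ≡ (q - 1ℤ) * (a * a)
      ring₁ = solve-∀
      β≡κ⁻¹ : β ≡ κ⁻¹
      β≡κ⁻¹ = sym (x-y≡0 (trans (sym B-xy) x⊥ry))
      κ≡invβ : Q p ≡ inv β
      κ≡invβ = begin
        Q p ≡⟨ sym (*-identityʳ (Q p)) ⟩
        Q p *ᶠ 1# ≡⟨ cong (Q p *ᶠ_) (sym (inv-right x⊥̸y)) ⟩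
        Q p *ᶠ (β *ᶠ inv β) ≡⟨ cong (λ b → Q p *ᶠ (b *ᶠ inv β)) β≡κ⁻¹ ⟩
        Q p *ᶠ (κ⁻¹ *ᶠ inv β) ≡⟨ sym (*-assoc (Q p) κ⁻¹ (inv β)) ⟩
        Q p *ᶠ κ⁻¹ *ᶠ inv β ≡⟨ cong (_*ᶠ inv β) (inv-right κ≢0) ⟩
        1# *ᶠ inv β ≡⟨ *-identityˡ (inv β) ⟩
        inv β ∎
        where open ≡-Reasoning
      Qw≡0 : Q w ≡ 0#
      Qw≡0 = trans Q-w (trans (cong (λ i → i +ᶠ -ᶠ inv β) κ≡invβ) (-‿inverseʳ (inv β)))
      w≢0 : w ≢ 0v
      -- If w = 0 then p = β⁻¹(x + y), and β = κ⁻¹ turns this into x = κ⁻¹ p - y.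
      w≢0 w≡0 = x≢ry (B-ext (λ e → trans (begin
          B e x ≡⟨ solve 2 (λ b c → b := 𝟙 :* (b :+ c) :+ :- c) refl (B e x) (B e y) ⟩
          1# *ᶠ (B e x +ᶠ B e y) +ᶠ -ᶠ B e y ≡⟨ cong (λ i → i *ᶠ (B e x +ᶠ B e y) +ᶠ -ᶠ B e y) (sym (inv-right x⊥̸y)) ⟩
          β *ᶠ inv β *ᶠ (B e x +ᶠ B e y) +ᶠ -ᶠ B e y ≡⟨ cong (_+ᶠ -ᶠ B e y) (*-assoc β (inv β) _) ⟩
          β *ᶠ (inv β *ᶠ (B e x +ᶠ B e y)) +ᶠ -ᶠ B e y ≡⟨ cong₂ (λ i j → i *ᶠ j +ᶠ -ᶠ B e y) β≡κ⁻¹ (sym (at e)) ⟩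
          κ⁻¹ *ᶠ B e p +ᶠ -ᶠ B e y ∎) (sym (B-reflect y e))))
        where
        open ≡-Reasoning
        at : ∀ e → B e p ≡ inv β *ᶠ (B e x +ᶠ B e y)
        at e = x-y≡0 (trans (solve 3 (λ b i s → b :+ :- (i :* s) := b :+ (:- i) :* s) refl (B e p) (inv β) (B e x +ᶠ B e y))
          (trans (sym (B-w e)) (trans (cong (B e) w≡0) (B-0vʳ e))))

    common-generic : B x (reflect y) ≢ 0# → common x y ≡ (qz - 1ℤ) * (a * a - a)
    common-generic x⊥̸ry = trans common-complement
      (trans (cong (λ i → M - i) (nonsingular-section w∈U Qw≢0)) (ring₁ a qz))
      where
      open ≡-Reasoning
      ring₁ : ∀ a q → a * a * q - a * q + a - a * a ≡ (q - 1ℤ) * (a * a - a)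
      ring₁ = solve-∀
      Qw≢0 : Q w ≢ 0#
      Qw≢0 Qw≡0 = x⊥̸ry (begin
        B x (reflect y) ≡⟨ B-xy ⟩
        κ⁻¹ +ᶠ -ᶠ β ≡⟨ cong (λ i → i +ᶠ -ᶠ β) (begin
            κ⁻¹ ≡⟨ sym (*-identityʳ κ⁻¹) ⟩
            κ⁻¹ *ᶠ 1# ≡⟨ cong (κ⁻¹ *ᶠ_) (sym (inv-left x⊥̸y)) ⟩
            κ⁻¹ *ᶠ (inv β *ᶠ β) ≡⟨ cong (λ i → κ⁻¹ *ᶠ (i *ᶠ β)) (sym κ≡invβ) ⟩
            κ⁻¹ *ᶠ (Q p *ᶠ β) ≡⟨ sym (*-assoc κ⁻¹ (Q p) β) ⟩
            κ⁻¹ *ᶠ Q p *ᶠ β ≡⟨ cong (_*ᶠ β) (inv-left κ≢0) ⟩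
            1# *ᶠ β ≡⟨ *-identityˡ β ⟩
            β ∎) ⟩
        β +ᶠ -ᶠ β ≡⟨ -‿inverseʳ β ⟩
        0# ∎)
        where
        κ≡invβ : Q p ≡ inv β
        κ≡invβ = x-y≡0 (trans (sym Q-w) Qw≡0)

  -- Of the outcomes of the four tests five are consistent, one for each relation; the others
  -- contradict x ⊥ x or `≢reflect`.
  common-formula : ∀ {x y} → Normalised x → Normalised y →
    common x y ≡ (qz - 1ℤ) * (a * a * (qz - 1ℤ) * ι ⌊ x ≟ᵛ y ⌋ - a * a * ι ⌊ x ≟ᵛ reflect y ⌋
                              + a * (pos 2 - qz) * z (B x y) + a * z (B x (reflect y)) + a * (a - 1ℤ))
  common-formula {x} {y} nx ny with x ≟ᵛ y | x ≟ᵛ reflect y | B x y ≟ 0# | B x (reflect y) ≟ 0#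
  ... | yes refl | yes x≡ry | _        | _        = ⊥-elim (≢reflect nx x⊥x (trans (cong (B x) (sym x≡ry)) x⊥x))
    where x⊥x = B-self (Normalised.singular nx)
  ... | yes refl | no _     | no x⊥̸x   | _        = ⊥-elim (x⊥̸x (B-self (Normalised.singular nx)))
  ... | yes refl | no _     | yes x⊥x  | yes x⊥rx = ⊥-elim (≢reflect nx x⊥x x⊥rx)
  ... | yes refl | no _     | yes _    | no _     = trans (common-same nx) (cong ((qz - 1ℤ) *_) (ring₁ a qz))
    where
    ring₁ : ∀ a q → a * a * q - a * q + a ≡ a * a * (q - 1ℤ) * 1ℤ - a * a * 0ℤ + a * (pos 2 - q) * 1ℤ + a * 0ℤ + a * (a - 1ℤ)
    ring₁ = solve-∀
  ... | no _     | yes refl | _        | no x⊥̸x   = ⊥-elim (x⊥̸x (B-self (Normalised.singular nx)))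
  ... | no _     | yes refl | yes x⊥y  | yes x⊥ry = ⊥-elim (≢reflect nx x⊥y x⊥ry)
  ... | no _     | yes refl | no _     | yes _    = trans (common-opposite y) (ring₁ a qz)
    where
    ring₁ : ∀ a q → 0ℤ ≡ (q - 1ℤ) * (a * a * (q - 1ℤ) * 0ℤ - a * a * 1ℤ + a * (pos 2 - q) * 0ℤ + a * 1ℤ + a * (a - 1ℤ))
    ring₁ = solve-∀
  ... | no _     | no _     | yes x⊥y  | yes x⊥ry = ⊥-elim (≢reflect nx x⊥y x⊥ry)
  ... | no x≢y   | no _     | yes x⊥y  | no _     = trans (common-collinear nx ny x≢y x⊥y) (cong ((qz - 1ℤ) *_) (ring₁ a qz))
    where
    ring₁ : ∀ a q → a * a - a * q + a ≡ a * a * (q - 1ℤ) * 0ℤ - a * a * 0ℤ + a * (pos 2 - q) * 1ℤ + a * 0ℤ + a * (a - 1ℤ)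
    ring₁ = solve-∀
  ... | no _     | no x≢ry  | no x⊥̸y   | yes x⊥ry = trans (common-tangent nx ny x⊥̸y x≢ry x⊥ry) (cong ((qz - 1ℤ) *_) (ring₁ a qz))
    where
    ring₁ : ∀ a q → a * a ≡ a * a * (q - 1ℤ) * 0ℤ - a * a * 0ℤ + a * (pos 2 - q) * 0ℤ + a * 1ℤ + a * (a - 1ℤ)
    ring₁ = solve-∀
  ... | no _     | no _     | no x⊥̸y   | no x⊥̸ry  = trans (common-generic nx ny x⊥̸y x⊥̸ry) (cong ((qz - 1ℤ) *_) (ring₁ a qz))
    where
    ring₁ : ∀ a q → a * a - a ≡ a * a * (q - 1ℤ) * 0ℤ - a * a * 0ℤ + a * (pos 2 - q) * 0ℤ + a * 0ℤ + a * (a - 1ℤ)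
    ring₁ = solve-∀

-- The elliptic quadric in coordinates

-- An injective map missing y would, after `punchOut`, inject a finite set into a smaller one.
-- Needed for squaring in characteristic 2.
injective⇒surjective : ∀ {n} {f : Fin n → Fin n} → Injective _≡_ _≡_ f → ∀ y → ∃[ x ] (f x ≡ y)
injective⇒surjective {suc n} {f} inj y with Fin.any? (λ x → f x ≟ y)
... | yes hit = hit
... | no miss = ⊥-elim (Fin.<⇒notInjective {f = λ x → punchOut (avoids x)} (ℕ.n<1+n n)
        (λ eq → inj (Fin.punchOut-injective (avoids _) (avoids _) eq)))
  where
  avoids : ∀ x → y ≢ f x
  avoids x eq = miss (x , sym eq)

module Coordinates {q : ℕ} (F : FiniteField q) (c d : Fin q) (irreducible : Geometry.Irreducible F c d) where

  open Geometry F c d using (Vector; Qf; Bf; _⊕_; _⊙_; allVectors; allPairs)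
  open FieldSums F
  open Solver using (solve; _:+_; _:*_; :-_; _:=_)

  -- The discriminant of the irreducible polynomial; in characteristic 2 its
  -- vanishing would force c = 0, while every element is a square.
  discriminant≢0 : (1# +ᶠ 1#) *ᶠ (1# +ᶠ 1#) *ᶠ d +ᶠ -ᶠ (c *ᶠ c) ≢ 0#
  discriminant≢0 Δ≡0 = go (1# +ᶠ 1# ≟ 0#)
    where
    open ≡-Reasoning
    2# : Fin q
    2# = 1# +ᶠ 1#
    go : Dec (2# ≡ 0#) → _
    -- A vanishing discriminant makes -c/2 a double root.
    go (no 2≢0) = irreducible t (*-cancel-0 (*≢0 2≢0 2≢0) (begin
      2# *ᶠ 2# *ᶠ (t *ᶠ t +ᶠ c *ᶠ t +ᶠ d)
        ≡⟨ solve 3 (λ c i d → let 2′ = 𝟙 :+ 𝟙; t′ = (:- c) :* i in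
             2′ :* 2′ :* (t′ :* t′ :+ c :* t′ :+ d) := c :* c :* (2′ :* i) :* (2′ :* i) :+ :- (2′ :* (c :* c) :* (2′ :* i)) :+ 2′ :* 2′ :* d) refl c (inv 2#) d ⟩
      c *ᶠ c *ᶠ (2# *ᶠ inv 2#) *ᶠ (2# *ᶠ inv 2#) +ᶠ -ᶠ (2# *ᶠ (c *ᶠ c) *ᶠ (2# *ᶠ inv 2#)) +ᶠ 2# *ᶠ 2# *ᶠ d
        ≡⟨ cong (λ i → c *ᶠ c *ᶠ i *ᶠ i +ᶠ -ᶠ (2# *ᶠ (c *ᶠ c) *ᶠ i) +ᶠ 2# *ᶠ 2# *ᶠ d) (inv-right 2≢0) ⟩
      c *ᶠ c *ᶠ 1# *ᶠ 1# +ᶠ -ᶠ (2# *ᶠ (c *ᶠ c) *ᶠ 1#) +ᶠ 2# *ᶠ 2# *ᶠ d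
        ≡⟨ solve 2 (λ c d → let 1′ = 𝟙; 2′ = 1′ :+ 1′ in
             c :* c :* 1′ :* 1′ :+ :- (2′ :* (c :* c) :* 1′) :+ 2′ :* 2′ :* d := 2′ :* 2′ :* d :+ :- (c :* c)) refl c d ⟩
      2# *ᶠ 2# *ᶠ d +ᶠ -ᶠ (c *ᶠ c)
        ≡⟨ Δ≡0 ⟩
      0# ∎))
      where
      t : Fin q
      t = (-ᶠ c) *ᶠ inv 2#
    go (yes 2≡0) with injective⇒surjective squaring-injective (-ᶠ d)
      where
      squaring-injective : Injective _≡_ _≡_ (λ t → t *ᶠ t)
      squaring-injective {s} {t} eq with s +ᶠ -ᶠ t ≟ 0#
      ... | yes s-t≡0 = x-y≡0 s-t≡0
      ... | no  s-t≢0 = ⊥-elim (*≢0 s-t≢0 s-t≢0 (begin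
        (s +ᶠ -ᶠ t) *ᶠ (s +ᶠ -ᶠ t)
          ≡⟨ solve 2 (λ s t → (s :+ :- t) :* (s :+ :- t) := s :* s :+ :- (t :* t) :+ (𝟙 :+ 𝟙) :* (t :* t :+ :- (s :* t))) refl s t ⟩
        s *ᶠ s +ᶠ -ᶠ (t *ᶠ t) +ᶠ 2# *ᶠ (t *ᶠ t +ᶠ -ᶠ (s *ᶠ t))
          ≡⟨ cong₂ (λ i j → i +ᶠ -ᶠ (t *ᶠ t) +ᶠ j *ᶠ (t *ᶠ t +ᶠ -ᶠ (s *ᶠ t))) eq 2≡0 ⟩
        t *ᶠ t +ᶠ -ᶠ (t *ᶠ t) +ᶠ 0# *ᶠ (t *ᶠ t +ᶠ -ᶠ (s *ᶠ t))
          ≡⟨ solve 2 (λ t u → t :+ :- t :+ 𝟘 :* u := 𝟘) refl (t *ᶠ t) _ ⟩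
        0# ∎))
    ... | t , t²≡-d = irreducible t (begin
      t *ᶠ t +ᶠ c *ᶠ t +ᶠ d ≡⟨ cong₂ (λ i j → i +ᶠ j *ᶠ t +ᶠ d) t²≡-d c≡0 ⟩
      -ᶠ d +ᶠ 0# *ᶠ t +ᶠ d ≡⟨ solve 2 (λ d t → :- d :+ 𝟘 :* t :+ d := 𝟘) refl d t ⟩
      0# ∎)
      where
      c²≡0 : c *ᶠ c ≡ 0#
      c²≡0 = begin
        c *ᶠ c ≡⟨ solve 2 (λ u c → c := u :* u :* 𝟘 :+ :- (u :* u :* 𝟘 :+ :- c)) refl 2# (c *ᶠ c) ⟩
        2# *ᶠ 2# *ᶠ 0# +ᶠ -ᶠ (2# *ᶠ 2# *ᶠ 0# +ᶠ -ᶠ (c *ᶠ c)) ≡⟨ solve 3 (λ u d c → u :* u :* 𝟘 :+ :- (u :* u :* 𝟘 :+ :- c) := u :* u :* d :+ :- (u :* u :* d :+ :- c)) refl 2# d (c *ᶠ c) ⟩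
        2# *ᶠ 2# *ᶠ d +ᶠ -ᶠ (2# *ᶠ 2# *ᶠ d +ᶠ -ᶠ (c *ᶠ c)) ≡⟨ cong₂ (λ i j → i *ᶠ 2# *ᶠ d +ᶠ -ᶠ j) 2≡0 Δ≡0 ⟩
        0# *ᶠ 2# *ᶠ d +ᶠ -ᶠ 0# ≡⟨ solve 2 (λ u d → 𝟘 :* u :* d :+ :- 𝟘 := 𝟘) refl 2# d ⟩
        0# ∎
      c≡0 : c ≡ 0#
      c≡0 with c ≟ 0#
      ... | yes p = p
      ... | no c≢0 = *-cancel-0 c≢0 c²≡0

  -- The polar form of `Qf` written out, so that bilinearity is a polynomial identity in each
  -- coordinate pair; `Bf≡polar` links it to the form in the statement.
  polar : ∀ {m} → Vector m → Vector m → Fin q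
  polar [] [] = 0#
  polar ((x , y) ∷ []) ((x′ , y′) ∷ []) =
    ((x *ᶠ x′ +ᶠ x *ᶠ x′) +ᶠ c *ᶠ (x *ᶠ y′ +ᶠ x′ *ᶠ y)) +ᶠ d *ᶠ (y *ᶠ y′ +ᶠ y *ᶠ y′)
  polar ((x , y) ∷ u@(_ ∷ _)) ((x′ , y′) ∷ v) = (x *ᶠ y′ +ᶠ x′ *ᶠ y) +ᶠ polar u v

  0v : ∀ {m} → Vector m
  0v = Vec.replicate _ (0# , 0#)

  polar-sym : ∀ {m} (u v : Vector m) → polar u v ≡ polar v u
  polar-sym [] [] = refl
  polar-sym ((x , y) ∷ []) ((x′ , y′) ∷ []) =
    solve 6 (λ c d x y x′ y′ → ((x :* x′ :+ x :* x′) :+ c :* (x :* y′ :+ x′ :* y)) :+ d :* (y :* y′ :+ y :* y′)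
      := ((x′ :* x :+ x′ :* x) :+ c :* (x′ :* y :+ x :* y′)) :+ d :* (y′ :* y :+ y′ :* y)) refl c d x y x′ y′
  polar-sym ((x , y) ∷ u@(_ ∷ _)) ((x′ , y′) ∷ v@(_ ∷ _)) = cong₂ _+ᶠ_ (+-comm _ _) (polar-sym u v)

  polar-⊕ : ∀ {m} (u v w : Vector m) → polar (u ⊕ v) w ≡ polar u w +ᶠ polar v w
  polar-⊕ [] [] [] = sym (+-identityˡ 0#)
  polar-⊕ ((x , y) ∷ []) ((x′ , y′) ∷ []) ((s , t) ∷ []) =
    solve 8 (λ c d x y x′ y′ s t → (((x :+ x′) :* s :+ (x :+ x′) :* s) :+ c :* ((x :+ x′) :* t :+ s :* (y :+ y′))) :+ d :* ((y :+ y′) :* t :+ (y :+ y′) :* t)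
      := (((x :* s :+ x :* s) :+ c :* (x :* t :+ s :* y)) :+ d :* (y :* t :+ y :* t)) :+ (((x′ :* s :+ x′ :* s) :+ c :* (x′ :* t :+ s :* y′)) :+ d :* (y′ :* t :+ y′ :* t)))
      refl c d x y x′ y′ s t
  polar-⊕ ((x , y) ∷ u@(_ ∷ _)) ((x′ , y′) ∷ v@(_ ∷ _)) ((s , t) ∷ w@(_ ∷ _)) =
    trans (cong (((x +ᶠ x′) *ᶠ t +ᶠ s *ᶠ (y +ᶠ y′)) +ᶠ_) (polar-⊕ u v w))
      (solve 8 (λ x y x′ y′ s t p r → ((x :+ x′) :* t :+ s :* (y :+ y′)) :+ (p :+ r) := ((x :* t :+ s :* y) :+ p) :+ ((x′ :* t :+ s :* y′) :+ r))
        refl x y x′ y′ s t (polar u w) (polar v w))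

  polar-⊙ : ∀ {m} k (u v : Vector m) → polar (k ⊙ u) v ≡ k *ᶠ polar u v
  polar-⊙ k [] [] = sym (zeroʳ k)
  polar-⊙ k ((x , y) ∷ []) ((x′ , y′) ∷ []) =
    solve 7 (λ k c d x y x′ y′ → ((k :* x :* x′ :+ k :* x :* x′) :+ c :* (k :* x :* y′ :+ x′ :* (k :* y))) :+ d :* (k :* y :* y′ :+ k :* y :* y′)
      := k :* (((x :* x′ :+ x :* x′) :+ c :* (x :* y′ :+ x′ :* y)) :+ d :* (y :* y′ :+ y :* y′))) refl k c d x y x′ y′
  polar-⊙ k ((x , y) ∷ u@(_ ∷ _)) ((x′ , y′) ∷ v@(_ ∷ _)) =
    trans (cong ((k *ᶠ x *ᶠ y′ +ᶠ x′ *ᶠ (k *ᶠ y)) +ᶠ_) (polar-⊙ k u v))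
      (solve 6 (λ k x y x′ y′ p → (k :* x :* y′ :+ x′ :* (k :* y)) :+ k :* p := k :* ((x :* y′ :+ x′ :* y) :+ p)) refl k x y x′ y′ (polar u v))

  0⊙≡0v : ∀ {m} (v : Vector m) → 0# ⊙ v ≡ 0v
  0⊙≡0v []            = refl
  0⊙≡0v ((x , y) ∷ v) = cong₂ _∷_ (cong₂ _,_ (zeroˡ x) (zeroˡ y)) (0⊙≡0v v)

  polar-0v : ∀ {m} (v : Vector m) → polar 0v v ≡ 0#
  polar-0v v = trans (cong (λ u → polar u v) (sym (0⊙≡0v v))) (trans (polar-⊙ 0# v v) (zeroˡ _))

  polar-diagonal : ∀ {m} (v : Vector m) → polar v v ≡ Qf v +ᶠ Qf v
  polar-diagonal [] = sym (+-identityˡ 0#)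
  polar-diagonal ((x , y) ∷ []) =
    solve 4 (λ c d x y → ((x :* x :+ x :* x) :+ c :* (x :* y :+ x :* y)) :+ d :* (y :* y :+ y :* y)
      := ((x :* x :+ c :* (x :* y)) :+ d :* (y :* y)) :+ ((x :* x :+ c :* (x :* y)) :+ d :* (y :* y))) refl c d x y
  polar-diagonal ((x , y) ∷ v@(_ ∷ _)) = trans (cong ((x *ᶠ y +ᶠ x *ᶠ y) +ᶠ_) (polar-diagonal v))
    (solve 2 (λ s r → (s :+ s) :+ (r :+ r) := (s :+ r) :+ (s :+ r)) refl (x *ᶠ y) (Qf v))

  Qf-⊕ : ∀ {m} (u v : Vector m) → Qf (u ⊕ v) ≡ (Qf u +ᶠ Qf v) +ᶠ polar u v
  Qf-⊕ [] [] = solve 0 (𝟘 := (𝟘 :+ 𝟘) :+ 𝟘) refl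
  Qf-⊕ ((x , y) ∷ []) ((x′ , y′) ∷ []) =
    solve 6 (λ c d x y x′ y′ → ((x :+ x′) :* (x :+ x′) :+ c :* ((x :+ x′) :* (y :+ y′))) :+ d :* ((y :+ y′) :* (y :+ y′))
      := (((x :* x :+ c :* (x :* y)) :+ d :* (y :* y)) :+ ((x′ :* x′ :+ c :* (x′ :* y′)) :+ d :* (y′ :* y′)))
         :+ (((x :* x′ :+ x :* x′) :+ c :* (x :* y′ :+ x′ :* y)) :+ d :* (y :* y′ :+ y :* y′))) refl c d x y x′ y′
  Qf-⊕ ((x , y) ∷ u@(_ ∷ _)) ((x′ , y′) ∷ v@(_ ∷ _)) =
    trans (cong ((x +ᶠ x′) *ᶠ (y +ᶠ y′) +ᶠ_) (Qf-⊕ u v))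
      (solve 7 (λ x y x′ y′ s t r → (x :+ x′) :* (y :+ y′) :+ ((s :+ t) :+ r) := ((x :* y :+ s) :+ (x′ :* y′ :+ t)) :+ ((x :* y′ :+ x′ :* y) :+ r))
        refl x y x′ y′ (Qf u) (Qf v) (polar u v))

  Qf-⊙ : ∀ {m} k (v : Vector m) → Qf (k ⊙ v) ≡ (k *ᶠ k) *ᶠ Qf v
  Qf-⊙ k [] = sym (zeroʳ _)
  Qf-⊙ k ((x , y) ∷ []) =
    solve 5 (λ k c d x y → ((k :* x) :* (k :* x) :+ c :* ((k :* x) :* (k :* y))) :+ d :* ((k :* y) :* (k :* y))
      := (k :* k) :* ((x :* x :+ c :* (x :* y)) :+ d :* (y :* y))) refl k c d x y
  Qf-⊙ k ((x , y) ∷ v@(_ ∷ _)) = trans (cong ((k *ᶠ x) *ᶠ (k *ᶠ y) +ᶠ_) (Qf-⊙ k v))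
    (solve 4 (λ k x y r → (k :* x) :* (k :* y) :+ (k :* k) :* r := (k :* k) :* (x :* y :+ r)) refl k x y (Qf v))

  Qf-0v : ∀ m → Qf (0v {m}) ≡ 0#
  Qf-0v m = trans (cong Qf (sym (0⊙≡0v (0v {m})))) (trans (Qf-⊙ 0# (0v {m})) (trans (cong (_*ᶠ Qf (0v {m})) (zeroˡ 0#)) (zeroˡ _)))

  Bf≡polar : ∀ {m} (u v : Vector m) → Bf u v ≡ polar u v
  Bf≡polar u v = trans (cong (_+ᶠ (-ᶠ Qf u +ᶠ -ᶠ Qf v)) (Qf-⊕ u v))
    (solve 3 (λ a b r → ((a :+ b) :+ r) :+ (:- a :+ :- b) := r) refl (Qf u) (Qf v) (polar u v))

  ⊕⊙-translate : ∀ {m} (v : Vector m) t e → (v ⊕ (t ⊙ e)) ⊕ ((-ᶠ t) ⊙ e) ≡ v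
  ⊕⊙-translate [] t [] = refl
  ⊕⊙-translate ((x , y) ∷ v) t ((x′ , y′) ∷ e) = cong₂ _∷_ (cong₂ _,_ (back x x′) (back y y′)) (⊕⊙-translate v t e)
    where
    back : ∀ x y → (x +ᶠ t *ᶠ y) +ᶠ (-ᶠ t) *ᶠ y ≡ x
    back x y = solve 3 (λ x t y → (x :+ t :* y) :+ (:- t) :* y := x) refl x t y

  ⊕⊙-difference : ∀ {m} (u : Vector m) s v → u ⊕ ((-ᶠ s) ⊙ v) ≡ 0v → u ≡ s ⊙ v
  ⊕⊙-difference [] s [] eq = refl
  ⊕⊙-difference ((x , y) ∷ u) s ((x′ , y′) ∷ v) eq =
    cong₂ _∷_ (cong₂ _,_ (equal (cong proj₁ (Vec.∷-injectiveˡ eq))) (equal (cong proj₂ (Vec.∷-injectiveˡ eq))))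
              (⊕⊙-difference u s v (Vec.∷-injectiveʳ eq))
    where
    equal : ∀ {x y} → x +ᶠ (-ᶠ s) *ᶠ y ≡ 0# → x ≡ s *ᶠ y
    equal {x} {y} eq = x-y≡0 (trans (solve 3 (λ x s y → x :+ :- (s :* y) := x :+ (:- s) :* y) refl x s y) eq)

  ⊕⊙-cancel : ∀ {m} s (v : Vector m) → (s ⊙ v) ⊕ ((-ᶠ s) ⊙ v) ≡ 0v
  ⊕⊙-cancel s [] = refl
  ⊕⊙-cancel s ((x , y) ∷ v) = cong₂ _∷_ (cong₂ _,_ (zeroes x) (zeroes y)) (⊕⊙-cancel s v)
    where
    zeroes : ∀ x → s *ᶠ x +ᶠ (-ᶠ s) *ᶠ x ≡ 0#
    zeroes x = solve 2 (λ s x → s :* x :+ (:- s) :* x := 𝟘) refl s x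

  1⊙≡id : ∀ {m} (v : Vector m) → 1# ⊙ v ≡ v
  1⊙≡id [] = refl
  1⊙≡id ((x , y) ∷ v) = cong₂ _∷_ (cong₂ _,_ (*-identityˡ x) (*-identityˡ y)) (1⊙≡id v)

  infix 4 _≟ᵥ_
  _≟ᵥ_ : ∀ {m} → DecidableEquality (Vector m)
  _≟ᵥ_ = Vec.≡-dec (Product.≡-dec _≟_ _≟_)

  private
    to-1 : ∀ {x} y → x ≢ 0# → y ≡ inv x *ᶠ x → y ≡ 1#
    to-1 y x≢0 eq = trans eq (inv-left x≢0)

  -- A nonzero coordinate in a hyperbolic pair is detected by its partner. On the last pair A and C
  -- are the products with (1, 0) and (0, 1); if both vanish, Cramer's rule with determinant Δ gives
  -- x = y = 0.
  polar-nondegenerate : ∀ {m} (v : Vector m) → v ≢ 0v → ∃[ e ] (polar e v ≡ 1#)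
  polar-nondegenerate [] ne = ⊥-elim (ne refl)
  polar-nondegenerate ((x , y) ∷ []) ne = go (A ≟ 0#) (C ≟ 0#)
    where
    2# A C Δ : Fin q
    2# = 1# +ᶠ 1#
    A = 2# *ᶠ x +ᶠ c *ᶠ y
    C = c *ᶠ x +ᶠ 2# *ᶠ d *ᶠ y
    Δ = 2# *ᶠ 2# *ᶠ d +ᶠ -ᶠ (c *ᶠ c)
    go : Dec (A ≡ 0#) → Dec (C ≡ 0#) → ∃[ e ] (polar e ((x , y) ∷ []) ≡ 1#)
    go (no A≢0) _ = ((inv A , 0#) ∷ []) , to-1 _ A≢0
      (solve 5 (λ c d x y i → ((i :* x :+ i :* x) :+ c :* (i :* y :+ x :* 𝟘)) :+ d :* (𝟘 :* y :+ 𝟘 :* y)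
        := i :* ((𝟙 :+ 𝟙) :* x :+ c :* y)) refl c d x y (inv A))
    go (yes _) (no C≢0) = ((0# , inv C) ∷ []) , to-1 _ C≢0
      (solve 5 (λ c d x y i → ((𝟘 :* x :+ 𝟘 :* x) :+ c :* (𝟘 :* y :+ x :* i)) :+ d :* (i :* y :+ i :* y)
        := i :* (c :* x :+ (𝟙 :+ 𝟙) :* d :* y)) refl c d x y (inv C))
    go (yes A≡0) (yes C≡0) = ⊥-elim (ne (cong (_∷ []) (cong₂ _,_
      (*-cancel-0 discriminant≢0 (begin
        Δ *ᶠ x ≡⟨ solve 4 (λ c d x y → let 2′ = 𝟙 :+ 𝟙 in
                                                   (2′ :* 2′ :* d :+ :- (c :* c)) :* x := 2′ :* d :* (2′ :* x :+ c :* y) :+ :- (c :* (c :* x :+ 2′ :* d :* y))) refl c d x y ⟩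
        2# *ᶠ d *ᶠ A +ᶠ -ᶠ (c *ᶠ C) ≡⟨ cong₂ (λ i j → 2# *ᶠ d *ᶠ i +ᶠ -ᶠ (c *ᶠ j)) A≡0 C≡0 ⟩
        2# *ᶠ d *ᶠ 0# +ᶠ -ᶠ (c *ᶠ 0#) ≡⟨ solve 2 (λ u c → u :* 𝟘 :+ :- (c :* 𝟘) := 𝟘) refl (2# *ᶠ d) c ⟩
        0# ∎))
      (*-cancel-0 discriminant≢0 (begin
        Δ *ᶠ y ≡⟨ solve 4 (λ c d x y → let 2′ = 𝟙 :+ 𝟙 in
                                                   (2′ :* 2′ :* d :+ :- (c :* c)) :* y := 2′ :* (c :* x :+ 2′ :* d :* y) :+ :- (c :* (2′ :* x :+ c :* y))) refl c d x y ⟩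
        2# *ᶠ C +ᶠ -ᶠ (c *ᶠ A) ≡⟨ cong₂ (λ i j → 2# *ᶠ i +ᶠ -ᶠ (c *ᶠ j)) C≡0 A≡0 ⟩
        2# *ᶠ 0# +ᶠ -ᶠ (c *ᶠ 0#) ≡⟨ solve 2 (λ u c → u :* 𝟘 :+ :- (c :* 𝟘) := 𝟘) refl 2# c ⟩
        0# ∎)))))
      where open ≡-Reasoning
  polar-nondegenerate ((x , y) ∷ v@(_ ∷ _)) ne = go (x ≟ 0#) (y ≟ 0#) (polar-nondegenerate v)
    where
    go : Dec (x ≡ 0#) → Dec (y ≡ 0#) → (v ≢ 0v → ∃[ e ] (polar e v ≡ 1#)) → ∃[ e ] (polar e ((x , y) ∷ v) ≡ 1#)
    go (no x≢0) _ _ = ((0# , inv x) ∷ 0v) , to-1 _ x≢0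
      (trans (cong ((0# *ᶠ y +ᶠ x *ᶠ inv x) +ᶠ_) (polar-0v v)) (solve 3 (λ x y i → (𝟘 :* y :+ x :* i) :+ 𝟘 := i :* x) refl x y (inv x)))
    go (yes _) (no y≢0) _ = ((inv y , 0#) ∷ 0v) , to-1 _ y≢0
      (trans (cong ((inv y *ᶠ y +ᶠ x *ᶠ 0#) +ᶠ_) (polar-0v v)) (solve 3 (λ x y i → (i :* y :+ x :* 𝟘) :+ 𝟘 := i :* y) refl x y (inv y)))
    go (yes x≡0) (yes y≡0) ih with ih (λ v≡0 → ne (cong₂ _∷_ (cong₂ _,_ x≡0 y≡0) v≡0))
    ... | e@(_ ∷ _) , e·v≡1 = ((0# , 0#) ∷ e) , trans (cong ((0# *ᶠ y +ᶠ x *ᶠ 0#) +ᶠ_) e·v≡1)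
      (solve 2 (λ x y → (𝟘 :* y :+ x :* 𝟘) :+ 𝟙 := 𝟙) refl x y)

  ∑-allVectors : ∀ m (f : Vector (suc m) → ℤ) →
    ∑ (allVectors (suc m)) f ≡ ∑F (λ x → ∑F (λ y → ∑ (allVectors m) (λ v → f ((x , y) ∷ v))))
  ∑-allVectors m f = trans (∑-concatMap (λ p → map (p ∷_) (allVectors m)) allPairs f)
    (trans (∑-cong allPairs (λ p → ∑-map (p ∷_) (allVectors m) f)) (∑-cartesianProduct (allFin q) (allFin q) _))

  allVectors-once : ∀ m (u : Vector m) → ∑ (allVectors m) (λ v → ι ⌊ v ≟ᵥ u ⌋) ≡ 1ℤ
  allVectors-once zero [] = refl
  allVectors-once (suc m) ((x , y) ∷ u) = begin
    ∑ (allVectors (suc m)) (λ v → ι ⌊ v ≟ᵥ (x , y) ∷ u ⌋)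
      ≡⟨ ∑-allVectors m _ ⟩
    ∑F (λ s → ∑F (λ t → ∑ (allVectors m) (λ v → ι ⌊ (s , t) ∷ v ≟ᵥ (x , y) ∷ u ⌋)))
      ≡⟨ ∑-cong (allFin q) (λ s → ∑-cong (allFin q) (λ t → trans (∑-cong (allVectors m) (split s t)) (∑-*ˡ (allVectors m) (ι ⌊ s ≟ x ⌋ * ι ⌊ t ≟ y ⌋) _))) ⟩
    ∑F (λ s → ∑F (λ t → ι ⌊ s ≟ x ⌋ * ι ⌊ t ≟ y ⌋ * ∑ (allVectors m) (λ v → ι ⌊ v ≟ᵥ u ⌋)))
      ≡⟨ ∑-cong (allFin q) (λ s → ∑-cong (allFin q) (λ t → trans (cong (ι ⌊ s ≟ x ⌋ * ι ⌊ t ≟ y ⌋ *_) (allVectors-once m u)) (ℤ.*-identityʳ _))) ⟩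
    ∑F (λ s → ∑F (λ t → ι ⌊ s ≟ x ⌋ * ι ⌊ t ≟ y ⌋))
      ≡⟨ ∑-cong (allFin q) (λ s → trans (∑-*ˡ (allFin q) (ι ⌊ s ≟ x ⌋) _) (trans (cong (ι ⌊ s ≟ x ⌋ *_) (allFin-once q y)) (ℤ.*-identityʳ _))) ⟩
    ∑F (λ s → ι ⌊ s ≟ x ⌋)
      ≡⟨ allFin-once q x ⟩
    1ℤ ∎
    where
    open ≡-Reasoning
    split : ∀ s t v → ι ⌊ (s , t) ∷ v ≟ᵥ (x , y) ∷ u ⌋ ≡ ι ⌊ s ≟ x ⌋ * ι ⌊ t ≟ y ⌋ * ι ⌊ v ≟ᵥ u ⌋
    split s t v = go (s ≟ x) (t ≟ y) (v ≟ᵥ u)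
      where
      whole : Dec ((s , t) ∷ v ≡ (x , y) ∷ u)
      whole = (s , t) ∷ v ≟ᵥ (x , y) ∷ u
      go : (d₁ : Dec (s ≡ x)) (d₂ : Dec (t ≡ y)) (d₃ : Dec (v ≡ u)) → ι ⌊ whole ⌋ ≡ ι ⌊ d₁ ⌋ * ι ⌊ d₂ ⌋ * ι ⌊ d₃ ⌋
      go (yes p) (yes r) (yes s) = ι-yes whole (cong₂ _∷_ (cong₂ _,_ p r) s)
      go (yes _) (yes _) (no ne) = ι-no whole (λ eq → ne (Vec.∷-injectiveʳ eq))
      go (yes _) (no ne) _       = ι-no whole (λ eq → ne (cong proj₂ (Vec.∷-injectiveˡ eq)))
      go (no ne) _       _       = ι-no whole (λ eq → ne (cong proj₁ (Vec.∷-injectiveˡ eq)))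

  vectorEnumeration : ∀ m → Enumeration (Vector m)
  vectorEnumeration m = record { elements = allVectors m ; _≟ᵉ_ = _≟ᵥ_ ; once = allVectors-once m }

  space : ℕ → QuadraticSpace F
  space m = record
    { V = Vector m ; enumeration = vectorEnumeration m ; _⊕_ = _⊕_ ; _⊙_ = _⊙_ ; 0v = 0v ; Q = Qf ; B = polar
    ; B-sym = polar-sym ; B-⊕ = polar-⊕ ; B-⊙ = polar-⊙ ; B-0v = polar-0v ; B-diagonal = polar-diagonal
    ; Q-⊕ = Qf-⊕ ; Q-⊙ = Qf-⊙ ; Q-0v = Qf-0v m ; translate = ⊕⊙-translate ; difference = ⊕⊙-difference
    ; cancel = ⊕⊙-cancel ; ⊙-identity = 1⊙≡id ; nondegenerate = polar-nondegenerate }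

  number-of-vectors : ∀ m → ∑ (allVectors m) (λ _ → 1ℤ) ≡ pos (q ^ m) * pos (q ^ m)
  number-of-vectors zero    = refl
  number-of-vectors (suc m) = begin
    ∑ (allVectors (suc m)) (λ _ → 1ℤ) ≡⟨ ∑-allVectors m _ ⟩
    ∑F (λ _ → ∑F (λ _ → ∑ (allVectors m) (λ _ → 1ℤ))) ≡⟨ trans (∑F-const _) (cong (qz *_) (∑F-const _)) ⟩
    qz * (qz * ∑ (allVectors m) (λ _ → 1ℤ)) ≡⟨ cong (λ i → qz * (qz * i)) (number-of-vectors m) ⟩
    qz * (qz * (pos (q ^ m) * pos (q ^ m))) ≡⟨ ring₁ qz (pos (q ^ m)) ⟩
    (qz * pos (q ^ m)) * (qz * pos (q ^ m)) ≡⟨ cong₂ _*_ (sym (ℤ.pos-* q (q ^ m))) (sym (ℤ.pos-* q (q ^ m))) ⟩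
    pos (q ^ suc m) * pos (q ^ suc m) ∎
    where
    open ≡-Reasoning
    ring₁ : ∀ q a → q * (q * (a * a)) ≡ (q * a) * (q * a)
    ring₁ = solve-∀

  -- If y were nonzero, x/y would be a root of the irreducible polynomial; then only x² is left.
  anisotropic : ∀ x y → (x *ᶠ x +ᶠ c *ᶠ (x *ᶠ y)) +ᶠ d *ᶠ (y *ᶠ y) ≡ 0# → x ≡ 0# × y ≡ 0#
  anisotropic x y eq with y ≟ 0#
  ... | no y≢0 = ⊥-elim (irreducible t (begin
      t *ᶠ t +ᶠ c *ᶠ t +ᶠ d
        ≡⟨ solve 3 (λ t c d → t :* t :+ c :* t :+ d := t :* t :+ c :* t :* 𝟙 :+ d :* (𝟙 :* 𝟙)) refl t c d ⟩
      t *ᶠ t +ᶠ c *ᶠ t *ᶠ 1# +ᶠ d *ᶠ (1# *ᶠ 1#)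
        ≡⟨ cong (λ i → t *ᶠ t +ᶠ c *ᶠ t *ᶠ i +ᶠ d *ᶠ (i *ᶠ i)) (sym (inv-right y≢0)) ⟩
      t *ᶠ t +ᶠ c *ᶠ t *ᶠ (y *ᶠ inv y) +ᶠ d *ᶠ (y *ᶠ inv y *ᶠ (y *ᶠ inv y))
        ≡⟨ solve 5 (λ x y i c d → (x :* i) :* (x :* i) :+ c :* (x :* i) :* (y :* i) :+ d :* (y :* i :* (y :* i))
             := ((x :* x :+ c :* (x :* y)) :+ d :* (y :* y)) :* (i :* i)) refl x y (inv y) c d ⟩
      ((x *ᶠ x +ᶠ c *ᶠ (x *ᶠ y)) +ᶠ d *ᶠ (y *ᶠ y)) *ᶠ (inv y *ᶠ inv y)
        ≡⟨ cong (_*ᶠ (inv y *ᶠ inv y)) eq ⟩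
      0# *ᶠ (inv y *ᶠ inv y)
        ≡⟨ zeroˡ _ ⟩
      0# ∎))
    where
    open ≡-Reasoning
    t : Fin q
    t = x *ᶠ inv y
  ... | yes refl with x ≟ 0#
  ...   | yes x≡0 = x≡0 , refl
  ...   | no x≢0 = ⊥-elim (*≢0 x≢0 x≢0 (trans
      (solve 3 (λ x c d → x :* x := (x :* x :+ c :* (x :* 𝟘)) :+ d :* (𝟘 :* 𝟘)) refl x c d) eq))

  -- The equation is linear in y: one solution for each x ≠ 0, and for x = 0 either all y or none.
  hyperbola : ∀ r → ∑F (λ x → ∑F (λ y → z (x *ᶠ y +ᶠ r))) ≡ (qz - 1ℤ) + qz * z r
  hyperbola r = begin
    ∑F (λ x → ∑F (λ y → z (x *ᶠ y +ᶠ r)))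
      ≡⟨ ∑-cong (allFin q) (λ x → trans (∑-cong (allFin q) (λ y → cong z (solve 3 (λ x y r → x :* y :+ r := r :+ y :* x) refl x y r)))
           (trans (linear-roots r x) (cong ((1ℤ - z x) +_) (ring₁ qz (z x) (z r))))) ⟩
    ∑F (λ x → (1ℤ - z x) + z x * (qz * z r))
      ≡⟨ ∑-+ (allFin q) _ _ ⟩
    ∑F (λ x → 1ℤ - z x) + ∑F (λ x → z x * (qz * z r))
      ≡⟨ cong₂ _+_ units-sum (Enumeration.∑-δ (finEnumeration q) 0# (λ _ → qz * z r)) ⟩
    (qz - 1ℤ) + qz * z r ∎
    where
    open ≡-Reasoning
    ring₁ : ∀ q x r → q * (x * r) ≡ x * (q * r)
    ring₁ = solve-∀

  -- The anisotropic plane has only the zero vector; each further hyperbolic pair is summed by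
  -- `hyperbola`, with the value of the remaining form as its constant.
  number-of-singular : ∀ m → ∑ (allVectors (suc m)) (λ v → z (Qf v)) ≡
    pos (q ^ m) * pos (q ^ m) * qz - pos (q ^ m) * qz + pos (q ^ m)
  number-of-singular zero = begin
    ∑ (allVectors 1) (λ v → z (Qf v)) ≡⟨ Enumeration.∑-unique (vectorEnumeration 1) 0v _ off ⟩
    z (Qf (0v {1})) ≡⟨ z≡1 (Qf-0v 1) ⟩
    1ℤ ≡⟨ ring₁ qz ⟩
    1ℤ * 1ℤ * qz - 1ℤ * qz + 1ℤ ∎
    where
    open ≡-Reasoning
    ring₁ : ∀ q → 1ℤ ≡ 1ℤ * 1ℤ * q - 1ℤ * q + 1ℤ
    ring₁ = solve-∀
    off : ∀ v → v ≢ 0v → z (Qf v) ≡ 0ℤ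
    off ((x , y) ∷ []) ne = z≡0 (λ eq → ne (cong (_∷ []) (cong₂ _,_ (proj₁ (anisotropic x y eq)) (proj₂ (anisotropic x y eq)))))
  number-of-singular (suc m) = begin
    ∑ (allVectors (suc (suc m))) (λ v → z (Qf v))
      ≡⟨ ∑-allVectors (suc m) _ ⟩
    ∑F (λ x → ∑F (λ y → ∑ vs (λ v → z (Qf ((x , y) ∷ v)))))
      -- `Qf` unfolds to a hyperbolic pair only when the tail is visibly nonempty.
      ≡⟨ ∑-cong (allFin q) (λ x → ∑-cong (allFin q) (λ y → ∑-cong vs (λ { (_ ∷ _) → refl }))) ⟩
    ∑F (λ x → ∑F (λ y → ∑ vs (λ v → z (x *ᶠ y +ᶠ Qf v))))
      ≡⟨ ∑-cong (allFin q) (λ x → ∑-swap (allFin q) vs _) ⟩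
    ∑F (λ x → ∑ vs (λ v → ∑F (λ y → z (x *ᶠ y +ᶠ Qf v))))
      ≡⟨ ∑-swap (allFin q) vs _ ⟩
    ∑ vs (λ v → ∑F (λ x → ∑F (λ y → z (x *ᶠ y +ᶠ Qf v))))
      ≡⟨ ∑-cong vs (λ v → trans (hyperbola (Qf v)) (cong (_+ qz * z (Qf v)) (sym (ℤ.*-identityʳ (qz - 1ℤ))))) ⟩
    ∑ vs (λ v → (qz - 1ℤ) * 1ℤ + qz * z (Qf v))
      ≡⟨ trans (∑-+ vs _ _) (cong₂ _+_ (∑-*ˡ vs (qz - 1ℤ) _) (∑-*ˡ vs qz _)) ⟩
    (qz - 1ℤ) * ∑ vs (λ _ → 1ℤ) + qz * ∑ vs (λ v → z (Qf v))
      ≡⟨ cong₂ (λ i j → (qz - 1ℤ) * i + qz * j) (number-of-vectors (suc m)) (number-of-singular m) ⟩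
    (qz - 1ℤ) * (pos (q ^ suc m) * pos (q ^ suc m)) + qz * (A * A * qz - A * qz + A)
      ≡⟨ cong (λ i → (qz - 1ℤ) * (i * i) + qz * (A * A * qz - A * qz + A)) (ℤ.pos-* q (q ^ m)) ⟩
    (qz - 1ℤ) * (qz * A * (qz * A)) + qz * (A * A * qz - A * qz + A)
      ≡⟨ ring₁ qz A ⟩
    qz * A * (qz * A) * qz - qz * A * qz + qz * A
      ≡⟨ cong (λ i → i * i * qz - i * qz + i) (sym (ℤ.pos-* q (q ^ m))) ⟩
    pos (q ^ suc m) * pos (q ^ suc m) * qz - pos (q ^ suc m) * qz + pos (q ^ suc m) ∎
    where
    open ≡-Reasoning
    vs : List (Vector (suc m))
    vs = allVectors (suc m)
    A : ℤ
    A = pos (q ^ m)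
    ring₁ : ∀ q a → (q - 1ℤ) * (q * a * (q * a)) + q * (a * a * q - a * q + a) ≡ q * a * (q * a) * q - q * a * q + q * a
    ring₁ = solve-∀

-- Boolean tests and their propositions

⌊⌋-sound : ∀ {P : Set} (d : Dec P) → ⌊ d ⌋ ≡ true → P
⌊⌋-sound (yes p) _ = p

⌊⌋-complete : ∀ {P : Set} (d : Dec P) → P → ⌊ d ⌋ ≡ true
⌊⌋-complete (yes _) _ = refl
⌊⌋-complete (no ¬p) p = ⊥-elim (¬p p)

⌊⌋-refute : ∀ {P : Set} (d : Dec P) → ¬ P → ⌊ d ⌋ ≡ false
⌊⌋-refute (yes p) ¬p = ⊥-elim (¬p p)
⌊⌋-refute (no _)  _  = refl

≡⌊⌋ : ∀ {P : Set} {b} (d : Dec P) → (b ≡ true → P) → (P → b ≡ true) → b ≡ ⌊ d ⌋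
≡⌊⌋ {b = true}  d f g = sym (⌊⌋-complete d (f refl))
≡⌊⌋ {b = false} d f g = sym (⌊⌋-refute d (λ p → false≢true (g p)))
  where
  false≢true : false ≢ true
  false≢true ()

true-ext : ∀ {x y} → (x ≡ true → y ≡ true) → (y ≡ true → x ≡ true) → x ≡ y
true-ext {true}          f g = sym (f refl)
true-ext {false} {true}  f g = g refl
true-ext {false} {false} f g = refl

∧-true : ∀ {x y} → x ∧ y ≡ true → x ≡ true × y ≡ true
∧-true {true} {true} _ = refl , refl

true-∧ : ∀ {x y} → x ≡ true → y ≡ true → x ∧ y ≡ true
true-∧ refl refl = refl

not-true : ∀ {x} → not x ≡ true → x ≢ true
not-true {false} _ ()

true-not : ∀ {x} → x ≢ true → not x ≡ true
true-not {true}  ne = ⊥-elim (ne refl)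
true-not {false} ne = refl

module _ {A : Set} (f : A → Bool) where

  all-elim : ∀ xs → BL.all f xs ≡ true → ∀ {x} → x ∈ xs → f x ≡ true
  all-elim (y ∷ ys) eq (here refl) = proj₁ (∧-true eq)
  all-elim (y ∷ ys) eq (there x∈)  = all-elim ys (proj₂ (∧-true {f y} eq)) x∈

  all-intro : ∀ xs → (∀ x → f x ≡ true) → BL.all f xs ≡ true
  all-intro []       h = refl
  all-intro (x ∷ xs) h = true-∧ (h x) (all-intro xs h)

  any-elim : ∀ xs → BL.any f xs ≡ true → ∃[ x ] (f x ≡ true)
  any-elim (x ∷ xs) eq with f x in fx
  ... | true  = x , fx
  ... | false = any-elim xs eq

  any-intro : ∀ {xs x} → x ∈ xs → f x ≡ true → BL.any f xs ≡ true
  any-intro {y ∷ ys} (here refl) fx rewrite fx = refl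
  any-intro {y ∷ ys} (there x∈)  fx with f y
  ... | true  = refl
  ... | false = any-intro x∈ fx

-- Normalised points and the pole of the hyperplane

module Points {q : ℕ} (F : FiniteField q) (c d : Fin q) (irreducible : Geometry.Irreducible F c d) where

  open Geometry F c d using (Vector; _⊕_; _⊙_; isPoint; isZero; dot; _==v_; _==_; allVectors)
  open FieldSums F
  open Solver using (solve; _:+_; _:*_; :-_; _:=_)
  open Coordinates F c d irreducible

  ==v≡⌊⌋ : ∀ {m} (u v : Vector m) → (u ==v v) ≡ ⌊ u ≟ᵥ v ⌋
  ==v≡⌊⌋ u v = ≡⌊⌋ (u ≟ᵥ v) (sound u v) (λ { refl → complete u })
    where
    sound : ∀ {m} (u v : Vector m) → (u ==v v) ≡ true → u ≡ v
    sound [] [] _ = refl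
    sound ((x , y) ∷ u) ((x′ , y′) ∷ v) eq with ∧-true {x == x′} eq
    ... | p , eq′ with ∧-true {y == y′} eq′
    ...   | r , s = cong₂ _∷_ (cong₂ _,_ (⌊⌋-sound (x ≟ x′) p) (⌊⌋-sound (y ≟ y′) r)) (sound u v s)
    complete : ∀ {m} (u : Vector m) → (u ==v u) ≡ true
    complete [] = refl
    complete ((x , y) ∷ u) = true-∧ (⌊⌋-complete (x ≟ x) refl) (true-∧ (⌊⌋-complete (y ≟ y) refl) (complete u))

  isZero-false : ∀ {m} (v : Vector m) → v ≢ 0v → isZero v ≡ false
  isZero-false v v≢0 with isZero v in eq
  ... | false = refl
  ... | true  = ⊥-elim (v≢0 (sound v eq))
    where
    sound : ∀ {m} (v : Vector m) → isZero v ≡ true → v ≡ 0v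
    sound [] _ = refl
    sound ((x , y) ∷ v) eq with ∧-true {x == 0#} eq
    ... | p , eq′ with ∧-true {y == 0#} eq′
    ...   | r , s = cong₂ _∷_ (cong₂ _,_ (⌊⌋-sound (x ≟ 0#) p) (⌊⌋-sound (y ≟ 0#) r)) (sound v s)

  isZero-0v : ∀ m → isZero (0v {m}) ≡ true
  isZero-0v zero    = refl
  isZero-0v (suc m) = true-∧ (⌊⌋-complete (0# ≟ 0#) refl) (true-∧ (⌊⌋-complete (0# ≟ 0#) refl) (isZero-0v m))

  ⊙-assoc : ∀ {m} s t (v : Vector m) → s ⊙ (t ⊙ v) ≡ (s *ᶠ t) ⊙ v
  ⊙-assoc s t [] = refl
  ⊙-assoc s t ((x , y) ∷ v) = cong₂ _∷_ (cong₂ _,_ (sym (*-assoc s t x)) (sym (*-assoc s t y))) (⊙-assoc s t v)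

  -- The value 0 at the zero vector makes this homogeneous without exception (`lead-⊙`), and points
  -- are the vectors where it equals 1.
  lead : ∀ {m} → Vector m → Fin q
  lead [] = 0#
  lead ((x , y) ∷ v) = if x == 0# then (if y == 0# then lead v else y) else x

  isPoint≡lead : ∀ {m} (v : Vector m) → isPoint v ≡ (lead v == 1#)
  isPoint≡lead [] = sym (⌊⌋-refute (0# ≟ 1#) 0≢1)
  isPoint≡lead ((x , y) ∷ v) with x ≟ 0# | y ≟ 0#
  ... | yes _ | yes _ = isPoint≡lead v
  ... | yes _ | no _  = refl
  ... | no _  | _     = refl

  lead-0v : ∀ m → lead (0v {m}) ≡ 0#
  lead-0v zero = refl
  lead-0v (suc m) with 0# ≟ 0#
  ... | yes _ = lead-0v m
  ... | no ne = ⊥-elim (ne refl)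

  lead-⊙ : ∀ {m} s (v : Vector m) → lead (s ⊙ v) ≡ s *ᶠ lead v
  lead-⊙ {m} s v with s ≟ 0#
  ... | yes refl = trans (cong lead (0⊙≡0v v)) (trans (lead-0v m) (sym (zeroˡ (lead v))))
  ... | no s≢0 = go v
    where
    go : ∀ {m} (v : Vector m) → lead (s ⊙ v) ≡ s *ᶠ lead v
    go [] = sym (zeroʳ s)
    go ((x , y) ∷ v) with x ≟ 0# | s *ᶠ x ≟ 0# | y ≟ 0# | s *ᶠ y ≟ 0#
    ... | no x≢0   | yes sx≡0 | _        | _        = ⊥-elim (x≢0 (*-cancel-0 s≢0 sx≡0))
    ... | no _     | no _     | _        | _        = refl
    ... | yes refl | no sx≢0  | _        | _        = ⊥-elim (sx≢0 (zeroʳ s))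
    ... | yes _    | yes _    | yes refl | no sy≢0  = ⊥-elim (sy≢0 (zeroʳ s))
    ... | yes _    | yes _    | no y≢0   | yes sy≡0 = ⊥-elim (y≢0 (*-cancel-0 s≢0 sy≡0))
    ... | yes _    | yes _    | yes _    | yes _    = go v
    ... | yes _    | yes _    | no _     | no _     = refl

  lead≢0 : ∀ {m} (v : Vector m) → v ≢ 0v → lead v ≢ 0#
  lead≢0 [] ne _ = ne refl
  lead≢0 ((x , y) ∷ v) ne eq with x ≟ 0# | y ≟ 0#
  ... | yes refl | yes refl = lead≢0 v (λ v≡0 → ne (cong (_ ∷_) v≡0)) eq
  ... | yes _    | no y≢0   = y≢0 eq
  ... | no x≢0   | _        = x≢0 eq

  norm : ∀ {m} → Vector m → Vector m
  norm v = inv (lead v) ⊙ v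

  lead-norm : ∀ {m} (v : Vector m) → v ≢ 0v → lead (norm v) ≡ 1#
  lead-norm v v≢0 = trans (lead-⊙ (inv (lead v)) v) (inv-left (lead≢0 v v≢0))

  norm-⊙ : ∀ {m} {s} (v : Vector m) → s ≢ 0# → lead v ≡ 1# → norm (s ⊙ v) ≡ v
  norm-⊙ {s = s} v s≢0 lead≡1 = begin
    inv (lead (s ⊙ v)) ⊙ (s ⊙ v) ≡⟨ cong (λ i → inv i ⊙ (s ⊙ v)) (trans (lead-⊙ s v) (trans (cong (s *ᶠ_) lead≡1) (*-identityʳ s))) ⟩
    inv s ⊙ (s ⊙ v) ≡⟨ ⊙-assoc (inv s) s v ⟩
    (inv s *ᶠ s) ⊙ v ≡⟨ cong (_⊙ v) (inv-left s≢0) ⟩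
    1# ⊙ v ≡⟨ 1⊙≡id v ⟩
    v ∎
    where open ≡-Reasoning

  -- The points are a transversal of the nonzero scalars acting on the nonzero vectors.
  point-sum : ∀ {m} (f : Vector m → ℤ) → (∀ {t} v → t ≢ 0# → f (t ⊙ v) ≡ f v) →
    (qz - 1ℤ) * ∑ (allVectors m) (λ v → ι (isPoint v) * f v) ≡ ∑ (allVectors m) (λ v → (1ℤ - ι ⌊ v ≟ᵥ 0v ⌋) * f v)
  point-sum {m} f f-scale = begin
    (qz - 1ℤ) * ∑ vs (λ v → ι (isPoint v) * f v)
      ≡⟨ cong (_* ∑ vs (λ v → ι (isPoint v) * f v)) (sym units-sum) ⟩
    ∑F (λ t → 1ℤ - z t) * ∑ vs (λ v → ι (isPoint v) * f v)
      ≡⟨ sym (∑-*ʳ (allFin q) (∑ vs (λ v → ι (isPoint v) * f v)) _) ⟩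
    ∑F (λ t → (1ℤ - z t) * ∑ vs (λ v → ι (isPoint v) * f v))
      ≡⟨ ∑-cong (allFin q) rescale ⟩
    ∑F (λ t → (1ℤ - z t) * ∑ vs (λ v → ι (isPoint (t ⊙ v)) * f v))
      ≡⟨ ∑-cong (allFin q) (λ t → sym (∑-*ˡ vs (1ℤ - z t) _)) ⟩
    ∑F (λ t → ∑ vs (λ v → (1ℤ - z t) * (ι (isPoint (t ⊙ v)) * f v)))
      ≡⟨ ∑-swap (allFin q) vs _ ⟩
    ∑ vs (λ v → ∑F (λ t → (1ℤ - z t) * (ι (isPoint (t ⊙ v)) * f v)))
      ≡⟨ ∑-cong vs (λ v → trans (∑-cong (allFin q) (λ t → sym (ℤ.*-assoc (1ℤ - z t) (ι (isPoint (t ⊙ v))) (f v))))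
           (trans (∑-*ʳ (allFin q) (f v) _) (cong (_* f v) (transversal v)))) ⟩
    ∑ vs (λ v → (1ℤ - ι ⌊ v ≟ᵥ 0v ⌋) * f v) ∎
    where
    open ≡-Reasoning
    vs : List (Vector m)
    vs = allVectors m
    -- Substituting t ⊙ v for v moves the scalar into `isPoint`, since f does not see it.
    rescale : ∀ t → (1ℤ - z t) * ∑ vs (λ v → ι (isPoint v) * f v) ≡ (1ℤ - z t) * ∑ vs (λ v → ι (isPoint (t ⊙ v)) * f v)
    rescale t with t ≟ 0#
    ... | yes _  = refl
    ... | no t≢0 = cong ((1ℤ - 0ℤ) *_) (trans
      (sym (Enumeration.∑-reindex (vectorEnumeration m) (t ⊙_) (inv t ⊙_)
        (λ v → trans (⊙-assoc t (inv t) v) (trans (cong (_⊙ v) (inv-right t≢0)) (1⊙≡id v)))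
        (λ v → trans (⊙-assoc (inv t) t v) (trans (cong (_⊙ v) (inv-left t≢0)) (1⊙≡id v))) (λ v → ι (isPoint v) * f v)))
      (∑-cong vs (λ v → cong (ι (isPoint (t ⊙ v)) *_) (f-scale v t≢0))))
    -- Of the nonzero multiples of v ≠ 0 only the one by `inv (lead v)` is a point.
    transversal : ∀ v → ∑F (λ t → (1ℤ - z t) * ι (isPoint (t ⊙ v))) ≡ 1ℤ - ι ⌊ v ≟ᵥ 0v ⌋
    transversal v with v ≟ᵥ 0v
    ... | yes refl = trans (∑-cong (allFin q) (λ t → trans (cong (λ b → (1ℤ - z t) * ι b)
            (trans (isPoint≡lead (t ⊙ 0v {m})) (⌊⌋-refute (_ ≟ 1#) (λ eq → 0≢1 (trans (sym (trans (lead-⊙ t (0v {m})) (trans (cong (t *ᶠ_) (lead-0v m)) (zeroʳ t)))) eq)))))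
            (ℤ.*-zeroʳ (1ℤ - z t)))) (∑-zero (allFin q))
    ... | no v≢0 = trans (Enumeration.∑-unique (finEnumeration q) s _ off) (cong₂ (λ i b → (1ℤ - i) * ι b)
            (z≡0 (inv≢0 (lead≢0 v v≢0))) (trans (isPoint≡lead (s ⊙ v)) (⌊⌋-complete (_ ≟ 1#) (lead-norm v v≢0))))
      where
      s : Fin q
      s = inv (lead v)
      off : ∀ t → t ≢ s → (1ℤ - z t) * ι (isPoint (t ⊙ v)) ≡ 0ℤ
      off t t≢s = trans (cong (λ b → (1ℤ - z t) * ι b) (trans (isPoint≡lead (t ⊙ v)) (⌊⌋-refute (_ ≟ 1#) (λ eq → t≢s (begin
          t ≡⟨ sym (*-identityʳ t) ⟩
          t *ᶠ 1# ≡⟨ cong (t *ᶠ_) (sym (inv-right (lead≢0 v v≢0))) ⟩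
          t *ᶠ (lead v *ᶠ s) ≡⟨ sym (*-assoc t (lead v) s) ⟩
          t *ᶠ lead v *ᶠ s ≡⟨ cong (_*ᶠ s) (trans (sym (lead-⊙ t v)) eq) ⟩
          1# *ᶠ s ≡⟨ *-identityˡ s ⟩
          s ∎))))) (ℤ.*-zeroʳ (1ℤ - z t))

  -- The vector representing the linear form dot a; on the anisotropic plane by Cramer's rule.
  pole : ∀ {m} → Vector m → Vector m
  pole [] = []
  pole ((a₁ , a₂) ∷ []) = (i *ᶠ ((1# +ᶠ 1#) *ᶠ d *ᶠ a₁ +ᶠ -ᶠ (c *ᶠ a₂)) , i *ᶠ ((1# +ᶠ 1#) *ᶠ a₂ +ᶠ -ᶠ (c *ᶠ a₁))) ∷ []
    where i = inv ((1# +ᶠ 1#) *ᶠ (1# +ᶠ 1#) *ᶠ d +ᶠ -ᶠ (c *ᶠ c))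
  pole ((a₁ , a₂) ∷ v@(_ ∷ _)) = (a₂ , a₁) ∷ pole v

  polar-pole : ∀ {m} (a x : Vector m) → polar (pole a) x ≡ dot a x
  polar-pole [] [] = refl
  polar-pole ((a₁ , a₂) ∷ []) ((x , y) ∷ []) = trans
    (solve 7 (λ c d i a₁ a₂ x y → let 2′ = 𝟙 :+ 𝟙; s = i :* (2′ :* d :* a₁ :+ :- (c :* a₂)); t = i :* (2′ :* a₂ :+ :- (c :* a₁)) in
      ((s :* x :+ s :* x) :+ c :* (s :* y :+ x :* t)) :+ d :* (t :* y :+ t :* y) := ((2′ :* 2′ :* d :+ :- (c :* c)) :* i) :* (a₁ :* x :+ a₂ :* y))
      refl c d (inv ((1# +ᶠ 1#) *ᶠ (1# +ᶠ 1#) *ᶠ d +ᶠ -ᶠ (c *ᶠ c))) a₁ a₂ x y)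
    (trans (cong (_*ᶠ (a₁ *ᶠ x +ᶠ a₂ *ᶠ y)) (inv-right discriminant≢0)) (trans (*-identityˡ _) (sym (+-identityʳ _))))
  polar-pole ((a₁ , a₂) ∷ v@(_ ∷ _)) ((x , y) ∷ w@(_ ∷ _)) = cons v w (polar-pole v w)
    where
    -- Matching on `pole v` exposes its first pair, without which `polar` does not unfold.
    cons : ∀ {m} (v w : Vector (suc m)) → polar (pole v) w ≡ dot v w → polar (pole ((a₁ , a₂) ∷ v)) ((x , y) ∷ w) ≡ dot ((a₁ , a₂) ∷ v) ((x , y) ∷ w)
    cons v@(_ ∷ _) w eq with pole v
    ... | _ ∷ _ = cong₂ _+ᶠ_ (trans (+-comm _ _) (cong (_+ᶠ a₂ *ᶠ y) (*-comm x a₁))) eq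

  dot-0v : ∀ {m} (a : Vector m) → dot a 0v ≡ 0#
  dot-0v a = trans (sym (polar-pole a 0v)) (trans (polar-sym (pole a) 0v) (polar-0v (pole a)))

  dot-nondegenerate : ∀ {m} (a : Vector m) → (∀ x → dot a x ≡ 0#) → a ≡ 0v
  dot-nondegenerate [] h = refl
  dot-nondegenerate ((a₁ , a₂) ∷ v) h = cong₂ _∷_ (cong₂ _,_
    (trans (sym (trans (cong ((a₁ *ᶠ 1# +ᶠ a₂ *ᶠ 0#) +ᶠ_) (dot-0v v)) (solve 2 (λ a b → (a :* 𝟙 :+ b :* 𝟘) :+ 𝟘 := a) refl a₁ a₂))) (h ((1# , 0#) ∷ 0v)))
    (trans (sym (trans (cong ((a₁ *ᶠ 0# +ᶠ a₂ *ᶠ 1#) +ᶠ_) (dot-0v v)) (solve 2 (λ a b → (a :* 𝟘 :+ b :* 𝟙) :+ 𝟘 := b) refl a₁ a₂))) (h ((0# , 1#) ∷ 0v))))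
    (dot-nondegenerate v (λ x → trans (solve 3 (λ a b r → r := (a :* 𝟘 :+ b :* 𝟘) :+ r) refl a₁ a₂ (dot v x)) (h ((0# , 0#) ∷ x))))

  pole≢0v : ∀ {m} (a : Vector m) → isZero a ≡ false → pole a ≢ 0v
  pole≢0v {m} a a≢0 p≡0 = true≢false (trans (sym (isZero-0v m)) (trans (cong isZero (sym a≡0)) a≢0))
    where
    true≢false : true ≢ false
    true≢false ()
    a≡0 : a ≡ 0v
    a≡0 = dot-nondegenerate a (λ x → trans (sym (polar-pole a x)) (trans (cong (λ v → polar v x) p≡0) (polar-0v x)))

-- From the square of C to the scheme

*-nonzero : ∀ {i j} → i ≢ 0ℤ → j ≢ 0ℤ → i * j ≢ 0ℤ
*-nonzero {i} i≢0 j≢0 eq with ℤ.i*j≡0⇒i≡0∨j≡0 i eq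
... | inj₁ p = i≢0 p
... | inj₂ p = j≢0 p

ι-injective : ∀ {x y} → ι x ≡ ι y → x ≡ y
ι-injective {true}  {true}  eq = refl
ι-injective {false} {false} eq = refl
ι-injective {true}  {false} ()
ι-injective {false} {true}  ()

-- The interface between geometry and algebra: an involution, a symmetric 0-1 matrix commuting with
-- it, and the formula for its square. D is represented by `C X (σ Y)`.
record ReflectionGeometry {A : Set} (Ω : List A) (R : Fin 5 → A → A → Bool) (a q : ℤ) : Set where
  open ℤCoefficients a q
  infix 4 _≟ᵖ_
  field
    _≟ᵖ_ : DecidableEquality A
    σ    : A → A
    C    : A → A → ℤ

  I : A → A → ℤ
  I X Y = ι ⌊ X ≟ᵖ Y ⌋

  S : A → A → ℤ
  S X Y = ι ⌊ X ≟ᵖ σ Y ⌋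

  eval : Coefficients → A → A → ℤ
  eval t X Y = t 0F * I X Y + (t 1F * S X Y + (t 2F * C X Y + (t 3F * C X (σ Y) + t 4F * 1ℤ)))

  field
    once      : ∀ {X} → X ∈ Ω → ∑ Ω (λ Z → I Z X) ≡ 1ℤ
    σ-closed  : ∀ {X} → X ∈ Ω → σ X ∈ Ω
    σ-invol   : ∀ {X} → X ∈ Ω → σ (σ X) ≡ X
    C-sym     : ∀ {X Y} → X ∈ Ω → Y ∈ Ω → C X Y ≡ C Y X
    C-σ       : ∀ {X Y} → X ∈ Ω → Y ∈ Ω → C X (σ Y) ≡ C (σ X) Y
    C-idem    : ∀ X Y → C X Y * C X Y ≡ C X Y
    C-diag    : ∀ {X} → X ∈ Ω → C X X ≡ 1ℤ
    C-opp     : ∀ {X} → X ∈ Ω → C X (σ X) ≡ 0ℤ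
    C-square  : ∀ {X Y} → X ∈ Ω → Y ∈ Ω → ∑ Ω (λ Z → C X Z * C Z Y) ≡
                a * a * (q - 1ℤ) * I X Y - a * a * S X Y + a * (pos 2 - q) * C X Y + a * C X (σ Y) + a * (a - 1ℤ)
    indicator : ∀ {X Y} → X ∈ Ω → Y ∈ Ω → ∀ l → ι (R l X Y) ≡ eval (adjacency l) X Y
    base      : A
    base∈Ω    : base ∈ Ω

-- With a and q in successor form, factors such as a - 1 and q - 2 reduce to visibly nonzero
-- integers, and the absurd pattern refutes their vanishing.
module ReflectionAlgebra {A : Set} {Ω : List A} {R : Fin 5 → A → A → Bool} {r s : ℕ}
  (𝒢 : ReflectionGeometry Ω R (pos (2 ℕ.+ s)) (pos (3 ℕ.+ r))) where

  a q : ℤ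
  a = pos (2 ℕ.+ s)
  q = pos (3 ℕ.+ r)

  open ReflectionGeometry 𝒢 public
  open ℤCoefficients a q public

  ∑-δ : ∀ {X} → X ∈ Ω → ∀ (f : A → ℤ) → ∑ Ω (λ Z → ι ⌊ Z ≟ᵖ X ⌋ * f Z) ≡ f X
  ∑-δ {X} X∈ f = trans (∑-cong Ω at) (trans (∑-*ʳ Ω (f X) _) (trans (cong (_* f X) (once X∈)) (ℤ.*-identityˡ (f X))))
    where
    at : ∀ Z → ι ⌊ Z ≟ᵖ X ⌋ * f Z ≡ ι ⌊ Z ≟ᵖ X ⌋ * f X
    at Z with Z ≟ᵖ X
    ... | yes refl = refl
    ... | no _     = refl

  I-sym : ∀ X Y → I X Y ≡ I Y X
  I-sym X Y = ι-⇔ (X ≟ᵖ Y) (Y ≟ᵖ X) sym sym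

  S-move : ∀ {X Y} → X ∈ Ω → Y ∈ Ω → S X Y ≡ I (σ X) Y
  S-move X∈ Y∈ = ι-⇔ (_ ≟ᵖ _) (_ ≟ᵖ _) (λ eq → trans (cong σ eq) (σ-invol Y∈)) (λ eq → trans (sym (σ-invol X∈)) (cong σ eq))

  S-sym : ∀ {X Y} → X ∈ Ω → Y ∈ Ω → S X Y ≡ S Y X
  S-sym X∈ Y∈ = trans (S-move X∈ Y∈) (I-sym _ _)

  D-sym : ∀ {X Y} → X ∈ Ω → Y ∈ Ω → C X (σ Y) ≡ C Y (σ X)
  D-sym X∈ Y∈ = trans (C-σ X∈ Y∈) (C-sym (σ-closed X∈) Y∈)

  X≢σX : ∀ {X} → X ∈ Ω → X ≢ σ X
  X≢σX {X} X∈ eq with trans (sym (C-diag X∈)) (trans (cong (C X) eq) (C-opp X∈))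
  ... | ()

  ∑-linear : ∀ (t : Coefficients) (f₀ f₁ f₂ f₃ f₄ : A → ℤ) →
    ∑ Ω (λ Z → t 0F * f₀ Z + (t 1F * f₁ Z + (t 2F * f₂ Z + (t 3F * f₃ Z + t 4F * f₄ Z)))) ≡
    t 0F * ∑ Ω f₀ + (t 1F * ∑ Ω f₁ + (t 2F * ∑ Ω f₂ + (t 3F * ∑ Ω f₃ + t 4F * ∑ Ω f₄)))
  ∑-linear t f₀ f₁ f₂ f₃ f₄ =
    trans (∑-+ Ω _ _) (cong₂ _+_ (∑-*ˡ Ω (t 0F) f₀)
      (trans (∑-+ Ω _ _) (cong₂ _+_ (∑-*ˡ Ω (t 1F) f₁)
        (trans (∑-+ Ω _ _) (cong₂ _+_ (∑-*ˡ Ω (t 2F) f₂)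
          (trans (∑-+ Ω _ _) (cong₂ _+_ (∑-*ˡ Ω (t 3F) f₃) (∑-*ˡ Ω (t 4F) f₄))))))))

  cong₅ : ∀ (t : Coefficients) {i i′ s s′ c c′ d d′ j j′} → i ≡ i′ → s ≡ s′ → c ≡ c′ → d ≡ d′ → j ≡ j′ →
    t 0F * i + (t 1F * s + (t 2F * c + (t 3F * d + t 4F * j))) ≡ t 0F * i′ + (t 1F * s′ + (t 2F * c′ + (t 3F * d′ + t 4F * j′)))
  cong₅ t refl refl refl refl refl = refl

  -- For a symmetric 0-1 matrix the row sum is the diagonal entry of the square, so the valency is
  -- already contained in `C-square`.
  row-sum : ∀ {X} → X ∈ Ω → ∑ Ω (C X) ≡ valency
  row-sum {X} X∈ = begin
    ∑ Ω (C X) ≡⟨ ∑-cong∈ Ω (λ Z Z∈ → trans (sym (C-idem X Z)) (cong (C X Z *_) (C-sym X∈ Z∈))) ⟩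
    ∑ Ω (λ Z → C X Z * C Z X) ≡⟨ C-square X∈ X∈ ⟩
    a * a * (q - 1ℤ) * I X X - a * a * S X X + a * (pos 2 - q) * C X X + a * C X (σ X) + a * (a - 1ℤ)
      ≡⟨ cong₂ (λ i j → a * a * (q - 1ℤ) * i - a * a * j + a * (pos 2 - q) * C X X + a * C X (σ X) + a * (a - 1ℤ))
           (ι-yes (X ≟ᵖ X) refl) (ι-no (X ≟ᵖ σ X) (X≢σX X∈)) ⟩
    a * a * (q - 1ℤ) * 1ℤ - a * a * 0ℤ + a * (pos 2 - q) * C X X + a * C X (σ X) + a * (a - 1ℤ)
      ≡⟨ cong₂ (λ i j → a * a * (q - 1ℤ) * 1ℤ - a * a * 0ℤ + a * (pos 2 - q) * i + a * j + a * (a - 1ℤ)) (C-diag X∈) (C-opp X∈) ⟩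
    a * a * (q - 1ℤ) * 1ℤ - a * a * 0ℤ + a * (pos 2 - q) * 1ℤ + a * 0ℤ + a * (a - 1ℤ)
      ≡⟨ ring₁ a q ⟩
    valency ∎
    where
    open ≡-Reasoning
    ring₁ : ∀ a q → a * a * (q - 1ℤ) * 1ℤ - a * a * 0ℤ + a * (pos 2 - q) * 1ℤ + a * 0ℤ + a * (a - 1ℤ) ≡ a * (a * q + - q + 1ℤ)
    ring₁ = solve-∀

  row-sum-σ : ∀ {X} → X ∈ Ω → ∑ Ω (λ Z → C X (σ Z)) ≡ valency
  row-sum-σ X∈ = trans (∑-cong∈ Ω (λ Z Z∈ → C-σ X∈ Z∈)) (row-sum (σ-closed X∈))

  I-sum : ∀ {X} → X ∈ Ω → ∑ Ω (λ Z → I X Z) ≡ 1ℤ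
  I-sum X∈ = trans (∑-cong Ω (λ Z → I-sym _ Z)) (once X∈)

  S-sum : ∀ {X} → X ∈ Ω → ∑ Ω (λ Z → S X Z) ≡ 1ℤ
  S-sum X∈ = trans (∑-cong∈ Ω (λ Z Z∈ → S-sym X∈ Z∈)) (once (σ-closed X∈))

  a[a-1]≢0 : a * (a - 1ℤ) ≢ 0ℤ
  a[a-1]≢0 = *-nonzero {a} {a - 1ℤ} (λ ()) (λ ())

  -- Summing the rows of C² once directly and once by the formula for C².
  Ω-size : ∑ Ω (λ _ → 1ℤ) ≡ order
  Ω-size = ℤ.*-cancelˡ-≡ (a * (a - 1ℤ)) _ _ {{ℤ.≢-nonZero a[a-1]≢0}} (begin
    a * (a - 1ℤ) * ∑ Ω (λ _ → 1ℤ)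
      ≡⟨ ring₁ a q (∑ Ω (λ _ → 1ℤ)) valency ⟩
    (a * a * (q - 1ℤ) * 1ℤ + ((- (a * a)) * 1ℤ + (a * (pos 2 - q) * valency + (a * valency + a * (a - 1ℤ) * ∑ Ω (λ _ → 1ℤ)))))
      - (a * a * (q - pos 2) + a * (pos 3 - q) * valency)
      ≡⟨ cong (_- (a * a * (q - pos 2) + a * (pos 3 - q) * valency)) (trans (sym by-formula) direct) ⟩
    valency * valency - (a * a * (q - pos 2) + a * (pos 3 - q) * valency)
      ≡⟨ ring₂ a q ⟩
    a * (a - 1ℤ) * order ∎)
    where
    open ≡-Reasoning
    X : A
    X = base
    X∈ : X ∈ Ω
    X∈ = base∈Ω
    direct : ∑ Ω (λ Y → ∑ Ω (λ Z → C X Z * C Z Y)) ≡ valency * valency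
    direct = begin
      ∑ Ω (λ Y → ∑ Ω (λ Z → C X Z * C Z Y)) ≡⟨ ∑-swap Ω Ω _ ⟩
      ∑ Ω (λ Z → ∑ Ω (λ Y → C X Z * C Z Y)) ≡⟨ ∑-cong∈ Ω (λ Z Z∈ → trans (∑-*ˡ Ω (C X Z) _) (cong (C X Z *_) (row-sum Z∈))) ⟩
      ∑ Ω (λ Z → C X Z * valency) ≡⟨ trans (∑-*ʳ Ω valency _) (cong (_* valency) (row-sum X∈)) ⟩
      valency * valency ∎
    u : Coefficients
    u = coefficients (a * a * (q - 1ℤ)) (- (a * a)) (a * (pos 2 - q)) a (a * (a - 1ℤ))
    by-formula : ∑ Ω (λ Y → ∑ Ω (λ Z → C X Z * C Z Y)) ≡
      a * a * (q - 1ℤ) * 1ℤ + ((- (a * a)) * 1ℤ + (a * (pos 2 - q) * valency + (a * valency + a * (a - 1ℤ) * ∑ Ω (λ _ → 1ℤ))))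
    by-formula = begin
      ∑ Ω (λ Y → ∑ Ω (λ Z → C X Z * C Z Y))
        ≡⟨ ∑-cong∈ Ω (λ Y Y∈ → trans (C-square X∈ Y∈) (ring₃ a q (I X Y) (S X Y) (C X Y) (C X (σ Y)))) ⟩
      ∑ Ω (λ Y → u 0F * I X Y + (u 1F * S X Y + (u 2F * C X Y + (u 3F * C X (σ Y) + u 4F * 1ℤ))))
        ≡⟨ ∑-linear u _ _ _ _ _ ⟩
      u 0F * ∑ Ω (λ Y → I X Y) + (u 1F * ∑ Ω (λ Y → S X Y) + (u 2F * ∑ Ω (C X) + (u 3F * ∑ Ω (λ Y → C X (σ Y)) + u 4F * ∑ Ω (λ _ → 1ℤ))))
        ≡⟨ cong₅ u (I-sum X∈) (S-sum X∈) (row-sum X∈) (row-sum-σ X∈) refl ⟩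
      u 0F * 1ℤ + (u 1F * 1ℤ + (u 2F * valency + (u 3F * valency + u 4F * ∑ Ω (λ _ → 1ℤ)))) ∎
      where
      ring₃ : ∀ a q i s c d → a * a * (q - 1ℤ) * i - a * a * s + a * (pos 2 - q) * c + a * d + a * (a - 1ℤ)
              ≡ a * a * (q - 1ℤ) * i + ((- (a * a)) * s + (a * (pos 2 - q) * c + (a * d + a * (a - 1ℤ) * 1ℤ)))
      ring₃ = solve-∀
    ring₁ : ∀ a q n k → a * (a - 1ℤ) * n ≡
      (a * a * (q - 1ℤ) * 1ℤ + ((- (a * a)) * 1ℤ + (a * (pos 2 - q) * k + (a * k + a * (a - 1ℤ) * n)))) - (a * a * (q - pos 2) + a * (pos 3 - q) * k)
    ring₁ = solve-∀
    ring₂ : ∀ a q → a * (a * q + - q + 1ℤ) * (a * (a * q + - q + 1ℤ)) - (a * a * (q - pos 2) + a * (pos 3 - q) * (a * (a * q + - q + 1ℤ)))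
            ≡ a * (a - 1ℤ) * (a * q * (a * q + - 1ℤ))
    ring₂ = solve-∀

  eval-swap : ∀ t X {Y} → Y ∈ Ω → eval t X (σ Y) ≡ eval (swap t) X Y
  eval-swap t X {Y} Y∈ = trans (cong₂ (λ i j → t 0F * S X Y + (t 1F * i + (t 2F * C X (σ Y) + (t 3F * j + t 4F * 1ℤ))))
      (cong (λ Z → I X Z) (σ-invol Y∈)) (cong (C X) (σ-invol Y∈)))
    (ring₁ (t 0F) (t 1F) (t 2F) (t 3F) (t 4F) (I X Y) (S X Y) (C X Y) (C X (σ Y)))
    where
    ring₁ : ∀ t₀ t₁ t₂ t₃ t₄ i s c d → t₀ * s + (t₁ * i + (t₂ * d + (t₃ * c + t₄ * 1ℤ))) ≡ t₁ * i + (t₀ * s + (t₃ * c + (t₂ * d + t₄ * 1ℤ)))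
    ring₁ = solve-∀

  eval-total : ∀ t {X} → X ∈ Ω → ∑ Ω (eval t X) ≡ total t
  eval-total t X∈ = trans (∑-linear t _ _ _ _ _)
    (trans (cong₅ t (I-sum X∈) (S-sum X∈) (row-sum X∈) (row-sum-σ X∈) Ω-size) (ring₁ (t 0F) (t 1F) (t 2F) (t 3F) (t 4F) valency order))
    where
    ring₁ : ∀ t₀ t₁ t₂ t₃ t₄ k n → t₀ * 1ℤ + (t₁ * 1ℤ + (t₂ * k + (t₃ * k + t₄ * n))) ≡ t₀ + t₁ + k * (t₂ + t₃) + n * t₄
    ring₁ = solve-∀

  -- The formula for C² at σ X and Y: `C-σ` moves the involution to the left factor.
  C-square-σ : ∀ {X Y} → X ∈ Ω → Y ∈ Ω → ∑ Ω (λ Z → C X (σ Z) * C Z Y) ≡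
    a * a * (q - 1ℤ) * S X Y - a * a * I X Y + a * (pos 2 - q) * C X (σ Y) + a * C X Y + a * (a - 1ℤ)
  C-square-σ {X} {Y} X∈ Y∈ = begin
    ∑ Ω (λ Z → C X (σ Z) * C Z Y)
      ≡⟨ ∑-cong∈ Ω (λ Z Z∈ → cong (_* C Z Y) (C-σ X∈ Z∈)) ⟩
    ∑ Ω (λ Z → C (σ X) Z * C Z Y)
      ≡⟨ C-square (σ-closed X∈) Y∈ ⟩
    formula (I (σ X) Y) (S (σ X) Y) (C (σ X) Y) (C (σ X) (σ Y))
      ≡⟨ cong₂ (λ i j → formula i j (C (σ X) Y) (C (σ X) (σ Y))) (sym (S-move X∈ Y∈))
           (trans (sym (S-move X∈ (σ-closed Y∈))) (cong (λ Z → I X Z) (σ-invol Y∈))) ⟩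
    formula (S X Y) (I X Y) (C (σ X) Y) (C (σ X) (σ Y))
      ≡⟨ cong₂ (formula (S X Y) (I X Y)) (sym (C-σ X∈ Y∈))
           (trans (sym (C-σ X∈ (σ-closed Y∈))) (cong (C X) (σ-invol Y∈))) ⟩
    formula (S X Y) (I X Y) (C X (σ Y)) (C X Y) ∎
    where
    open ≡-Reasoning
    formula : ℤ → ℤ → ℤ → ℤ → ℤ
    formula i s c d = a * a * (q - 1ℤ) * i - a * a * s + a * (pos 2 - q) * c + a * d + a * (a - 1ℤ)

  eval-timesC : ∀ t {X Y} → X ∈ Ω → Y ∈ Ω → ∑ Ω (λ Z → eval t X Z * C Z Y) ≡ eval (timesC t) X Y
  eval-timesC t {X} {Y} X∈ Y∈ = begin
    ∑ Ω (λ Z → eval t X Z * C Z Y)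
      ≡⟨ ∑-cong Ω (λ Z → ring₁ (t 0F) (t 1F) (t 2F) (t 3F) (t 4F) (I X Z) (S X Z) (C X Z) (C X (σ Z)) (C Z Y)) ⟩
    ∑ Ω (λ Z → t 0F * (I X Z * C Z Y) + (t 1F * (S X Z * C Z Y) + (t 2F * (C X Z * C Z Y) + (t 3F * (C X (σ Z) * C Z Y) + t 4F * C Z Y))))
      ≡⟨ ∑-linear t _ _ _ _ _ ⟩
    t 0F * ∑ Ω (λ Z → I X Z * C Z Y) + (t 1F * ∑ Ω (λ Z → S X Z * C Z Y) + (t 2F * ∑ Ω (λ Z → C X Z * C Z Y)
      + (t 3F * ∑ Ω (λ Z → C X (σ Z) * C Z Y) + t 4F * ∑ Ω (λ Z → C Z Y))))
      ≡⟨ cong₅ t (trans (∑-cong Ω (λ Z → cong (_* C Z Y) (I-sym X Z))) (∑-δ X∈ (λ Z → C Z Y)))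
                 (trans (∑-cong∈ Ω (λ Z Z∈ → cong (_* C Z Y) (S-sym X∈ Z∈))) (trans (∑-δ (σ-closed X∈) (λ Z → C Z Y)) (sym (C-σ X∈ Y∈))))
                 (C-square X∈ Y∈) (C-square-σ X∈ Y∈) (trans (∑-cong∈ Ω (λ Z Z∈ → C-sym Z∈ Y∈)) (row-sum Y∈)) ⟩
    t 0F * C X Y + (t 1F * C X (σ Y) + (t 2F * (a * a * (q - 1ℤ) * I X Y - a * a * S X Y + a * (pos 2 - q) * C X Y + a * C X (σ Y) + a * (a - 1ℤ))
      + (t 3F * (a * a * (q - 1ℤ) * S X Y - a * a * I X Y + a * (pos 2 - q) * C X (σ Y) + a * C X Y + a * (a - 1ℤ)) + t 4F * valency)))
      ≡⟨ ring₂ a q (t 0F) (t 1F) (t 2F) (t 3F) (t 4F) (I X Y) (S X Y) (C X Y) (C X (σ Y)) valency ⟩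
    eval (timesC t) X Y ∎
    where
    open ≡-Reasoning
    ring₁ : ∀ t₀ t₁ t₂ t₃ t₄ i s c d e → (t₀ * i + (t₁ * s + (t₂ * c + (t₃ * d + t₄ * 1ℤ)))) * e ≡ t₀ * (i * e) + (t₁ * (s * e) + (t₂ * (c * e) + (t₃ * (d * e) + t₄ * e)))
    ring₁ = solve-∀
    ring₂ : ∀ a q t₀ t₁ t₂ t₃ t₄ i s c d k →
      t₀ * c + (t₁ * d + (t₂ * (a * a * (q - 1ℤ) * i - a * a * s + a * (pos 2 - q) * c + a * d + a * (a - 1ℤ))
        + (t₃ * (a * a * (q - 1ℤ) * s - a * a * i + a * (pos 2 - q) * d + a * c + a * (a - 1ℤ)) + t₄ * k)))
      ≡ (a * a * (q + - 1ℤ) * t₂ + - (a * a) * t₃) * i + ((- (a * a) * t₂ + a * a * (q + - 1ℤ) * t₃) * s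
        + ((t₀ + (a * (pos 2 + - q) * t₂ + a * t₃)) * c + ((t₁ + (a * t₂ + a * (pos 2 + - q) * t₃)) * d + (a * (a + - 1ℤ) * (t₂ + t₃) + k * t₄) * 1ℤ)))
    ring₂ = solve-∀

  -- The right factor is split into I, S, C, D and J, handled in turn by a delta, `swap`, `timesC`,
  -- both of these, and the row total. The algebra is therefore closed.
  eval-product : ∀ t u {X Y} → X ∈ Ω → Y ∈ Ω → ∑ Ω (λ Z → eval t X Z * eval u Z Y) ≡ eval (t ⊛ u) X Y
  eval-product t u {X} {Y} X∈ Y∈ = begin
    ∑ Ω (λ Z → f Z * eval u Z Y)
      ≡⟨ ∑-cong Ω (λ Z → ring₁ (u 0F) (u 1F) (u 2F) (u 3F) (u 4F) (I Z Y) (S Z Y) (C Z Y) (C Z (σ Y)) (f Z)) ⟩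
    ∑ Ω (λ Z → u 0F * (I Z Y * f Z) + (u 1F * (S Z Y * f Z) + (u 2F * (f Z * C Z Y) + (u 3F * (f Z * C Z (σ Y)) + u 4F * f Z))))
      ≡⟨ ∑-linear u _ _ _ _ _ ⟩
    u 0F * ∑ Ω (λ Z → I Z Y * f Z) + (u 1F * ∑ Ω (λ Z → S Z Y * f Z) + (u 2F * ∑ Ω (λ Z → f Z * C Z Y)
      + (u 3F * ∑ Ω (λ Z → f Z * C Z (σ Y)) + u 4F * ∑ Ω f)))
      ≡⟨ cong₅ u (∑-δ Y∈ f) (trans (∑-δ (σ-closed Y∈) f) (eval-swap t X Y∈)) (eval-timesC t X∈ Y∈)
                 (trans (eval-timesC t X∈ (σ-closed Y∈)) (eval-swap (timesC t) X Y∈)) (eval-total t X∈) ⟩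
    u 0F * eval t X Y + (u 1F * eval (swap t) X Y + (u 2F * eval (timesC t) X Y + (u 3F * eval (swap (timesC t)) X Y + u 4F * total t)))
      ≡⟨ combine (u 0F) (u 1F) (u 2F) (u 3F) (u 4F) (total t) t (swap t) (timesC t) (swap (timesC t)) ⟩
    eval (t ⊛ u) X Y ∎
    where
    open ≡-Reasoning
    f : A → ℤ
    f = eval t X
    ring₁ : ∀ u₀ u₁ u₂ u₃ u₄ i s c d f → f * (u₀ * i + (u₁ * s + (u₂ * c + (u₃ * d + u₄ * 1ℤ)))) ≡ u₀ * (i * f) + (u₁ * (s * f) + (u₂ * (f * c) + (u₃ * (f * d) + u₄ * f)))
    ring₁ = solve-∀
    ring₂ : ∀ u₀ u₁ u₂ u₃ u₄ v₁ v₂ v₃ v₄ w₁ w₂ w₃ w₄ x₁ x₂ x₃ x₄ y₁ y₂ y₃ y₄ z₁ z₂ z₃ z₄ n i s c d →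
      u₀ * (v₁ * i + (w₁ * s + (x₁ * c + (y₁ * d + z₁ * 1ℤ)))) + (u₁ * (v₂ * i + (w₂ * s + (x₂ * c + (y₂ * d + z₂ * 1ℤ))))
       + (u₂ * (v₃ * i + (w₃ * s + (x₃ * c + (y₃ * d + z₃ * 1ℤ)))) + (u₃ * (v₄ * i + (w₄ * s + (x₄ * c + (y₄ * d + z₄ * 1ℤ)))) + u₄ * n)))
      ≡ (u₀ * v₁ + u₁ * v₂ + u₂ * v₃ + u₃ * v₄ + u₄ * 0ℤ) * i + ((u₀ * w₁ + u₁ * w₂ + u₂ * w₃ + u₃ * w₄ + u₄ * 0ℤ) * s
       + ((u₀ * x₁ + u₁ * x₂ + u₂ * x₃ + u₃ * x₄ + u₄ * 0ℤ) * c + ((u₀ * y₁ + u₁ * y₂ + u₂ * y₃ + u₃ * y₄ + u₄ * 0ℤ) * d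
       + (u₀ * z₁ + u₁ * z₂ + u₂ * z₃ + u₃ * z₄ + u₄ * n) * 1ℤ)))
    ring₂ = solve-∀
    combine : ∀ u₀ u₁ u₂ u₃ u₄ n (t₁ t₂ t₃ t₄ : Coefficients) →
      u₀ * eval t₁ X Y + (u₁ * eval t₂ X Y + (u₂ * eval t₃ X Y + (u₃ * eval t₄ X Y + u₄ * n)))
      ≡ eval (λ k → u₀ * t₁ k + u₁ * t₂ k + u₂ * t₃ k + u₃ * t₄ k + u₄ * coefficients 0ℤ 0ℤ 0ℤ 0ℤ n k) X Y
    combine u₀ u₁ u₂ u₃ u₄ n t₁ t₂ t₃ t₄ = ring₂ u₀ u₁ u₂ u₃ u₄
      (t₁ 0F) (t₂ 0F) (t₃ 0F) (t₄ 0F) (t₁ 1F) (t₂ 1F) (t₃ 1F) (t₄ 1F) (t₁ 2F) (t₂ 2F) (t₃ 2F) (t₄ 2F)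
      (t₁ 3F) (t₂ 3F) (t₃ 3F) (t₄ 3F) (t₁ 4F) (t₂ 4F) (t₃ 4F) (t₄ 4F) n
      (I X Y) (S X Y) (C X Y) (C X (σ Y))

-- Passage to rational matrices

fromℤ : ℤ → ℚ
fromℤ i = i ℚ./ 1

private
  toℚᵘ-fromℤ : ∀ i → ℚ.toℚᵘ (fromℤ i) ℚᵘ.≃ ℚᵘ.mkℚᵘ i 0
  toℚᵘ-fromℤ i = ℚ.toℚᵘ-fromℚᵘ (ℚᵘ.mkℚᵘ i 0)

-- Division by 1 still normalises through a gcd that does not reduce on variables; among
-- unnormalised rationals the identity is plain integer arithmetic.
fromℤ-+ : ∀ i j → fromℤ (i + j) ≡ fromℤ i ℚ.+ fromℤ j
fromℤ-+ i j = ℚ.toℚᵘ-injective (begin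
  ℚ.toℚᵘ (fromℤ (i + j))                          ≈⟨ toℚᵘ-fromℤ (i + j) ⟩
  ℚᵘ.mkℚᵘ (i + j) 0                               ≈⟨ ℚᵘ.*≡* (ring₁ i j) ⟩
  ℚᵘ.mkℚᵘ i 0 ℚᵘ.+ ℚᵘ.mkℚᵘ j 0                    ≈⟨ ℚᵘ.+-cong (ℚᵘ.≃-sym (toℚᵘ-fromℤ i)) (ℚᵘ.≃-sym (toℚᵘ-fromℤ j)) ⟩
  ℚ.toℚᵘ (fromℤ i) ℚᵘ.+ ℚ.toℚᵘ (fromℤ j)          ≈⟨ ℚᵘ.≃-sym (ℚ.toℚᵘ-homo-+ (fromℤ i) (fromℤ j)) ⟩
  ℚ.toℚᵘ (fromℤ i ℚ.+ fromℤ j) ∎)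
  where
  open import Relation.Binary.Reasoning.Setoid ℚᵘ.≃-setoid
  ring₁ : ∀ i j → (i + j) * 1ℤ ≡ (i * 1ℤ + j * 1ℤ) * 1ℤ
  ring₁ = solve-∀

fromℤ-* : ∀ i j → fromℤ (i * j) ≡ fromℤ i ℚ.* fromℤ j
fromℤ-* i j = ℚ.toℚᵘ-injective (begin
  ℚ.toℚᵘ (fromℤ (i * j))                          ≈⟨ toℚᵘ-fromℤ (i * j) ⟩
  ℚᵘ.mkℚᵘ (i * j) 0                               ≈⟨ ℚᵘ.*≡* refl ⟩
  ℚᵘ.mkℚᵘ i 0 ℚᵘ.* ℚᵘ.mkℚᵘ j 0                    ≈⟨ ℚᵘ.*-cong (ℚᵘ.≃-sym (toℚᵘ-fromℤ i)) (ℚᵘ.≃-sym (toℚᵘ-fromℤ j)) ⟩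
  ℚ.toℚᵘ (fromℤ i) ℚᵘ.* ℚ.toℚᵘ (fromℤ j)          ≈⟨ ℚᵘ.≃-sym (ℚ.toℚᵘ-homo-* (fromℤ i) (fromℤ j)) ⟩
  ℚ.toℚᵘ (fromℤ i ℚ.* fromℤ j) ∎)
  where
  open import Relation.Binary.Reasoning.Setoid ℚᵘ.≃-setoid

fromℤ-injective : ∀ {i j} → fromℤ i ≡ fromℤ j → i ≡ j
fromℤ-injective {i} {j} eq with ℚ.fromℚᵘ-injective {ℚᵘ.mkℚᵘ i 0} {ℚᵘ.mkℚᵘ j 0} eq
... | ℚᵘ.*≡* eq′ = trans (sym (ℤ.*-identityʳ i)) (trans eq′ (ℤ.*-identityʳ j))

fromℤ-ι : ∀ b → (if b then 1ℚ else 0ℚ) ≡ fromℤ (ι b)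
fromℤ-ι true  = refl
fromℤ-ι false = refl

module ReflectionScheme {A : Set} {Ω : List A} {R : Fin 5 → A → A → Bool} {r s : ℕ}
  (𝒢 : ReflectionGeometry Ω R (pos (2 ℕ.+ s)) (pos (3 ℕ.+ r))) where

  open ReflectionAlgebra 𝒢
  open Scheme Ω hiding (adjacency)

  -- The coordinates of the five adjacency matrices add up to J. Existence and uniqueness of the
  -- relation between two points both follow.
  indicator-sum : ∀ {X Y} → X ∈ Ω → Y ∈ Ω → ∑ (allFin 5) (λ l → ι (R l X Y)) ≡ 1ℤ
  indicator-sum {X} {Y} X∈ Y∈ = trans (∑-cong (allFin 5) (indicator X∈ Y∈))
    (ring₁ (I X Y) (S X Y) (C X Y) (C X (σ Y)))
    where
    ring₁ : ∀ i s c d →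
      (1ℤ * i + (0ℤ * s + (0ℤ * c + (0ℤ * d + 0ℤ * 1ℤ))))
      + ((0ℤ * i + (ℤ.-1ℤ * s + (0ℤ * c + (1ℤ * d + 0ℤ * 1ℤ))))
      + ((0ℤ * i + (0ℤ * s + (ℤ.-1ℤ * c + (ℤ.-1ℤ * d + 1ℤ * 1ℤ))))
      + ((ℤ.-1ℤ * i + (0ℤ * s + (1ℤ * c + (0ℤ * d + 0ℤ * 1ℤ))))
      + ((0ℤ * i + (1ℤ * s + (0ℤ * c + (0ℤ * d + 0ℤ * 1ℤ)))) + 0ℤ)))) ≡ 1ℤ
    ring₁ = solve-∀

  covers : ∀ X Y → X ∈ Ω → Y ∈ Ω → ∃[ l ] (R l X Y ≡ true)
  covers X Y X∈ Y∈ with Fin.any? (λ l → R l X Y Bool.≟ true)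
  ... | yes hit = hit
  ... | no miss = ⊥-elim (0≢1 (trans (sym none) (indicator-sum X∈ Y∈)))
    where
    0≢1 : 0ℤ ≢ 1ℤ
    0≢1 ()
    at : ∀ l → ι (R l X Y) ≡ 0ℤ
    at l with R l X Y in eq
    ... | true  = ⊥-elim (miss (l , eq))
    ... | false = refl
    none : ∑ (allFin 5) (λ l → ι (R l X Y)) ≡ 0ℤ
    none = trans (∑-cong (allFin 5) at) (∑-zero (allFin 5))

  -- Once relation k holds, the differences of the two sides are nonnegative and have total 1 - 1.
  indicator-δ : ∀ {X Y} → X ∈ Ω → Y ∈ Ω → ∀ {k} → R k X Y ≡ true → ∀ l → ι (R l X Y) ≡ ι ⌊ l Fin.≟ k ⌋
  indicator-δ {X} {Y} X∈ Y∈ {k} hit l = ℤ.i-j≡0⇒i≡j _ _ (∑≡0⇒≡0 (allFin 5) nonneg total≡0 (∈-allFin l))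
    where
    f : Fin 5 → ℤ
    f l = ι (R l X Y) - ι ⌊ l Fin.≟ k ⌋
    ι-nonneg : ∀ b → 0ℤ ℤ.≤ ι b
    ι-nonneg true  = ℤ.+≤+ ℕ.z≤n
    ι-nonneg false = ℤ.≤-refl
    nonneg : ∀ l → 0ℤ ℤ.≤ f l
    nonneg l with l Fin.≟ k
    ... | yes refl = subst (λ b → 0ℤ ℤ.≤ ι b - 1ℤ) (sym hit) ℤ.≤-refl
    ... | no _     = subst (0ℤ ℤ.≤_) (sym (ℤ.+-identityʳ (ι (R l X Y)))) (ι-nonneg (R l X Y))
    total≡0 : ∑ (allFin 5) f ≡ 0ℤ
    total≡0 = trans (∑-+ (allFin 5) (λ l → ι (R l X Y)) (λ l → - ι ⌊ l Fin.≟ k ⌋)) (cong₂ _+_ (indicator-sum X∈ Y∈)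
      (trans (∑-cong (allFin 5) (λ l → sym (ℤ.-1*i≡-i (ι ⌊ l Fin.≟ k ⌋)))) (trans (∑-*ˡ (allFin 5) ℤ.-1ℤ (λ l → ι ⌊ l Fin.≟ k ⌋)) (cong (ℤ.-1ℤ *_) (allFin-once 5 k)))))

  disjoint : ∀ X Y → X ∈ Ω → Y ∈ Ω → ∀ k l → R k X Y ≡ true → R l X Y ≡ true → k ≡ l
  disjoint X Y X∈ Y∈ k l k-hit l-hit = agree (k Fin.≟ l) (trans (cong ι (sym k-hit)) (indicator-δ X∈ Y∈ l-hit k))
    where
    agree : (d : Dec (k ≡ l)) → 1ℤ ≡ ι ⌊ d ⌋ → k ≡ l
    agree (yes eq) _ = eq
    agree (no _)   ()

  eval-0 : ∀ X Y → eval (adjacency 0F) X Y ≡ I X Y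
  eval-0 X Y = ring₁ (I X Y) (S X Y) (C X Y) (C X (σ Y))
    where
    ring₁ : ∀ i s c d → 1ℤ * i + (0ℤ * s + (0ℤ * c + (0ℤ * d + 0ℤ * 1ℤ))) ≡ i
    ring₁ = solve-∀

  R₀-diagonal : ∀ X Y → X ∈ Ω → Y ∈ Ω → (R 0F X Y ≡ true → X ≡ Y) × (X ≡ Y → R 0F X Y ≡ true)
  R₀-diagonal X Y X∈ Y∈ = to (X ≟ᵖ Y) eq , from (X ≟ᵖ Y) eq
    where
    eq : ι (R 0F X Y) ≡ I X Y
    eq = trans (indicator X∈ Y∈ 0F) (eval-0 X Y)
    to : (d : Dec (X ≡ Y)) → ι (R 0F X Y) ≡ ι ⌊ d ⌋ → R 0F X Y ≡ true → X ≡ Y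
    to (yes X≡Y) _ _ = X≡Y
    to (no _) eq hit with trans (cong ι (sym hit)) eq
    ... | ()
    from : (d : Dec (X ≡ Y)) → ι (R 0F X Y) ≡ ι ⌊ d ⌋ → X ≡ Y → R 0F X Y ≡ true
    from (yes _) eq _ = ι-injective eq
    from (no ne) _ X≡Y = ⊥-elim (ne X≡Y)

  eval-sym : ∀ t {X Y} → X ∈ Ω → Y ∈ Ω → eval t X Y ≡ eval t Y X
  eval-sym t X∈ Y∈ = cong₅ t (I-sym _ _) (S-sym X∈ Y∈) (C-sym X∈ Y∈) (D-sym X∈ Y∈) refl

  symmetric : ∀ X Y → X ∈ Ω → Y ∈ Ω → ∀ l → R l X Y ≡ R l Y X
  symmetric X Y X∈ Y∈ l = ι-injective (trans (indicator X∈ Y∈ l) (trans (eval-sym (adjacency l) X∈ Y∈) (sym (indicator Y∈ X∈ l))))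

  sumℤ : ∀ {m} → (Fin m → ℤ) → ℤ
  sumℤ {zero}  f = 0ℤ
  sumℤ {suc m} f = f zero + sumℤ (λ i → f (suc i))

  sumℤ-cong : ∀ {m} {f g : Fin m → ℤ} → (∀ i → f i ≡ g i) → sumℤ f ≡ sumℤ g
  sumℤ-cong {zero}  eq = refl
  sumℤ-cong {suc m} eq = cong₂ _+_ (eq zero) (sumℤ-cong (λ i → eq (suc i)))

  -- The constant value of `eval t` on each relation: C is 1 on R₀ and R₃, D is 1 on R₁ and R₄, and
  -- J is 1 everywhere.
  relation-coordinates : Coefficients → Fin 5 → ℤ
  relation-coordinates t = coefficients (t 0F + t 2F + t 4F) (t 3F + t 4F) (t 4F) (t 2F + t 4F) (t 1F + t 3F + t 4F)

  eval-relations : ∀ t {X Y} → X ∈ Ω → Y ∈ Ω → eval t X Y ≡ sumℤ (λ l → relation-coordinates t l * ι (R l X Y))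
  eval-relations t {X} {Y} X∈ Y∈ = trans
    (ring₁ (t 0F) (t 1F) (t 2F) (t 3F) (t 4F) (I X Y) (S X Y) (C X Y) (C X (σ Y)))
    (sumℤ-cong {5} (λ l → cong (relation-coordinates t l *_) (sym (indicator X∈ Y∈ l))))
    where
    ring₁ : ∀ t₀ t₁ t₂ t₃ t₄ i s c d → t₀ * i + (t₁ * s + (t₂ * c + (t₃ * d + t₄ * 1ℤ))) ≡
      (t₀ + t₂ + t₄) * (1ℤ * i + (0ℤ * s + (0ℤ * c + (0ℤ * d + 0ℤ * 1ℤ))))
      + ((t₃ + t₄) * (0ℤ * i + (ℤ.-1ℤ * s + (0ℤ * c + (1ℤ * d + 0ℤ * 1ℤ))))
      + (t₄ * (0ℤ * i + (0ℤ * s + (ℤ.-1ℤ * c + (ℤ.-1ℤ * d + 1ℤ * 1ℤ))))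
      + ((t₂ + t₄) * (ℤ.-1ℤ * i + (0ℤ * s + (1ℤ * c + (0ℤ * d + 0ℤ * 1ℤ))))
      + ((t₁ + t₃ + t₄) * (0ℤ * i + (1ℤ * s + (0ℤ * c + (0ℤ * d + 0ℤ * 1ℤ)))) + 0ℤ))))
    ring₁ = solve-∀

  -- The count is an entry of a product of adjacency matrices, which lies in the algebra and so is
  -- constant on relation k. The absolute value only brings the integer back to ℕ.
  intersection : ∀ i j k → ∃[ p ] (∀ X Y → X ∈ Ω → Y ∈ Ω → R k X Y ≡ true → count (λ Z → R i X Z ∧ R j Z Y) ≡ p)
  intersection i j k = ℤ.∣ value ∣ , λ X Y X∈ Y∈ hit → cong ℤ.∣_∣ (begin
    pos (count (λ Z → R i X Z ∧ R j Z Y))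
      ≡⟨ length-filter (λ Z → R i X Z ∧ R j Z Y) Ω ⟩
    ∑ Ω (λ Z → ι (R i X Z ∧ R j Z Y))
      ≡⟨ ∑-cong∈ Ω (λ Z Z∈ → trans (ι-∧ (R i X Z) (R j Z Y)) (cong₂ _*_ (indicator X∈ Z∈ i) (indicator Z∈ Y∈ j))) ⟩
    ∑ Ω (λ Z → eval (adjacency i) X Z * eval (adjacency j) Z Y)
      ≡⟨ eval-product (adjacency i) (adjacency j) X∈ Y∈ ⟩
    eval t X Y
      ≡⟨ eval-relations t X∈ Y∈ ⟩
    sumℤ (λ l → relation-coordinates t l * ι (R l X Y))
      ≡⟨ sumℤ-cong {5} (λ l → cong (relation-coordinates t l *_) (indicator-δ X∈ Y∈ hit l)) ⟩
    value ∎)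
    where
    open ≡-Reasoning
    t : Coefficients
    t = adjacency i ⊛ adjacency j
    value : ℤ
    value = sumℤ (λ l → relation-coordinates t l * ι ⌊ l Fin.≟ k ⌋)

  isAssociationScheme : IsAssociationScheme 4 R
  isAssociationScheme = record
    { covers = covers ; disjoint = disjoint ; R₀-diag = R₀-diagonal ; symmetric = symmetric ; intersection = intersection }

  denominator≢0 : denominator ≢ 0ℤ
  denominator≢0 = *-nonzero {_} {a * q + - 1ℤ} (*-nonzero {_} {q + 1ℤ} (*-nonzero {_} {q + - 1ℤ}
    (*-nonzero {_} {q} (*-nonzero {pos 2} {a} (λ ()) (λ ())) (λ ())) (λ ())) (λ ())) (λ ())

  instance
    denominator-nonZero : ℚ.NonZero (fromℤ denominator)
    denominator-nonZero = ℚ.≢-nonZero (λ eq → denominator≢0 (fromℤ-injective eq))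

  ρ : ℚ
  ρ = ℚ.1/ fromℤ denominator

  ρ-cancel : ∀ i → ρ ℚ.* fromℤ (denominator * i) ≡ fromℤ i
  ρ-cancel i = begin
    ρ ℚ.* fromℤ (denominator * i) ≡⟨ cong (ρ ℚ.*_) (fromℤ-* denominator i) ⟩
    ρ ℚ.* (fromℤ denominator ℚ.* fromℤ i) ≡⟨ sym (ℚ.*-assoc ρ (fromℤ denominator) (fromℤ i)) ⟩
    ρ ℚ.* fromℤ denominator ℚ.* fromℤ i ≡⟨ cong (ℚ._* fromℤ i) (ℚ.*-inverseˡ (fromℤ denominator)) ⟩
    1ℚ ℚ.* fromℤ i ≡⟨ ℚ.*-identityˡ (fromℤ i) ⟩
    fromℤ i ∎
    where open ≡-Reasoning

  E : Fin 5 → Mat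
  E k X Y = ρ ℚ.* fromℤ (eval (idempotent k) X Y)

  ℚ-swap : ∀ x y z → x ℚ.* (y ℚ.* z) ≡ y ℚ.* (x ℚ.* z)
  ℚ-swap x y z = trans (sym (ℚ.*-assoc x y z)) (trans (cong (ℚ._* z) (ℚ.*-comm x y)) (ℚ.*-assoc y x z))

  sumFin-fromℤ : ∀ {m} (c : Fin m → ℚ) (f g : Fin m → ℤ) (M : Fin m → ℚ) →
    (∀ i → c i ℚ.* M i ≡ ρ ℚ.* fromℤ (f i * g i)) → sumFin (λ i → c i ℚ.* M i) ≡ ρ ℚ.* fromℤ (sumℤ (λ i → f i * g i))
  sumFin-fromℤ {zero}  c f g M eq = sym (ℚ.*-zeroʳ ρ)
  sumFin-fromℤ {suc m} c f g M eq = trans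
    (cong₂ ℚ._+_ (eq zero) (sumFin-fromℤ (λ i → c (suc i)) (λ i → f (suc i)) (λ i → g (suc i)) (λ i → M (suc i)) (λ i → eq (suc i))))
    (trans (sym (ℚ.*-distribˡ-+ ρ _ _)) (cong (ρ ℚ.*_) (sym (fromℤ-+ (f zero * g zero) _))))

  sumΩ-fromℤ : ∀ (f : A → ℚ) (g : A → ℤ) x → (∀ Z → f Z ≡ x ℚ.* fromℤ (g Z)) → sumΩ f ≡ x ℚ.* fromℤ (∑ Ω g)
  sumΩ-fromℤ f g x eq = go Ω
    where
    go : ∀ zs → foldr (λ z acc → f z ℚ.+ acc) 0ℚ zs ≡ x ℚ.* fromℤ (∑ zs g)
    go []       = sym (ℚ.*-zeroʳ x)
    go (Z ∷ zs) = trans (cong₂ ℚ._+_ (eq Z) (go zs))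
      (trans (sym (ℚ.*-distribˡ-+ x _ _)) (cong (x ℚ.*_) (sym (fromℤ-+ (g Z) (∑ zs g)))))

  E-in-algebra : ∀ k → ∃[ c ] (E k ≈ lincomb c (λ l → Scheme.adjacency Ω (R l)))
  E-in-algebra k = (λ l → ρ ℚ.* fromℤ (w l)) , λ X Y X∈ Y∈ → sym (trans
    (sumFin-fromℤ (λ l → ρ ℚ.* fromℤ (w l)) w (λ l → ι (R l X Y)) _
      (λ l → trans (cong (ρ ℚ.* fromℤ (w l) ℚ.*_) (fromℤ-ι (R l X Y)))
        (trans (ℚ.*-assoc ρ (fromℤ (w l)) _) (cong (ρ ℚ.*_) (sym (fromℤ-* (w l) _))))))
    (cong (λ i → ρ ℚ.* fromℤ i) (sym (eval-relations (idempotent k) X∈ Y∈))))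
    where
    w : Fin 5 → ℤ
    w = relation-coordinates (idempotent k)

  eval-diagonal : ∀ t → eval t base base ≡ t 0F + t 2F + t 4F
  eval-diagonal t = trans (cong₅ t (ι-yes (base ≟ᵖ base) refl)
      (ι-no (base ≟ᵖ σ base) (X≢σX base∈Ω)) (C-diag base∈Ω) (C-opp base∈Ω) refl)
    (ring₁ (t 0F) (t 1F) (t 2F) (t 3F) (t 4F))
    where
    ring₁ : ∀ t₀ t₁ t₂ t₃ t₄ → t₀ * 1ℤ + (t₁ * 0ℤ + (t₂ * 1ℤ + (t₃ * 0ℤ + t₄ * 1ℤ))) ≡ t₀ + t₂ + t₄
    ring₁ = solve-∀

  -- The diagonal entry of the scaled idempotent, a positive multiple of its multiplicity. The
  -- factor q - 2 occurs at `2F` and a - 1 at `1F` and `4F`; here q > 2 and n ≥ 3 matter.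
  trace≢0 : ∀ k → idempotent k 0F + idempotent k 2F + idempotent k 4F ≢ 0ℤ
  trace≢0 0F eq = *-nonzero {pos 2 * (q - 1ℤ)} {q + 1ℤ} (*-nonzero {pos 2} {q - 1ℤ} (λ ()) (λ ())) (λ ()) (trans (ring₁ q) eq)
    where
    ring₁ : ∀ q → pos 2 * (q - 1ℤ) * (q + 1ℤ) ≡ pos 2 * (q + - 1ℤ) * (q + 1ℤ) * 0ℤ + pos 2 * (q + - 1ℤ) * (q + 1ℤ) * 0ℤ + pos 2 * (q + - 1ℤ) * (q + 1ℤ) * 1ℤ
    ring₁ = solve-∀
  trace≢0 1F eq = *-nonzero {q * (q - 1ℤ) * (a * q - 1ℤ)} {a - 1ℤ}
      (*-nonzero {q * (q - 1ℤ)} {a * q - 1ℤ} (*-nonzero {q} {q - 1ℤ} (λ ()) (λ ())) (λ ())) (λ ()) (trans (ring₁ a q) eq)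
    where
    ring₁ : ∀ a q → q * (q - 1ℤ) * (a * q - 1ℤ) * (a - 1ℤ) ≡
      q * (q + - 1ℤ) * (a * q + - 1ℤ) * a + q * (q + - 1ℤ) * (a * q + - 1ℤ) * (- 1ℤ) + q * (q + - 1ℤ) * (a * q + - 1ℤ) * 0ℤ
    ring₁ = solve-∀
  trace≢0 2F eq = *-nonzero {(q + 1ℤ) * (a * q - 1ℤ)} {(q - pos 2) * (a * q + 1ℤ)}
      (*-nonzero {q + 1ℤ} {a * q - 1ℤ} (λ ()) (λ ())) (*-nonzero {q - pos 2} {a * q + 1ℤ} (λ ()) (λ ())) (trans (ring₁ a q) eq)
    where
    ring₁ : ∀ a q → (q + 1ℤ) * (a * q - 1ℤ) * ((q - pos 2) * (a * q + 1ℤ)) ≡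
      (q + 1ℤ) * (a * q + - 1ℤ) * (a * q * (q + - pos 2)) + (q + 1ℤ) * (a * q + - 1ℤ) * q + (q + 1ℤ) * (a * q + - 1ℤ) * (- pos 2)
    ring₁ = solve-∀
  trace≢0 3F eq = *-nonzero {q * (q - 1ℤ) * (a * q - 1ℤ)} {a * q + 1ℤ}
      (*-nonzero {q * (q - 1ℤ)} {a * q - 1ℤ} (*-nonzero {q} {q - 1ℤ} (λ ()) (λ ())) (λ ())) (λ ()) (trans (ring₁ a q) eq)
    where
    ring₁ : ∀ a q → q * (q - 1ℤ) * (a * q - 1ℤ) * (a * q + 1ℤ) ≡
      q * (q + - 1ℤ) * (a * q + - 1ℤ) * (a * q) + q * (q + - 1ℤ) * (a * q + - 1ℤ) * 1ℤ + q * (q + - 1ℤ) * (a * q + - 1ℤ) * 0ℤ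
    ring₁ = solve-∀
  trace≢0 4F eq = *-nonzero {q * (q + 1ℤ)} {(a - 1ℤ) * (a * q + 1ℤ)}
      (*-nonzero {q} {q + 1ℤ} (λ ()) (λ ())) (*-nonzero {a - 1ℤ} {a * q + 1ℤ} (λ ()) (λ ())) (trans (ring₁ a q) eq)
    where
    ring₁ : ∀ a q → q * (q + 1ℤ) * ((a - 1ℤ) * (a * q + 1ℤ)) ≡
      q * (q + 1ℤ) * (a * (a * q + - 1ℤ)) + q * (q + 1ℤ) * (- (a * q + - 1ℤ)) + q * (q + 1ℤ) * (pos 2 * (a + - 1ℤ))
    ring₁ = solve-∀

  E-nonzero : ∀ k → ∃[ X ] ∃[ Y ] (X ∈ Ω × Y ∈ Ω × E k X Y ≢ 0ℚ)
  E-nonzero k = base , base , base∈Ω , base∈Ω , λ eq → trace≢0 k (begin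
    idempotent k 0F + idempotent k 2F + idempotent k 4F ≡⟨ sym (eval-diagonal (idempotent k)) ⟩
    e ≡⟨ fromℤ-injective (begin
        fromℤ e ≡⟨ sym (ρ-cancel e) ⟩
        ρ ℚ.* fromℤ (denominator * e) ≡⟨ cong (ρ ℚ.*_) (fromℤ-* denominator e) ⟩
        ρ ℚ.* (fromℤ denominator ℚ.* fromℤ e) ≡⟨ ℚ-swap ρ (fromℤ denominator) (fromℤ e) ⟩
        fromℤ denominator ℚ.* (ρ ℚ.* fromℤ e) ≡⟨ cong (fromℤ denominator ℚ.*_) eq ⟩
        fromℤ denominator ℚ.* 0ℚ ≡⟨ ℚ.*-zeroʳ (fromℤ denominator) ⟩
        fromℤ 0ℤ ∎) ⟩
    0ℤ ∎)
    where
    open ≡-Reasoning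
    e : ℤ
    e = eval (idempotent k) base base

  eval-cong : ∀ {t u : Coefficients} → (∀ l → t l ≡ u l) → ∀ X Y → eval t X Y ≡ eval u X Y
  eval-cong eq X Y rewrite eq 0F | eq 1F | eq 2F | eq 3F | eq 4F = refl

  eval-scale : ∀ x t X Y → eval (λ l → x * t l) X Y ≡ x * eval t X Y
  eval-scale x t X Y = ring₁ x (t 0F) (t 1F) (t 2F) (t 3F) (t 4F) (I X Y) (S X Y) (C X Y) (C X (σ Y))
    where
    ring₁ : ∀ x t₀ t₁ t₂ t₃ t₄ i s c d →
      x * t₀ * i + (x * t₁ * s + (x * t₂ * c + (x * t₃ * d + x * t₄ * 1ℤ))) ≡ x * (t₀ * i + (t₁ * s + (t₂ * c + (t₃ * d + t₄ * 1ℤ))))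
    ring₁ = solve-∀

  E-orthogonal : ∀ k l → (E k · E l) ≈ (if δ k l then E k else zeroM)
  E-orthogonal k l X Y X∈ Y∈ = trans product (cases (k Fin.≟ l) (character-idempotent k l))
    where
    open ≡-Reasoning
    e : ℤ
    e = eval (idempotent k) X Y
    product : (E k · E l) X Y ≡ ρ ℚ.* (ρ ℚ.* fromℤ (character k (idempotent l) * e))
    product = begin
      sumΩ (λ Z → E k X Z ℚ.* E l Z Y)
        ≡⟨ sumΩ-fromℤ _ (λ Z → eval (idempotent k) X Z * eval (idempotent l) Z Y) (ρ ℚ.* ρ) (λ Z → begin
             E k X Z ℚ.* E l Z Y ≡⟨ ℚ.*-assoc ρ _ _ ⟩
             ρ ℚ.* (fromℤ (f Z) ℚ.* (ρ ℚ.* fromℤ (g Z))) ≡⟨ cong (ρ ℚ.*_) (ℚ-swap (fromℤ (f Z)) ρ (fromℤ (g Z))) ⟩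
             ρ ℚ.* (ρ ℚ.* (fromℤ (f Z) ℚ.* fromℤ (g Z))) ≡⟨ sym (ℚ.*-assoc ρ ρ _) ⟩
             ρ ℚ.* ρ ℚ.* (fromℤ (f Z) ℚ.* fromℤ (g Z)) ≡⟨ cong (ρ ℚ.* ρ ℚ.*_) (sym (fromℤ-* (f Z) (g Z))) ⟩
             ρ ℚ.* ρ ℚ.* fromℤ (f Z * g Z) ∎) ⟩
      ρ ℚ.* ρ ℚ.* fromℤ (∑ Ω (λ Z → f Z * g Z))
        ≡⟨ cong (λ i → ρ ℚ.* ρ ℚ.* fromℤ i) (trans (eval-product (idempotent k) (idempotent l) X∈ Y∈)
             (trans (eval-cong (λ m → idempotent-⊛ k m (idempotent l)) X Y) (eval-scale (character k (idempotent l)) (idempotent k) X Y))) ⟩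
      ρ ℚ.* ρ ℚ.* fromℤ (character k (idempotent l) * e)
        ≡⟨ ℚ.*-assoc ρ ρ _ ⟩
      ρ ℚ.* (ρ ℚ.* fromℤ (character k (idempotent l) * e)) ∎
      where
      f g : A → ℤ
      f Z = eval (idempotent k) X Z
      g Z = eval (idempotent l) Z Y
    cases : (d : Dec (k ≡ l)) → character k (idempotent l) ≡ (if ⌊ d ⌋ then denominator else 0ℤ) →
            ρ ℚ.* (ρ ℚ.* fromℤ (character k (idempotent l) * e)) ≡ (if ⌊ d ⌋ then E k else zeroM) X Y
    cases (yes _) eq = trans (cong (λ i → ρ ℚ.* (ρ ℚ.* fromℤ (i * e))) eq) (cong (ρ ℚ.*_) (ρ-cancel e))
    cases (no _)  eq = trans (cong (λ i → ρ ℚ.* (ρ ℚ.* fromℤ (i * e))) eq) (trans (cong (ρ ℚ.*_) (ℚ.*-zeroʳ ρ)) (ℚ.*-zeroʳ ρ))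

  expand : ∀ u X Y → sumℤ (λ k → character k u * eval (idempotent k) X Y) ≡ denominator * eval u X Y
  expand u X Y = trans (trans
    (ring₁ (character 0F u) (character 1F u) (character 2F u) (character 3F u) (character 4F u) (idempotent 0F) (idempotent 1F) (idempotent 2F) (idempotent 3F) (idempotent 4F))
    (eval-cong (expansion-correct u) X Y)) (eval-scale denominator u X Y)
    where
    ring₁ : ∀ x₀ x₁ x₂ x₃ x₄ (t₀ t₁ t₂ t₃ t₄ : Coefficients) →
      x₀ * eval t₀ X Y + (x₁ * eval t₁ X Y + (x₂ * eval t₂ X Y + (x₃ * eval t₃ X Y + (x₄ * eval t₄ X Y + 0ℤ)))) ≡
      eval (λ l → x₀ * t₀ l + (x₁ * t₁ l + (x₂ * t₂ l + (x₃ * t₃ l + (x₄ * t₄ l + 0ℤ))))) X Y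
    ring₁ x₀ x₁ x₂ x₃ x₄ t₀ t₁ t₂ t₃ t₄ = ring₂ x₀ x₁ x₂ x₃ x₄
      (t₀ 0F) (t₀ 1F) (t₀ 2F) (t₀ 3F) (t₀ 4F) (t₁ 0F) (t₁ 1F) (t₁ 2F) (t₁ 3F) (t₁ 4F) (t₂ 0F) (t₂ 1F) (t₂ 2F) (t₂ 3F) (t₂ 4F)
      (t₃ 0F) (t₃ 1F) (t₃ 2F) (t₃ 3F) (t₃ 4F) (t₄ 0F) (t₄ 1F) (t₄ 2F) (t₄ 3F) (t₄ 4F)
      (I X Y) (S X Y) (C X Y) (C X (σ Y))
      where
      ring₂ : ∀ x₀ x₁ x₂ x₃ x₄ a₀ a₁ a₂ a₃ a₄ b₀ b₁ b₂ b₃ b₄ c₀ c₁ c₂ c₃ c₄ d₀ d₁ d₂ d₃ d₄ e₀ e₁ e₂ e₃ e₄ i s c d →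
        x₀ * (a₀ * i + (a₁ * s + (a₂ * c + (a₃ * d + a₄ * 1ℤ)))) + (x₁ * (b₀ * i + (b₁ * s + (b₂ * c + (b₃ * d + b₄ * 1ℤ))))
        + (x₂ * (c₀ * i + (c₁ * s + (c₂ * c + (c₃ * d + c₄ * 1ℤ)))) + (x₃ * (d₀ * i + (d₁ * s + (d₂ * c + (d₃ * d + d₄ * 1ℤ))))
        + (x₄ * (e₀ * i + (e₁ * s + (e₂ * c + (e₃ * d + e₄ * 1ℤ)))) + 0ℤ)))) ≡
        (x₀ * a₀ + (x₁ * b₀ + (x₂ * c₀ + (x₃ * d₀ + (x₄ * e₀ + 0ℤ))))) * i + ((x₀ * a₁ + (x₁ * b₁ + (x₂ * c₁ + (x₃ * d₁ + (x₄ * e₁ + 0ℤ))))) * s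
        + ((x₀ * a₂ + (x₁ * b₂ + (x₂ * c₂ + (x₃ * d₂ + (x₄ * e₂ + 0ℤ))))) * c + ((x₀ * a₃ + (x₁ * b₃ + (x₂ * c₃ + (x₃ * d₃ + (x₄ * e₃ + 0ℤ))))) * d
        + (x₀ * a₄ + (x₁ * b₄ + (x₂ * c₄ + (x₃ * d₄ + (x₄ * e₄ + 0ℤ))))) * 1ℤ)))
      ring₂ = solve-∀

  -- One statement for two fields of the record: u = I, with all characters 1, gives `E-sum`, and u
  -- = A_l gives the eigenvalues.
  spectral : ∀ (P : Fin 5 → ℚ) u → (∀ k → P k ≡ fromℤ (character k u)) → ∀ X Y → lincomb P E X Y ≡ fromℤ (eval u X Y)
  spectral P u eq X Y = trans
    (sumFin-fromℤ P (λ k → character k u) (λ k → eval (idempotent k) X Y) (λ k → E k X Y)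
      (λ k → trans (cong (ℚ._* E k X Y) (eq k)) (trans (ℚ-swap (fromℤ (character k u)) ρ _) (cong (ρ ℚ.*_) (sym (fromℤ-* (character k u) _))))))
    (trans (cong (λ i → ρ ℚ.* fromℤ i) (expand u X Y)) (ρ-cancel (eval u X Y)))

  E-sum : lincomb (λ _ → 1ℚ) E ≈ idM (R 0F)
  E-sum X Y X∈ Y∈ = trans (spectral (λ _ → 1ℚ) (adjacency 0F) (λ k → cong fromℤ (sym (ring₁ (sign k) (root k) (weight k)))) X Y)
    (trans (cong fromℤ (sym (indicator X∈ Y∈ 0F))) (sym (fromℤ-ι (R 0F X Y))))
    where
    ring₁ : ∀ e r w → (1ℤ + e * 0ℤ) + (0ℤ + e * 0ℤ) * r + 0ℤ * w ≡ 1ℤ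
    ring₁ = solve-∀

  E₀-uniform : ∀ X Y → X ∈ Ω → Y ∈ Ω → E 0F X Y ℚ.* (pos (length Ω) ℚ./ 1) ≡ 1ℚ
  E₀-uniform X Y X∈ Y∈ = begin
    E 0F X Y ℚ.* fromℤ (pos (length Ω))
      ≡⟨ ℚ.*-assoc ρ _ _ ⟩
    ρ ℚ.* (fromℤ (eval (idempotent 0F) X Y) ℚ.* fromℤ (pos (length Ω)))
      ≡⟨ cong (ρ ℚ.*_) (sym (fromℤ-* (eval (idempotent 0F) X Y) (pos (length Ω)))) ⟩
    ρ ℚ.* fromℤ (eval (idempotent 0F) X Y * pos (length Ω))
      ≡⟨ cong (λ i → ρ ℚ.* fromℤ (eval (idempotent 0F) X Y * i)) length≡ ⟩
    ρ ℚ.* fromℤ (eval (idempotent 0F) X Y * order)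
      ≡⟨ cong (λ i → ρ ℚ.* fromℤ i) (ring₁ a q (I X Y) (S X Y) (C X Y) (C X (σ Y))) ⟩
    ρ ℚ.* fromℤ (denominator * 1ℤ)
      ≡⟨ ρ-cancel 1ℤ ⟩
    1ℚ ∎
    where
    open ≡-Reasoning
    length≡ : pos (length Ω) ≡ order
    length≡ = trans (sym (ℤ.*-identityʳ (pos (length Ω)))) (trans (sym (∑-const Ω 1ℤ)) Ω-size)
    ring₁ : ∀ a q i s c d →
      (pos 2 * (q + - 1ℤ) * (q + 1ℤ) * 0ℤ * i + (pos 2 * (q + - 1ℤ) * (q + 1ℤ) * 0ℤ * s + (pos 2 * (q + - 1ℤ) * (q + 1ℤ) * 0ℤ * c
        + (pos 2 * (q + - 1ℤ) * (q + 1ℤ) * 0ℤ * d + pos 2 * (q + - 1ℤ) * (q + 1ℤ) * 1ℤ * 1ℤ)))) * (a * q * (a * q + - 1ℤ))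
      ≡ pos 2 * a * q * (q + - 1ℤ) * (q + 1ℤ) * (a * q + - 1ℤ) * 1ℤ
    ring₁ = solve-∀

  hasEigenmatrix : ∀ (P : Fin 5 → Fin 5 → ℚ) → (∀ k l → P k l ≡ fromℤ (character k (adjacency l))) →
                   HasEigenmatrix 4 (R 0F) R P E
  hasEigenmatrix P P≡ = record
    { E-in-algebra = E-in-algebra ; E-nonzero = E-nonzero ; E-orthogonal = E-orthogonal ; E-sum = E-sum ; E₀-J/|Ω| = E₀-uniform
    ; eigen = λ l X Y X∈ Y∈ → trans (fromℤ-ι (R l X Y)) (trans (cong fromℤ (indicator X∈ Y∈ l))
        (sym (spectral (λ k → P k l) (adjacency l) (λ k → P≡ k l) X Y))) }

-- The relations of the scheme

-- The source of an explicit point of Ω in `Ω-inhabited`; as a parameter it lets `Relations` keep n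
-- a variable.
record HyperbolicPair {q : ℕ} {F : FiniteField q} (𝒱 : QuadraticSpace F) : Set where
  open QuadraticSpace 𝒱
  open FiniteField F using (0#; 1#)
  field
    e f   : V
    Qe≡0  : Q e ≡ 0#
    Qf≡0  : Q f ≡ 0#
    e·f≡1 : B e f ≡ 1#

module StandardSpace {q : ℕ} (F : FiniteField q) (c d : Fin q) (irreducible : Geometry.Irreducible F c d) (k : ℕ) where

  open Coordinates F c d irreducible
  open FieldSums F
  open Solver using (solve; _:+_; _:*_; _:=_)

  elliptic : IsElliptic (space (2 ℕ.+ k)) (pos (q ^ k))
  elliptic = record
    { vectors-size = trans (number-of-vectors (2 ℕ.+ k)) (trans (cong₂ _*_ q² q²) (ring₁ (pos (q ^ k)) qz))
    ; cone-size    = trans (number-of-singular (suc k))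
        (trans (cong (λ i → i * i * qz - i * qz + i) (ℤ.pos-* q (q ^ k))) (ring₂ (pos (q ^ k)) qz)) }
    where
    q² : pos (q ^ (2 ℕ.+ k)) ≡ qz * (qz * pos (q ^ k))
    q² = trans (ℤ.pos-* q (q ^ suc k)) (cong (qz *_) (ℤ.pos-* q (q ^ k)))
    ring₁ : ∀ a q → q * (q * a) * (q * (q * a)) ≡ a * a * q * q * q * q
    ring₁ = solve-∀
    ring₂ : ∀ a q → q * a * (q * a) * q - q * a * q + q * a ≡ a * a * q * q * q - a * q * q + a * q
    ring₂ = solve-∀

  hyperbolicPair : HyperbolicPair (space (2 ℕ.+ k))
  hyperbolicPair = record
    { e = (1# , 0#) ∷ 0v
    ; f = (0# , 1#) ∷ 0v
    ; Qe≡0 = trans (cong (1# *ᶠ 0# +ᶠ_) (Qf-0v (suc k))) (solve 0 (𝟙 :* 𝟘 :+ 𝟘 := 𝟘) refl)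
    ; Qf≡0 = trans (cong (0# *ᶠ 1# +ᶠ_) (Qf-0v (suc k))) (solve 0 (𝟘 :* 𝟙 :+ 𝟘 := 𝟘) refl)
    ; e·f≡1 = trans (cong ((1# *ᶠ 1# +ᶠ 0# *ᶠ 0#) +ᶠ_) (polar-0v (0v {suc k})))
        (solve 0 ((𝟙 :* 𝟙 :+ 𝟘 :* 𝟘) :+ 𝟘 := 𝟙) refl) }

module Relations {q : ℕ} (F : FiniteField q) (c d : Fin q) (irreducible : Geometry.Irreducible F c d)
  (n : ℕ) (α : ℤ) (elliptic : IsElliptic (Coordinates.space F c d irreducible n) α)
  (pair : HyperbolicPair (Coordinates.space F c d irreducible n))
  (a : Geometry.Vector F c d n) (a≢0 : Geometry.isZero F c d a ≡ false)
  (section : Geometry.Hyperplane.NondegenerateSection F c d a) where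

  open Coordinates F c d irreducible using (space; Bf≡polar; _≟ᵥ_)
  open Points F c d irreducible
  open Geometry F c d using (isPoint; dot; _==v_; _==_; allVectors; Bf; allF; anyF)
  open Geometry.Hyperplane F c d a

  𝒱 : QuadraticSpace F
  𝒱 = space n

  open Counting 𝒱
  open HyperbolicPair pair
  open Solver using (solve; _:+_; _:*_; :-_; _:=_)

  p : V
  p = pole a

  p≢0v : p ≢ 0v
  p≢0v = pole≢0v a a≢0

  B-p : ∀ v → B v p ≡ dot a v
  B-p v = trans (B-sym v p) (polar-pole a v)

  -- A singular p would satisfy B(p, p) = 2 Q(p) = 0 and so lie in Π; being orthogonal to Π it would
  -- be a singular point of the section.
  κ≢0 : Q p ≢ 0#
  κ≢0 Qp with section p (⌊⌋-complete (dot a p ≟ 0#) (trans (sym (B-p p)) (B-self {p} Qp))) (isZero-false p p≢0v) Qp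
  ... | y , y∈Π , Bpy≢0 = Bpy≢0 (trans (Bf≡polar p y) (trans (polar-pole a y) (⌊⌋-sound (dot a y ≟ 0#) y∈Π)))

  open ReflectionCount 𝒱 α elliptic p κ≢0

  B-⊙ʳ : ∀ t u v → B u (t ⊙ v) ≡ t *ᶠ B u v
  B-⊙ʳ t u v = trans (B-sym u _) (trans (B-⊙ t v u) (cong (t *ᶠ_) (B-sym v u)))

  record InΩ (X : V) : Set where
    constructor inΩ-intro
    field
      point  : lead X ≡ 1#
      sing   : Q X ≡ 0#
      affine : B X p ≢ 0#
  open InΩ

  ι-inΩ : ∀ v → ι (inΩ v) ≡ ι (isPoint v) * (z (Q v) * (1ℤ - z (B v p)))
  ι-inΩ v = begin
    ι (inΩ v) ≡⟨ ι-∧ (onQuadric v) (not (inΠ v)) ⟩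
    ι (onQuadric v) * ι (not (inΠ v)) ≡⟨ cong₂ _*_ (ι-∧ (isPoint v) (Q v == 0#)) (trans (ι-not (inΠ v)) (cong (λ x → 1ℤ - z x) (sym (B-p v)))) ⟩
    ι (isPoint v) * z (Q v) * (1ℤ - z (B v p)) ≡⟨ ℤ.*-assoc (ι (isPoint v)) (z (Q v)) (1ℤ - z (B v p)) ⟩
    ι (isPoint v) * (z (Q v) * (1ℤ - z (B v p))) ∎
    where open ≡-Reasoning

  inΩ-sound : ∀ {X} → inΩ X ≡ true → InΩ X
  inΩ-sound {X} eq with ∧-true {onQuadric X} eq
  ... | quad , off with ∧-true {isPoint X} quad
  ...   | pt , sg = inΩ-intro (⌊⌋-sound (lead X ≟ 1#) (trans (sym (isPoint≡lead X)) pt)) (⌊⌋-sound (Q X ≟ 0#) sg)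
                      (λ X⊥p → not-true off (⌊⌋-complete (dot a X ≟ 0#) (trans (sym (B-p X)) X⊥p)))

  onQuadric-complete : ∀ {X} → lead X ≡ 1# → Q X ≡ 0# → onQuadric X ≡ true
  onQuadric-complete {X} pt sg = true-∧ (trans (isPoint≡lead X) (⌊⌋-complete (lead X ≟ 1#) pt)) (⌊⌋-complete (Q X ≟ 0#) sg)

  inΩ-complete : ∀ {X} → InΩ X → inΩ X ≡ true
  inΩ-complete {X} (inΩ-intro pt sg off) = true-∧ (onQuadric-complete {X} pt sg) (true-not (λ eq → off (trans (B-p X) (⌊⌋-sound (dot a X ≟ 0#) eq))))

  ∈Ω⇒ : ∀ {X} → X ∈ Ω → InΩ X
  ∈Ω⇒ X∈ = inΩ-sound (proj₂ (∈-filter⁻ (λ x → inΩ x Bool.≟ true) {xs = allVectors n} X∈))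

  ⇒∈Ω : ∀ {X} → InΩ X → X ∈ Ω
  ⇒∈Ω {X} h = ∈-filter⁺ (λ x → inΩ x Bool.≟ true) (Enumeration.listed enumeration X) (inΩ-complete h)

  -- Points are stored with leading coordinate 1, whereas the counts want B(X, p) = 1. On Ω, `hat`
  -- and `norm` translate between the two representatives.
  hat : V → V
  hat X = inv (B X p) ⊙ X

  σ : V → V
  σ X = norm (reflect (hat X))

  hat-normalised : ∀ {X} → InΩ X → Normalised (hat X)
  hat-normalised {X} h = trans (Q-⊙ i X) (trans (cong (i *ᶠ i *ᶠ_) (sing h)) (zeroʳ (i *ᶠ i)))
                       , trans (B-⊙ i X p) (inv-left (affine h))
    where
    i : Fin q
    i = inv (B X p)

  normalised≢0v : ∀ {v} → Normalised v → v ≢ 0v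
  normalised≢0v nv refl = 0≢1 (trans (sym (B-0v p)) (Normalised.height nv))

  norm-InΩ : ∀ {v} → Q v ≡ 0# → B v p ≢ 0# → InΩ (norm v)
  norm-InΩ {v} Qv v⊥̸p = inΩ-intro (lead-norm v v≢0)
      (trans (Q-⊙ i v) (trans (cong (i *ᶠ i *ᶠ_) Qv) (zeroʳ (i *ᶠ i))))
      (λ eq → *≢0 (inv≢0 (lead≢0 v v≢0)) v⊥̸p (trans (sym (B-⊙ i v p)) eq))
    where
    i : Fin q
    i = inv (lead v)
    v≢0 : v ≢ 0v
    v≢0 refl = v⊥̸p (B-0v p)

  normalised-InΩ : ∀ {v} → Normalised v → InΩ (norm v)
  normalised-InΩ {v} (Qv , v·p≡1) = norm-InΩ {v} Qv (λ eq → 1≢0 (trans (sym v·p≡1) eq))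

  norm-hat : ∀ {X} → InΩ X → norm (hat X) ≡ X
  norm-hat {X} h = norm-⊙ X (inv≢0 (affine h)) (point h)

  hat-norm : ∀ {v} → Normalised v → hat (norm v) ≡ v
  hat-norm {v} nv = begin
    inv (B (norm v) p) ⊙ (ℓ ⊙ v) ≡⟨ cong (λ i → inv i ⊙ (ℓ ⊙ v)) (trans (B-⊙ ℓ v p) (trans (cong (ℓ *ᶠ_) (Normalised.height nv)) (*-identityʳ ℓ))) ⟩
    inv ℓ ⊙ (ℓ ⊙ v) ≡⟨ ⊙-assoc (inv ℓ) ℓ v ⟩
    (inv ℓ *ᶠ ℓ) ⊙ v ≡⟨ cong (_⊙ v) (inv-left (inv≢0 (lead≢0 v (normalised≢0v nv)))) ⟩
    1# ⊙ v ≡⟨ ⊙-identity v ⟩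
    v ∎
    where
    open ≡-Reasoning
    ℓ : Fin q
    ℓ = inv (lead v)

  σ-InΩ : ∀ {X} → InΩ X → InΩ (σ X)
  σ-InΩ h = normalised-InΩ (reflect-normalised (hat-normalised h))

  hat-σ : ∀ {X} → InΩ X → hat (σ X) ≡ reflect (hat X)
  hat-σ h = hat-norm (reflect-normalised (hat-normalised h))

  σ-involutive : ∀ {X} → InΩ X → σ (σ X) ≡ X
  σ-involutive {X} h = trans (cong (λ v → norm (reflect v)) (hat-σ h)) (trans (cong norm (reflect-involutive (hat X))) (norm-hat h))

  C : V → V → ℤ
  C X Y = z (B X Y)

  z-B-hatʳ : ∀ v {X} → InΩ X → z (B v (hat X)) ≡ z (B v X)
  z-B-hatʳ v {X} h = trans (cong z (B-⊙ʳ (inv (B X p)) v X)) (z-scale (B v X) (inv≢0 (affine h)))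

  C-hat : ∀ {X Y} → InΩ X → InΩ Y → C X Y ≡ z (B (hat X) (hat Y))
  C-hat {X} {Y} hX hY = sym (trans (z-B-hatʳ (hat X) hY) (trans (cong z (B-⊙ (inv (B X p)) X Y)) (z-scale (B X Y) (inv≢0 (affine hX)))))

  C-hat-σ : ∀ {X Y} → InΩ X → InΩ Y → C X (σ Y) ≡ z (B (hat X) (reflect (hat Y)))
  C-hat-σ {X} hX hY = trans (C-hat hX (σ-InΩ hY)) (cong (λ v → z (B (hat X) v)) (hat-σ hY))

  I-hat : ∀ {X Y} → InΩ X → InΩ Y → ι ⌊ X ≟ᵛ Y ⌋ ≡ ι ⌊ hat X ≟ᵛ hat Y ⌋
  I-hat hX hY = ι-⇔ (_ ≟ᵛ _) (_ ≟ᵛ _) (cong hat) (λ eq → trans (sym (norm-hat hX)) (trans (cong norm eq) (norm-hat hY)))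

  S-hat : ∀ {X Y} → InΩ X → InΩ Y → ι ⌊ X ≟ᵛ σ Y ⌋ ≡ ι ⌊ hat X ≟ᵛ reflect (hat Y) ⌋
  S-hat {X} hX hY = trans (I-hat hX (σ-InΩ hY)) (cong (λ v → ι ⌊ hat X ≟ᵛ v ⌋) (hat-σ hY))

  C-σ : ∀ {X Y} → InΩ X → InΩ Y → C X (σ Y) ≡ C (σ X) Y
  C-σ {X} {Y} hX hY = begin
    C X (σ Y) ≡⟨ C-hat-σ hX hY ⟩
    z (B (hat X) (reflect (hat Y))) ≡⟨ cong z (B-reflect-normalised (hat-normalised hX)) ⟩
    z (κ⁻¹ +ᶠ -ᶠ B (hat X) (hat Y)) ≡⟨ cong (λ i → z (κ⁻¹ +ᶠ -ᶠ i)) (B-sym (hat X) (hat Y)) ⟩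
    z (κ⁻¹ +ᶠ -ᶠ B (hat Y) (hat X)) ≡⟨ cong z (sym (B-reflect-normalised (hat-normalised hY))) ⟩
    z (B (hat Y) (reflect (hat X))) ≡⟨ sym (C-hat-σ hY hX) ⟩
    C Y (σ X) ≡⟨ cong z (B-sym Y (σ X)) ⟩
    C (σ X) Y ∎
    where open ≡-Reasoning

  C-diagonal : ∀ {X} → InΩ X → C X X ≡ 1ℤ
  C-diagonal {X} h = z≡1 (B-self {X} (sing h))

  C*D≡0 : ∀ {X Y} → InΩ X → InΩ Y → C X Y * C X (σ Y) ≡ 0ℤ
  C*D≡0 {X} {Y} hX hY = trans (cong₂ _*_ (C-hat hX hY) (C-hat-σ hX hY)) (go (B (hat X) (hat Y) ≟ 0#))
    where
    go : Dec (B (hat X) (hat Y) ≡ 0#) → z (B (hat X) (hat Y)) * z (B (hat X) (reflect (hat Y))) ≡ 0ℤ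
    go (yes eq) = trans (cong (z (B (hat X) (hat Y)) *_) (z≡0 (≢reflect (hat-normalised hX) eq))) (ℤ.*-zeroʳ (z (B (hat X) (hat Y))))
    go (no ne)  = cong (_* z (B (hat X) (reflect (hat Y)))) (z≡0 ne)

  C-opposite : ∀ {X} → InΩ X → C X (σ X) ≡ 0ℤ
  C-opposite {X} h = trans (sym (ℤ.*-identityˡ (C X (σ X)))) (trans (cong (_* C X (σ X)) (sym (C-diagonal h))) (C*D≡0 h h))

  I*C≡I : ∀ {X Y} → InΩ X → ι ⌊ X ≟ᵛ Y ⌋ * C X Y ≡ ι ⌊ X ≟ᵛ Y ⌋
  I*C≡I {X} {Y} h with X ≟ᵛ Y
  ... | yes refl = cong (1ℤ *_) (C-diagonal h)
  ... | no _     = refl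

  q-1≢0 : qz - 1ℤ ≢ 0ℤ
  q-1≢0 eq = go q 0# 1# (ℤ.+-injective (ℤ.i-j≡0⇒i≡j qz 1ℤ eq)) 0≢1
    where
    go : ∀ m (x y : Fin m) → m ≡ 1 → x ≢ y → _
    go (suc zero) Fin.zero Fin.zero refl ne = ne refl

  -- The summand does not see scalars, so `point-sum` turns q - 1 times the sum over Ω into the
  -- vector count `common`; the zero vector has weight 0, being orthogonal to p.
  C-square : ∀ {X Y} → InΩ X → InΩ Y → ∑ Ω (λ Z → C X Z * C Z Y) ≡
    α * α * (qz - 1ℤ) * ι ⌊ X ≟ᵛ Y ⌋ - α * α * ι ⌊ X ≟ᵛ σ Y ⌋ + α * (pos 2 - qz) * C X Y + α * C X (σ Y) + α * (α - 1ℤ)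
  C-square {X} {Y} hX hY = ℤ.*-cancelˡ-≡ (qz - 1ℤ) _ _ {{ℤ.≢-nonZero q-1≢0}} (begin
    (qz - 1ℤ) * ∑ Ω (λ Z → C X Z * C Z Y)
      ≡⟨ cong ((qz - 1ℤ) *_) (trans (∑-filter inΩ vs _)
           (∑-cong vs (λ v → trans (cong (_* (C X v * C v Y)) (ι-inΩ v)) (ℤ.*-assoc (ι (isPoint v)) (z (Q v) * (1ℤ - z (B v p))) (C X v * C v Y))))) ⟩
    (qz - 1ℤ) * ∑ vs (λ v → ι (isPoint v) * weight v)
      ≡⟨ point-sum weight weight-scale ⟩
    ∑ vs (λ v → (1ℤ - ι ⌊ v ≟ᵥ 0v ⌋) * weight v)
      ≡⟨ ∑-cong vs at ⟩
    common (hat X) (hat Y)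
      ≡⟨ common-formula (hat-normalised hX) (hat-normalised hY) ⟩
    (qz - 1ℤ) * formula (ι ⌊ hat X ≟ᵛ hat Y ⌋) (ι ⌊ hat X ≟ᵛ reflect (hat Y) ⌋) (z (B (hat X) (hat Y))) (z (B (hat X) (reflect (hat Y))))
      ≡⟨ cong₂ (λ i s → (qz - 1ℤ) * formula i s (z (B (hat X) (hat Y))) (z (B (hat X) (reflect (hat Y))))) (sym (I-hat hX hY)) (sym (S-hat hX hY)) ⟩
    (qz - 1ℤ) * formula (ι ⌊ X ≟ᵛ Y ⌋) (ι ⌊ X ≟ᵛ σ Y ⌋) (z (B (hat X) (hat Y))) (z (B (hat X) (reflect (hat Y))))
      ≡⟨ cong₂ (λ c d → (qz - 1ℤ) * formula (ι ⌊ X ≟ᵛ Y ⌋) (ι ⌊ X ≟ᵛ σ Y ⌋) c d) (sym (C-hat hX hY)) (sym (C-hat-σ hX hY)) ⟩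
    (qz - 1ℤ) * formula (ι ⌊ X ≟ᵛ Y ⌋) (ι ⌊ X ≟ᵛ σ Y ⌋) (C X Y) (C X (σ Y)) ∎)
    where
    open ≡-Reasoning
    vs : List V
    vs = allVectors n
    formula : ℤ → ℤ → ℤ → ℤ → ℤ
    formula i s c d = α * α * (qz - 1ℤ) * i - α * α * s + α * (pos 2 - qz) * c + α * d + α * (α - 1ℤ)
    weight : V → ℤ
    weight v = (z (Q v) * (1ℤ - z (B v p))) * (C X v * C v Y)
    weight-scale : ∀ {t} v → t ≢ 0# → weight (t ⊙ v) ≡ weight v
    weight-scale {t} v t≢0 = cong₂ _*_
      (cong₂ (λ i j → i * (1ℤ - j)) (trans (cong z (Q-⊙ t v)) (z-scale (Q v) (*≢0 t≢0 t≢0))) (trans (cong z (B-⊙ t v p)) (z-scale (B v p) t≢0)))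
      (cong₂ _*_ (trans (cong z (B-⊙ʳ t X v)) (z-scale (B X v) t≢0)) (trans (cong z (B-⊙ t v Y)) (z-scale (B v Y) t≢0)))
    ring₁ : ∀ q r x y → 1ℤ * (q * r * (x * y)) ≡ x * y * q * r
    ring₁ = solve-∀
    at : ∀ v → (1ℤ - ι ⌊ v ≟ᵥ 0v ⌋) * weight v ≡ (z (B v (hat X)) * z (B v (hat Y))) * z (Q v) * (1ℤ - z (B v p))
    at v = go (v ≟ᵥ 0v)
      where
      go : (e : Dec (v ≡ 0v)) → (1ℤ - ι ⌊ e ⌋) * weight v ≡ (z (B v (hat X)) * z (B v (hat Y))) * z (Q v) * (1ℤ - z (B v p))
      go (yes refl) = sym (trans (cong (λ i → z (B 0v (hat X)) * z (B 0v (hat Y)) * z (Q 0v) * (1ℤ - i)) (z≡1 (B-0v p)))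
        (ℤ.*-zeroʳ (z (B 0v (hat X)) * z (B 0v (hat Y)) * z (Q 0v))))
      go (no _) = trans (ring₁ (z (Q v)) (1ℤ - z (B v p)) (C X v) (C v Y))
        (cong₂ (λ i j → i * j * z (Q v) * (1ℤ - z (B v p))) (trans (cong z (B-sym X v)) (sym (z-B-hatʳ v hX))) (sym (z-B-hatʳ v hY)))

  Ω-once : ∀ {X} → InΩ X → ∑ Ω (λ Z → ι ⌊ Z ≟ᵛ X ⌋) ≡ 1ℤ
  Ω-once {X} h = begin
    ∑ Ω (λ Z → ι ⌊ Z ≟ᵛ X ⌋) ≡⟨ ∑-filter inΩ (allVectors n) _ ⟩
    ∑ (allVectors n) (λ Z → ι (inΩ Z) * ι ⌊ Z ≟ᵛ X ⌋) ≡⟨ ∑-cong (allVectors n) (λ Z → ℤ.*-comm (ι (inΩ Z)) _) ⟩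
    ∑ (allVectors n) (λ Z → ι ⌊ Z ≟ᵛ X ⌋ * ι (inΩ Z)) ≡⟨ Enumeration.∑-δ enumeration X (λ Z → ι (inΩ Z)) ⟩
    ι (inΩ X) ≡⟨ cong ι (inΩ-complete h) ⟩
    1ℤ ∎
    where open ≡-Reasoning

  -- If both e and f are orthogonal to p, a suitable u + x e + y f with B u p = 1 is singular.
  Ω-inhabited : ∃[ X ] InΩ X
  Ω-inhabited = go (B e p ≟ 0#) (B f p ≟ 0#) (nondegenerate p p≢0v)
    where
    go : Dec (B e p ≡ 0#) → Dec (B f p ≡ 0#) → ∃[ u ] (B u p ≡ 1#) → ∃[ X ] InΩ X
    go (no e⊥̸p)  _         _           = norm e , norm-InΩ {e} Qe≡0 e⊥̸p
    go (yes _)   (no f⊥̸p)  _           = norm f , norm-InΩ {f} Qf≡0 f⊥̸p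
    go (yes e⊥p) (yes f⊥p) (u , u·p≡1) = norm v , norm-InΩ {v} Qv (λ eq → 1≢0 (trans (sym v·p≡1) eq))
     where
     w v : V
     w = u ⊕ (1# +ᶠ -ᶠ B u f) ⊙ e
     v = w ⊕ (-ᶠ Q w) ⊙ f
     w·f≡1 : B w f ≡ 1#
     w·f≡1 = trans (B-line u (1# +ᶠ -ᶠ B u f) e f) (trans (cong (λ i → B u f +ᶠ (1# +ᶠ -ᶠ B u f) *ᶠ i) e·f≡1)
       (solve 1 (λ b → b :+ (𝟙 :+ :- b) :* 𝟙 := 𝟙) refl (B u f)))
     Qv : Q v ≡ 0#
     Qv = trans (Q-line {f} Qf≡0 (-ᶠ Q w) w) (trans (cong (λ i → Q w +ᶠ (-ᶠ Q w) *ᶠ i) w·f≡1)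
       (solve 1 (λ x → x :+ (:- x) :* 𝟙 := 𝟘) refl (Q w)))
     v·p≡1 : B v p ≡ 1#
     v·p≡1 = trans (B-line-⊥ {f} {p} f⊥p (-ᶠ Q w) w) (trans (B-line-⊥ {e} {p} e⊥p (1# +ᶠ -ᶠ B u f) u) u·p≡1)

  collinear-form : ∀ {X Y} → Q X ≡ 0# → Q Y ≡ 0# → ∀ s t → Q (s ⊙ X ⊕ t ⊙ Y) ≡ (s *ᶠ t) *ᶠ B X Y
  collinear-form {X} {Y} QX QY s t = trans (Q-line {Y} QY t (s ⊙ X)) (trans (cong₂ (λ i j → i +ᶠ t *ᶠ j)
    (trans (Q-⊙ s X) (cong (s *ᶠ s *ᶠ_) QX)) (B-⊙ s X Y))
    (solve 3 (λ s t b → s :* s :* 𝟘 :+ t :* (s :* b) := (s :* t) :* b) refl s t (B X Y)))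

  spansLine : V → V → Bool
  spansLine X Y = allF (λ s → allF (λ t → Q (s ⊙ X ⊕ t ⊙ Y) == 0#))

  -- On the span Q is s t B(X, Y), and s = t = 1 already recovers B(X, Y).
  line-on-quadric : ∀ {X Y} → Q X ≡ 0# → Q Y ≡ 0# → spansLine X Y ≡ ⌊ B X Y ≟ 0# ⌋
  line-on-quadric {X} {Y} QX QY = ≡⌊⌋ (B X Y ≟ 0#) to from
    where
    to : spansLine X Y ≡ true → B X Y ≡ 0#
    to eq = trans (solve 1 (λ b → b := (𝟙 :* 𝟙) :* b) refl (B X Y)) (trans (sym (collinear-form {X} {Y} QX QY 1# 1#))
      (⌊⌋-sound (Q (1# ⊙ X ⊕ 1# ⊙ Y) ≟ 0#) (all-elim (λ t → Q (1# ⊙ X ⊕ t ⊙ Y) == 0#) (allFin q)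
        (all-elim (λ s → allF (λ t → Q (s ⊙ X ⊕ t ⊙ Y) == 0#)) (allFin q) eq (∈-allFin 1#)) (∈-allFin 1#))))
    from : B X Y ≡ 0# → spansLine X Y ≡ true
    from X⊥Y = all-intro (λ s → allF (λ t → Q (s ⊙ X ⊕ t ⊙ Y) == 0#)) (allFin q) (λ s → all-intro (λ t → Q (s ⊙ X ⊕ t ⊙ Y) == 0#) (allFin q) (λ t →
      ⌊⌋-complete (Q (s ⊙ X ⊕ t ⊙ Y) ≟ 0#) (trans (collinear-form {X} {Y} QX QY s t) (trans (cong ((s *ᶠ t) *ᶠ_) X⊥Y) (zeroʳ (s *ᶠ t))))))

  ι-∼ : ∀ {X Y} → InΩ X → InΩ Y → ι (X ∼ Y) ≡ C X Y - ι ⌊ X ≟ᵛ Y ⌋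
  ι-∼ {X} {Y} hX hY = begin
    ι (X ∼ Y) ≡⟨ ι-∧ (not (X ==v Y)) (spansLine X Y) ⟩
    ι (not (X ==v Y)) * ι (spansLine X Y) ≡⟨ cong₂ _*_ (trans (ι-not (X ==v Y)) (cong (λ b → 1ℤ - ι b) (==v≡⌊⌋ X Y))) (cong ι (line-on-quadric {X} {Y} (sing hX) (sing hY))) ⟩
    (1ℤ - ι ⌊ X ≟ᵛ Y ⌋) * C X Y ≡⟨ ring₁ (ι ⌊ X ≟ᵛ Y ⌋) (C X Y) ⟩
    C X Y - ι ⌊ X ≟ᵛ Y ⌋ * C X Y ≡⟨ cong (λ i → C X Y - i) (I*C≡I {X} {Y} hX) ⟩
    C X Y - ι ⌊ X ≟ᵛ Y ⌋ ∎
    where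
    open ≡-Reasoning
    ring₁ : ∀ i c → (1ℤ - i) * c ≡ c - i * c
    ring₁ = solve-∀

  -- Equal points also have C = 1, so excluding equality and collinearity together is the plain
  -- complement of C.
  ι-≁ : ∀ {X Y} → InΩ X → InΩ Y → ι (X ≁ Y) ≡ 1ℤ - C X Y
  ι-≁ {X} {Y} hX hY = begin
    ι (X ≁ Y) ≡⟨ ι-∧ (not (X ==v Y)) (not (X ∼ Y)) ⟩
    ι (not (X ==v Y)) * ι (not (X ∼ Y)) ≡⟨ cong₂ _*_ (trans (ι-not (X ==v Y)) (cong (λ b → 1ℤ - ι b) (==v≡⌊⌋ X Y))) (trans (ι-not (X ∼ Y)) (cong (1ℤ +_) (cong -_ (ι-∼ hX hY)))) ⟩
    (1ℤ - I) * (1ℤ - (C X Y - I)) ≡⟨ ring₁ I (C X Y) ⟩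
    1ℤ - C X Y + (I * C X Y - I * I) ≡⟨ cong₂ (λ i j → 1ℤ - C X Y + (i - j)) (I*C≡I {X} {Y} hX) (ι-idem ⌊ X ≟ᵛ Y ⌋) ⟩
    1ℤ - C X Y + (I - I) ≡⟨ ring₂ I (C X Y) ⟩
    1ℤ - C X Y ∎
    where
    open ≡-Reasoning
    I : ℤ
    I = ι ⌊ X ≟ᵛ Y ⌋
    ring₁ : ∀ i c → (1ℤ - i) * (1ℤ - (c - i)) ≡ 1ℤ - c + (i * c - i * i)
    ring₁ = solve-∀
    ring₂ : ∀ i c → 1ℤ - c + (i - i) ≡ 1ℤ - c
    ring₂ = solve-∀

  Y≢σY : ∀ {Y} → InΩ Y → σ Y ≢ Y
  Y≢σY {Y} h eq = 1≢0ℤ (trans (sym (C-diagonal h)) (trans (cong (C Y) (sym eq)) (C-opposite h)))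
    where
    1≢0ℤ : 1ℤ ≢ 0ℤ
    1≢0ℤ ()

  -- Choose e with B(e, p) = 1 and put r = B(e, p′). Then p′ - r p is orthogonal to Π and to e,
  -- which together span the space, so it is 0.
  isPole-sound : ∀ {p′} → isPole p′ ≡ true → ∃[ r ] (p′ ≡ r ⊙ p)
  isPole-sound {p′} eq with nondegenerate p p≢0v
  ... | e , e·p≡1 = r , go (p″ ≟ᵛ 0v)
    where
    open ≡-Reasoning
    r : Fin q
    r = B e p′
    p″ : V
    p″ = p′ ⊕ (-ᶠ r) ⊙ p
    e⊥p″ : B e p″ ≡ 0#
    e⊥p″ = trans (B-lineʳ p′ (-ᶠ r) p e) (trans (cong (λ i → r +ᶠ (-ᶠ r) *ᶠ i) e·p≡1)
      (solve 1 (λ r → r :+ (:- r) :* 𝟙 := 𝟘) refl r))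
    p′⊥Π : ∀ {x} → B x p ≡ 0# → B p′ x ≡ 0#
    p′⊥Π {x} x⊥p = trans (sym (Bf≡polar p′ x)) (⌊⌋-sound (Bf p′ x ≟ 0#) (subst (λ b → (if b then Bf p′ x == 0# else true) ≡ true)
      (⌊⌋-complete (dot a x ≟ 0#) (trans (sym (B-p x)) x⊥p))
      (all-elim (λ x → if inΠ x then Bf p′ x == 0# else true) (allVectors n) (proj₂ (∧-true {isPoint p′} eq)) (Enumeration.listed enumeration x))))
    go : Dec (p″ ≡ 0v) → p′ ≡ r ⊙ p
    go (yes p″≡0) = difference p′ r p p″≡0
    go (no p″≢0) with nondegenerate p″ p″≢0
    ... | x , x·p″≡1 = ⊥-elim (0≢1 (begin
      0# ≡⟨ solve 1 (λ r → 𝟘 := 𝟘 :+ (:- r) :* 𝟘) refl r ⟩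
      0# +ᶠ (-ᶠ r) *ᶠ 0# ≡⟨ cong₂ (λ i j → i +ᶠ (-ᶠ r) *ᶠ j) (sym (trans (B-sym y p′) (p′⊥Π y⊥p))) (sym y⊥p) ⟩
      B y p′ +ᶠ (-ᶠ r) *ᶠ B y p ≡⟨ sym (B-lineʳ p′ (-ᶠ r) p y) ⟩
      B y p″ ≡⟨ trans (B-line-⊥ {e} {p″} e⊥p″ (-ᶠ B x p) x) x·p″≡1 ⟩
      1# ∎))
      where
      y : V
      y = x ⊕ (-ᶠ B x p) ⊙ e
      y⊥p : B y p ≡ 0#
      y⊥p = trans (B-line x (-ᶠ B x p) e p) (trans (cong (λ i → B x p +ᶠ (-ᶠ B x p) *ᶠ i) e·p≡1)
        (solve 1 (λ r → r :+ (:- r) :* 𝟙 := 𝟘) refl (B x p)))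

  isPole-norm : isPole (norm p) ≡ true
  isPole-norm = true-∧ (trans (isPoint≡lead (norm p)) (⌊⌋-complete (lead (norm p) ≟ 1#) (lead-norm p p≢0v)))
    (all-intro (λ x → if inΠ x then Bf (norm p) x == 0# else true) (allVectors n) at)
    where
    at : ∀ x → (if inΠ x then Bf (norm p) x == 0# else true) ≡ true
    at x with dot a x ≟ 0#
    ... | yes x∈Π = ⌊⌋-complete (Bf (norm p) x ≟ 0#) (trans (Bf≡polar (norm p) x) (trans (B-⊙ (inv (lead p)) p x)
                      (trans (cong (inv (lead p) *ᶠ_) (trans (polar-pole a x) x∈Π)) (zeroʳ (inv (lead p))))))
    ... | no _    = refl

  -- For Z = s Y + u p the value Q Z is u (s η + u κ). The root u = 0 is Y itself, as both are
  -- normalised; the other gives B(Z, p) = u κ, and rescaling Z to height 1 yields the reflected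
  -- vector.
  second-point : ∀ {Y Z s u} → InΩ Y → lead Z ≡ 1# → Q Z ≡ 0# → Z ≢ Y → (∀ e → B e Z ≡ s *ᶠ B e Y +ᶠ u *ᶠ B e p) → Z ≡ σ Y
  second-point {Y} {Z} {s} {u} hY pt QZ Z≢Y line = go (u ≟ 0#)
    where
    open ≡-Reasoning
    η : Fin q
    η = B Y p
    Z≡ : Z ≡ s ⊙ Y ⊕ u ⊙ p
    Z≡ = B-ext (λ e → trans (line e) (sym (trans (B-lineʳ (s ⊙ Y) u p e) (cong (_+ᶠ u *ᶠ B e p) (B-⊙ʳ s e Y)))))
    QZ-expand : u *ᶠ (s *ᶠ η +ᶠ u *ᶠ Q p) ≡ 0#
    QZ-expand = begin
      u *ᶠ (s *ᶠ η +ᶠ u *ᶠ Q p)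
        ≡⟨ solve 4 (λ u s h k → u :* (s :* h :+ u :* k) := (s :* s :* 𝟘 :+ u :* u :* k) :+ u :* (s :* h)) refl u s η (Q p) ⟩
      (s *ᶠ s *ᶠ 0# +ᶠ u *ᶠ u *ᶠ Q p) +ᶠ u *ᶠ (s *ᶠ η)
        ≡⟨ cong₂ _+ᶠ_ (cong₂ _+ᶠ_ (trans (cong (s *ᶠ s *ᶠ_) (sym (sing hY))) (sym (Q-⊙ s Y))) (sym (Q-⊙ u p)))
             (sym (trans (B-⊙ʳ u (s ⊙ Y) p) (cong (u *ᶠ_) (B-⊙ s Y p)))) ⟩
      (Q (s ⊙ Y) +ᶠ Q (u ⊙ p)) +ᶠ B (s ⊙ Y) (u ⊙ p)
        ≡⟨ sym (Q-⊕ (s ⊙ Y) (u ⊙ p)) ⟩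
      Q (s ⊙ Y ⊕ u ⊙ p)
        ≡⟨ cong Q (sym Z≡) ⟩
      Q Z
        ≡⟨ QZ ⟩
      0# ∎
    go : Dec (u ≡ 0#) → Z ≡ σ Y
    go (yes u≡0) = ⊥-elim (Z≢Y (trans Z≡sY (trans (cong (_⊙ Y) s≡1) (⊙-identity Y))))
      where
      Z≡sY : Z ≡ s ⊙ Y
      Z≡sY = B-ext (λ e → trans (line e) (trans (cong (λ i → s *ᶠ B e Y +ᶠ i *ᶠ B e p) u≡0)
        (trans (solve 2 (λ x y → x :+ 𝟘 :* y := x) refl (s *ᶠ B e Y) (B e p)) (sym (B-⊙ʳ s e Y)))))
      s≡1 : s ≡ 1#
      s≡1 = trans (sym (*-identityʳ s)) (trans (cong (s *ᶠ_) (sym (point hY))) (trans (sym (lead-⊙ s Y)) (trans (cong lead (sym Z≡sY)) pt)))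
    go (no u≢0) = trans (sym (norm-hat hZ)) (cong norm (B-ext (λ e → begin
        B e (hat Z)
          ≡⟨ trans (B-⊙ʳ i e Z) (cong (i *ᶠ_) (line e)) ⟩
        i *ᶠ (s *ᶠ B e Y +ᶠ u *ᶠ B e p)
          ≡⟨ solve 5 (λ i s u y p → i :* (s :* y :+ u :* p) := (i :* u) :* p :+ (i :* s) :* y) refl i s u (B e Y) (B e p) ⟩
        (i *ᶠ u) *ᶠ B e p +ᶠ (i *ᶠ s) *ᶠ B e Y
          ≡⟨ cong₂ (λ x y → x *ᶠ B e p +ᶠ y *ᶠ B e Y) iu≡κ⁻¹ is≡ ⟩
        κ⁻¹ *ᶠ B e p +ᶠ (-ᶠ inv η) *ᶠ B e Y
          ≡⟨ solve 3 (λ x j y → x :+ (:- j) :* y := x :+ :- (j :* y)) refl (κ⁻¹ *ᶠ B e p) (inv η) (B e Y) ⟩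
        κ⁻¹ *ᶠ B e p +ᶠ -ᶠ (inv η *ᶠ B e Y)
          ≡⟨ cong (λ x → κ⁻¹ *ᶠ B e p +ᶠ -ᶠ x) (sym (B-⊙ʳ (inv η) e Y)) ⟩
        κ⁻¹ *ᶠ B e p +ᶠ -ᶠ B e (hat Y)
          ≡⟨ sym (B-reflect (hat Y) e) ⟩
        B e (reflect (hat Y)) ∎)))
      where
      sη≡-uκ : s *ᶠ η ≡ -ᶠ (u *ᶠ Q p)
      sη≡-uκ = x-y≡0 (trans (cong (s *ᶠ η +ᶠ_) (-‿involutive (u *ᶠ Q p))) (*-cancel-0 u≢0 QZ-expand))
      Z·p : B Z p ≡ u *ᶠ Q p
      Z·p = begin
        B Z p ≡⟨ trans (B-sym Z p) (line p) ⟩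
        s *ᶠ B p Y +ᶠ u *ᶠ B p p ≡⟨ cong₂ (λ x y → s *ᶠ x +ᶠ u *ᶠ y) (B-sym p Y) (B-diagonal p) ⟩
        s *ᶠ η +ᶠ u *ᶠ (Q p +ᶠ Q p) ≡⟨ cong (_+ᶠ u *ᶠ (Q p +ᶠ Q p)) sη≡-uκ ⟩
        -ᶠ (u *ᶠ Q p) +ᶠ u *ᶠ (Q p +ᶠ Q p) ≡⟨ solve 2 (λ u k → :- (u :* k) :+ u :* (k :+ k) := u :* k) refl u (Q p) ⟩
        u *ᶠ Q p ∎
      Z·p≢0 : B Z p ≢ 0#
      Z·p≢0 eq = *≢0 u≢0 κ≢0 (trans (sym Z·p) eq)
      hZ : InΩ Z
      hZ = inΩ-intro pt QZ Z·p≢0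
      i : Fin q
      i = inv (B Z p)
      iuκ≡1 : i *ᶠ (u *ᶠ Q p) ≡ 1#
      iuκ≡1 = trans (cong (i *ᶠ_) (sym Z·p)) (inv-left Z·p≢0)
      iu≡κ⁻¹ : i *ᶠ u ≡ κ⁻¹
      iu≡κ⁻¹ = begin
        i *ᶠ u ≡⟨ solve 2 (λ i u → i :* u := i :* u :* 𝟙) refl i u ⟩
        i *ᶠ u *ᶠ 1# ≡⟨ cong (i *ᶠ u *ᶠ_) (sym (inv-right κ≢0)) ⟩
        i *ᶠ u *ᶠ (Q p *ᶠ κ⁻¹) ≡⟨ solve 4 (λ i u k j → i :* u :* (k :* j) := (i :* (u :* k)) :* j) refl i u (Q p) κ⁻¹ ⟩
        (i *ᶠ (u *ᶠ Q p)) *ᶠ κ⁻¹ ≡⟨ cong (_*ᶠ κ⁻¹) iuκ≡1 ⟩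
        1# *ᶠ κ⁻¹ ≡⟨ *-identityˡ κ⁻¹ ⟩
        κ⁻¹ ∎
      is≡ : i *ᶠ s ≡ -ᶠ inv η
      is≡ = begin
        i *ᶠ s ≡⟨ solve 2 (λ i s → i :* s := i :* s :* 𝟙) refl i s ⟩
        i *ᶠ s *ᶠ 1# ≡⟨ cong (i *ᶠ s *ᶠ_) (sym (inv-right (affine hY))) ⟩
        i *ᶠ s *ᶠ (η *ᶠ inv η) ≡⟨ solve 4 (λ i s h j → i :* s :* (h :* j) := i :* (s :* h) :* j) refl i s η (inv η) ⟩
        i *ᶠ (s *ᶠ η) *ᶠ inv η ≡⟨ cong (λ x → i *ᶠ x *ᶠ inv η) sη≡-uκ ⟩
        i *ᶠ (-ᶠ (u *ᶠ Q p)) *ᶠ inv η ≡⟨ solve 3 (λ i x j → i :* (:- x) :* j := :- (i :* x :* j)) refl i (u *ᶠ Q p) (inv η) ⟩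
        -ᶠ (i *ᶠ (u *ᶠ Q p) *ᶠ inv η) ≡⟨ cong (λ x → -ᶠ (x *ᶠ inv η)) iuκ≡1 ⟩
        -ᶠ (1# *ᶠ inv η) ≡⟨ cong -ᶠ_ (*-identityˡ (inv η)) ⟩
        -ᶠ inv η ∎

  isSigma≡ : ∀ {Y} → InΩ Y → ∀ Z → isSigma Y Z ≡ ⌊ Z ≟ᵛ σ Y ⌋
  isSigma≡ {Y} hY Z = ≡⌊⌋ (Z ≟ᵛ σ Y) to (λ { refl → from })
    where
    onLine : V → V → Fin q → Fin q → Bool
    onLine Z p′ s t = Z ==v (s ⊙ Y ⊕ t ⊙ p′)
    joins : V → V → Bool
    joins Z p′ = isPole p′ ∧ anyF (λ s → anyF (λ t → onLine Z p′ s t))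
    to : isSigma Y Z ≡ true → Z ≡ σ Y
    to eq with ∧-true {onQuadric Z} eq
    ... | quad , eq₁ with ∧-true {isPoint Z} quad | ∧-true {not (Z ==v Y)} eq₁
    ... | pt , sg | ne , eq₂ with any-elim (joins Z) (allVectors n) eq₂
    ... | p′ , eq₃ with ∧-true {isPole p′} eq₃
    ... | pl , eq₄ with isPole-sound pl | any-elim (λ s → anyF (onLine Z p′ s)) (allFin q) eq₄
    ... | r , p′≡ | s , eq₅ with any-elim (onLine Z p′ s) (allFin q) eq₅
    ... | t , eq₆ = second-point {Y} {Z} {s} {t *ᶠ r} hY (⌊⌋-sound (lead Z ≟ 1#) (trans (sym (isPoint≡lead Z)) pt)) (⌊⌋-sound (Q Z ≟ 0#) sg)
        (λ Z≡Y → not-true ne (trans (==v≡⌊⌋ Z Y) (⌊⌋-complete (Z ≟ᵛ Y) Z≡Y)))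
        (λ e → trans (cong (B e) Z≡) (trans (B-lineʳ (s ⊙ Y) t p′ e) (trans (cong₂ (λ x y → x +ᶠ t *ᶠ y) (B-⊙ʳ s e Y) (trans (cong (B e) p′≡) (B-⊙ʳ r e p)))
          (cong (s *ᶠ B e Y +ᶠ_) (sym (*-assoc t r (B e p)))))))
      where
      Z≡ : Z ≡ s ⊙ Y ⊕ t ⊙ p′
      Z≡ = ⌊⌋-sound (Z ≟ᵛ (s ⊙ Y ⊕ t ⊙ p′)) (trans (sym (==v≡⌊⌋ Z _)) eq₆)
    from : isSigma Y (σ Y) ≡ true
    from = true-∧ (onQuadric-complete {σ Y} (point hσ) (sing hσ))
      (true-∧ (true-not (λ eq → Y≢σY hY (⌊⌋-sound (σ Y ≟ᵛ Y) (trans (sym (==v≡⌊⌋ (σ Y) Y)) eq))))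
        (any-intro (joins (σ Y)) (Enumeration.listed enumeration (norm p)) (true-∧ isPole-norm
          (any-intro (λ s → anyF (onLine (σ Y) (norm p) s)) (∈-allFin s)
            (any-intro (onLine (σ Y) (norm p) s) (∈-allFin t) (trans (==v≡⌊⌋ (σ Y) _) (⌊⌋-complete (σ Y ≟ᵛ _) on-line)))))))
      where
      open ≡-Reasoning
      hσ : InΩ (σ Y)
      hσ = σ-InΩ hY
      -- ℓ normalises the reflected vector, and the factor `lead p` undoes the normalisation of
      -- `norm p`.
      ℓ s t : Fin q
      ℓ = inv (lead (reflect (hat Y)))
      s = ℓ *ᶠ (-ᶠ inv (B Y p))
      t = ℓ *ᶠ (κ⁻¹ *ᶠ lead p)
      on-line : σ Y ≡ s ⊙ Y ⊕ t ⊙ norm p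
      on-line = B-ext (λ e → begin
        B e (σ Y) ≡⟨ trans (B-⊙ʳ ℓ e (reflect (hat Y))) (cong (ℓ *ᶠ_) (B-reflect (hat Y) e)) ⟩
        ℓ *ᶠ (κ⁻¹ *ᶠ B e p +ᶠ -ᶠ B e (hat Y)) ≡⟨ cong (λ x → ℓ *ᶠ (κ⁻¹ *ᶠ B e p +ᶠ -ᶠ x)) (B-⊙ʳ (inv (B Y p)) e Y) ⟩
        ℓ *ᶠ (κ⁻¹ *ᶠ B e p +ᶠ -ᶠ (inv (B Y p) *ᶠ B e Y))
          ≡⟨ solve 5 (λ l k x j y → l :* (k :* x :+ :- (j :* y)) := l :* (:- j) :* y :+ l :* (k :* 𝟙) :* x) refl ℓ κ⁻¹ (B e p) (inv (B Y p)) (B e Y) ⟩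
        s *ᶠ B e Y +ᶠ ℓ *ᶠ (κ⁻¹ *ᶠ 1#) *ᶠ B e p
          ≡⟨ cong (λ x → s *ᶠ B e Y +ᶠ ℓ *ᶠ (κ⁻¹ *ᶠ x) *ᶠ B e p) (sym (inv-right (lead≢0 p p≢0v))) ⟩
        s *ᶠ B e Y +ᶠ ℓ *ᶠ (κ⁻¹ *ᶠ (lead p *ᶠ inv (lead p))) *ᶠ B e p
          ≡⟨ solve 6 (λ y l k m j x → y :+ l :* (k :* (m :* j)) :* x := y :+ l :* (k :* m) :* (j :* x)) refl (s *ᶠ B e Y) ℓ κ⁻¹ (lead p) (inv (lead p)) (B e p) ⟩
        s *ᶠ B e Y +ᶠ t *ᶠ (inv (lead p) *ᶠ B e p) ≡⟨ cong₂ (λ x y → x +ᶠ t *ᶠ y) (sym (B-⊙ʳ s e Y)) (sym (B-⊙ʳ (inv (lead p)) e p)) ⟩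
        B e (s ⊙ Y) +ᶠ t *ᶠ B e (norm p) ≡⟨ sym (B-lineʳ (s ⊙ Y) t (norm p) e) ⟩
        B e (s ⊙ Y ⊕ t ⊙ norm p) ∎)

  -- The search for Z has the single hit σ Y, so the existential in `simσ` and `nsimσ` becomes
  -- evaluation.
  any-σ : ∀ {Y} → InΩ Y → (g : V → Bool) → BL.any (λ Z → isSigma Y Z ∧ g Z) (allVectors n) ≡ g (σ Y)
  any-σ {Y} hY g = true-ext to (λ gσ → any-intro (λ Z → isSigma Y Z ∧ g Z) (Enumeration.listed enumeration (σ Y))
      (true-∧ (trans (isSigma≡ hY (σ Y)) (⌊⌋-complete (σ Y ≟ᵛ σ Y) refl)) gσ))
    where
    at : ∀ Z → isSigma Y Z ∧ g Z ≡ true → g (σ Y) ≡ true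
    at Z eq = subst (λ V → g V ≡ true) (⌊⌋-sound (Z ≟ᵛ σ Y) (trans (sym (isSigma≡ hY Z)) (proj₁ split))) (proj₂ split)
      where
      split : isSigma Y Z ≡ true × g Z ≡ true
      split = ∧-true {isSigma Y Z} eq
    to : BL.any (λ Z → isSigma Y Z ∧ g Z) (allVectors n) ≡ true → g (σ Y) ≡ true
    to eq = at (proj₁ found) (proj₂ found)
      where
      found : ∃[ Z ] (isSigma Y Z ∧ g Z ≡ true)
      found = any-elim (λ Z → isSigma Y Z ∧ g Z) (allVectors n) eq

  geometry : ReflectionGeometry Ω R α qz
  geometry = record
    { _≟ᵖ_ = _≟ᵛ_ ; σ = σ ; C = C
    ; once = λ X∈ → Ω-once (∈Ω⇒ X∈)
    ; σ-closed = λ X∈ → ⇒∈Ω (σ-InΩ (∈Ω⇒ X∈))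
    ; σ-invol = λ X∈ → σ-involutive (∈Ω⇒ X∈)
    ; C-sym = λ {X} {Y} _ _ → cong z (B-sym X Y)
    ; C-σ = λ X∈ Y∈ → C-σ (∈Ω⇒ X∈) (∈Ω⇒ Y∈)
    ; C-idem = λ X Y → ι-idem ⌊ B X Y ≟ 0# ⌋
    ; C-diag = λ X∈ → C-diagonal (∈Ω⇒ X∈)
    ; C-opp = λ X∈ → C-opposite (∈Ω⇒ X∈)
    ; C-square = λ X∈ Y∈ → C-square (∈Ω⇒ X∈) (∈Ω⇒ Y∈)
    ; indicator = λ X∈ Y∈ → indicator (∈Ω⇒ X∈) (∈Ω⇒ Y∈)
    ; base = proj₁ Ω-inhabited
    ; base∈Ω = ⇒∈Ω (proj₂ Ω-inhabited) }
    where
    open ℤCoefficients α qz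
    open ≡-Reasoning
    combination : Coefficients → V → V → ℤ
    combination t X Y = t 0F * ι ⌊ X ≟ᵛ Y ⌋ + (t 1F * ι ⌊ X ≟ᵛ σ Y ⌋ + (t 2F * C X Y + (t 3F * C X (σ Y) + t 4F * 1ℤ)))
    indicator : ∀ {X Y} → InΩ X → InΩ Y → ∀ l → ι (R l X Y) ≡ combination (adjacency l) X Y
    indicator {X} {Y} hX hY = go
      where
      I S c′ d′ : ℤ
      I  = ι ⌊ X ≟ᵛ Y ⌋
      S  = ι ⌊ X ≟ᵛ σ Y ⌋
      c′ = C X Y
      d′ = C X (σ Y)
      -- The relations are conjunctions, so their indicators are products. Since C D vanishes
      -- entrywise, I ≤ C and S ≤ D, the mixed products vanish and linear combinations remain.
      I*d≡0 : I * d′ ≡ 0ℤ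
      I*d≡0 = trans (cong (_* d′) (sym (I*C≡I {X} {Y} hX))) (trans (ℤ.*-assoc I c′ d′) (trans (cong (I *_) (C*D≡0 hX hY)) (ℤ.*-zeroʳ I)))
      c*S≡0 : c′ * S ≡ 0ℤ
      c*S≡0 = trans (cong (c′ *_) (sym (I*C≡I {X} {σ Y} hX))) (trans (ring₁ c′ S d′) (trans (cong (_* S) (C*D≡0 hX hY)) refl))
        where
        ring₁ : ∀ c s d → c * (s * d) ≡ c * d * s
        ring₁ = solve-∀
      Y≁X : ι (Y ≁ X) ≡ 1ℤ - c′
      Y≁X = trans (ι-≁ hY hX) (cong (λ b → 1ℤ - z b) (B-sym Y X))
      Y∼X : ι (Y ∼ X) ≡ c′ - I
      Y∼X = trans (ι-∼ hY hX) (cong₂ (λ b i → z b - i) (B-sym Y X) (ι-⇔ (Y ≟ᵛ X) (X ≟ᵛ Y) sym sym))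
      sim : ι (simσ X Y) ≡ d′ - S
      sim = trans (cong ι (any-σ hY (X ∼_))) (ι-∼ hX (σ-InΩ hY))
      nsim : ι (nsimσ X Y) ≡ 1ℤ - d′
      nsim = trans (cong ι (any-σ hY (X ≁_))) (ι-≁ hX (σ-InΩ hY))
      go : ∀ l → ι (R l X Y) ≡ combination (adjacency l) X Y
      go 0F = trans (cong ι (==v≡⌊⌋ X Y)) (ring₁ I S c′ d′)
        where
        ring₁ : ∀ i s c d → i ≡ 1ℤ * i + (0ℤ * s + (0ℤ * c + (0ℤ * d + 0ℤ * 1ℤ)))
        ring₁ = solve-∀
      go 1F = begin
        ι ((Y ≁ X) ∧ simσ X Y) ≡⟨ trans (ι-∧ (Y ≁ X) _) (cong₂ _*_ Y≁X sim) ⟩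
        (1ℤ - c′) * (d′ - S) ≡⟨ ring₁ c′ d′ S ⟩
        d′ - S + (c′ * S - c′ * d′) ≡⟨ cong₂ (λ x y → d′ - S + (x - y)) c*S≡0 (C*D≡0 hX hY) ⟩
        d′ - S + (0ℤ - 0ℤ) ≡⟨ ring₂ I S c′ d′ ⟩
        combination (adjacency 1F) X Y ∎
        where
        ring₁ : ∀ c d s → (1ℤ - c) * (d - s) ≡ d - s + (c * s - c * d)
        ring₁ = solve-∀
        ring₂ : ∀ i s c d → d - s + (0ℤ - 0ℤ) ≡ 0ℤ * i + (ℤ.-1ℤ * s + (0ℤ * c + (1ℤ * d + 0ℤ * 1ℤ)))
        ring₂ = solve-∀
      go 2F = begin
        ι ((Y ≁ X) ∧ nsimσ X Y) ≡⟨ trans (ι-∧ (Y ≁ X) _) (cong₂ _*_ Y≁X nsim) ⟩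
        (1ℤ - c′) * (1ℤ - d′) ≡⟨ ring₁ c′ d′ ⟩
        1ℤ - c′ - d′ + c′ * d′ ≡⟨ cong (1ℤ - c′ - d′ +_) (C*D≡0 hX hY) ⟩
        1ℤ - c′ - d′ + 0ℤ ≡⟨ ring₂ I S c′ d′ ⟩
        combination (adjacency 2F) X Y ∎
        where
        ring₁ : ∀ c d → (1ℤ - c) * (1ℤ - d) ≡ 1ℤ - c - d + c * d
        ring₁ = solve-∀
        ring₂ : ∀ i s c d → 1ℤ - c - d + 0ℤ ≡ 0ℤ * i + (0ℤ * s + (ℤ.-1ℤ * c + (ℤ.-1ℤ * d + 1ℤ * 1ℤ)))
        ring₂ = solve-∀
      go 3F = begin
        ι ((Y ∼ X) ∧ nsimσ X Y) ≡⟨ trans (ι-∧ (Y ∼ X) _) (cong₂ _*_ Y∼X nsim) ⟩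
        (c′ - I) * (1ℤ - d′) ≡⟨ ring₁ I c′ d′ ⟩
        c′ - I + (I * d′ - c′ * d′) ≡⟨ cong₂ (λ x y → c′ - I + (x - y)) I*d≡0 (C*D≡0 hX hY) ⟩
        c′ - I + (0ℤ - 0ℤ) ≡⟨ ring₂ I S c′ d′ ⟩
        combination (adjacency 3F) X Y ∎
        where
        ring₁ : ∀ i c d → (c - i) * (1ℤ - d) ≡ c - i + (i * d - c * d)
        ring₁ = solve-∀
        ring₂ : ∀ i s c d → c - i + (0ℤ - 0ℤ) ≡ ℤ.-1ℤ * i + (0ℤ * s + (1ℤ * c + (0ℤ * d + 0ℤ * 1ℤ)))
        ring₂ = solve-∀
      go 4F = trans (cong ι (isSigma≡ hY X)) (ring₁ I S c′ d′)
        where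
        ring₁ : ∀ i s c d → s ≡ 0ℤ * i + (1ℤ * s + (0ℤ * c + (0ℤ * d + 0ℤ * 1ℤ)))
        ring₁ = solve-∀

-- The eigenvalues, and the conclusion

module Entries (q k : ℕ) where

  open ℤCoefficients (pos (q ^ suc k)) (pos q)
  open Data.Integer.Solver.+-*-Solver using (Polynomial; solve; _:=_; _:+_; _:-_; _:*_; :-_; con)

  private
    a q′ : ℤ
    a  = pos (q ^ suc k)
    q′ = pos q

    eigenvalue : Fin 5 → Fin 5 → (a q : Polynomial 2) → Polynomial 2
    eigenvalue i l a q = CoefficientAlgebra.character (polynomials 2) a q i (CoefficientAlgebra.adjacency (polynomials 2) a q l)

    -- The matrix contains q^(n-1) as a separate power; as q times a it leaves polynomials in two
    -- variables.
    at-qa : (f : ℤ → ℤ) → f (pos (q ^ suc (suc k))) ≡ f (q′ * a)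
    at-qa f = cong f (ℤ.pos-* q (q ^ suc k))

  eigenmatrix≡ : ∀ i l → eigenmatrix q (suc (suc (suc k))) i l ≡ fromℤ (character i (adjacency l))
  eigenmatrix≡ 0F 0F = cong fromℤ (solve 2 (λ a q → con 1ℤ := eigenvalue 0F 0F a q) refl a q′)
  eigenmatrix≡ 0F 1F = cong fromℤ (trans (at-qa (λ b → (a - 1ℤ) * (b + 1ℤ))) (solve 2 (λ a q → (a :- con 1ℤ) :* (q :* a :+ con 1ℤ) := eigenvalue 0F 1F a q) refl a q′))
  eigenmatrix≡ 0F 2F = cong fromℤ (trans (at-qa (λ b → a * (q′ - pos 2) * (b + 1ℤ))) (solve 2 (λ a q → a :* (q :- con (pos 2)) :* (q :* a :+ con 1ℤ) := eigenvalue 0F 2F a q) refl a q′))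
  eigenmatrix≡ 0F 3F = cong fromℤ (trans (at-qa (λ b → (a - 1ℤ) * (b + 1ℤ))) (solve 2 (λ a q → (a :- con 1ℤ) :* (q :* a :+ con 1ℤ) := eigenvalue 0F 3F a q) refl a q′))
  eigenmatrix≡ 0F 4F = cong fromℤ (solve 2 (λ a q → con 1ℤ := eigenvalue 0F 4F a q) refl a q′)
  eigenmatrix≡ 1F 0F = cong fromℤ (solve 2 (λ a q → con 1ℤ := eigenvalue 1F 0F a q) refl a q′)
  eigenmatrix≡ 1F 1F = cong fromℤ (trans (at-qa (λ b → b + 1ℤ)) (solve 2 (λ a q → q :* a :+ con 1ℤ := eigenvalue 1F 1F a q) refl a q′))
  eigenmatrix≡ 1F 2F = cong fromℤ (solve 2 (λ a q → con 0ℤ := eigenvalue 1F 2F a q) refl a q′)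
  eigenmatrix≡ 1F 3F = cong fromℤ (trans (at-qa (λ b → - (b + 1ℤ))) (solve 2 (λ a q → :- (q :* a :+ con 1ℤ) := eigenvalue 1F 3F a q) refl a q′))
  eigenmatrix≡ 1F 4F = cong fromℤ (solve 2 (λ a q → con ℤ.-1ℤ := eigenvalue 1F 4F a q) refl a q′)
  eigenmatrix≡ 2F 0F = cong fromℤ (solve 2 (λ a q → con 1ℤ := eigenvalue 2F 0F a q) refl a q′)
  eigenmatrix≡ 2F 1F = cong fromℤ (solve 2 (λ a q → a :- con 1ℤ := eigenvalue 2F 1F a q) refl a q′)
  eigenmatrix≡ 2F 2F = cong fromℤ (solve 2 (λ a q → :- (con (pos 2) :* a) := eigenvalue 2F 2F a q) refl a q′)
  eigenmatrix≡ 2F 3F = cong fromℤ (solve 2 (λ a q → a :- con 1ℤ := eigenvalue 2F 3F a q) refl a q′)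
  eigenmatrix≡ 2F 4F = cong fromℤ (solve 2 (λ a q → con 1ℤ := eigenvalue 2F 4F a q) refl a q′)
  eigenmatrix≡ 3F 0F = cong fromℤ (solve 2 (λ a q → con 1ℤ := eigenvalue 3F 0F a q) refl a q′)
  eigenmatrix≡ 3F 1F = cong fromℤ (solve 2 (λ a q → :- (a :- con 1ℤ) := eigenvalue 3F 1F a q) refl a q′)
  eigenmatrix≡ 3F 2F = cong fromℤ (solve 2 (λ a q → con 0ℤ := eigenvalue 3F 2F a q) refl a q′)
  eigenmatrix≡ 3F 3F = cong fromℤ (solve 2 (λ a q → a :- con 1ℤ := eigenvalue 3F 3F a q) refl a q′)
  eigenmatrix≡ 3F 4F = cong fromℤ (solve 2 (λ a q → con ℤ.-1ℤ := eigenvalue 3F 4F a q) refl a q′)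
  eigenmatrix≡ 4F 0F = cong fromℤ (solve 2 (λ a q → con 1ℤ := eigenvalue 4F 0F a q) refl a q′)
  eigenmatrix≡ 4F 1F = cong fromℤ (solve 2 (λ a q → :- (a :* (q :- con (pos 2))) :- con 1ℤ := eigenvalue 4F 1F a q) refl a q′)
  eigenmatrix≡ 4F 2F = cong fromℤ (solve 2 (λ a q → con (pos 2) :* a :* (q :- con (pos 2)) := eigenvalue 4F 2F a q) refl a q′)
  eigenmatrix≡ 4F 3F = cong fromℤ (solve 2 (λ a q → :- (a :* (q :- con (pos 2))) :- con 1ℤ := eigenvalue 4F 3F a q) refl a q′)
  eigenmatrix≡ 4F 4F = cong fromℤ (solve 2 (λ a q → con 1ℤ := eigenvalue 4F 4F a q) refl a q′)

module _ {A : Set} {Ω : List A} {R : Fin 5 → A → A → Bool} where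
  open Scheme Ω

  -- A power of q does not reduce to a successor; matching on the equation for α supplies the form 2
  -- + s that `ReflectionScheme` is stated for.
  scheme : ∀ {r s α} P → α ≡ 2 ℕ.+ s → ReflectionGeometry Ω R (pos α) (pos (3 ℕ.+ r)) →
    (∀ k l → P k l ≡ fromℤ (ℤCoefficients.character (pos α) (pos (3 ℕ.+ r)) k (ℤCoefficients.adjacency (pos α) (pos (3 ℕ.+ r)) l))) →
    IsAssociationScheme 4 R × ∃[ E ] HasEigenmatrix 4 (R 0F) R P E
  scheme {r} {s} P refl 𝒢 P≡ = isAssociationScheme , E , hasEigenmatrix P P≡
    where open ReflectionScheme {r = r} {s = s} 𝒢

2≤power : ∀ r k → 2 ≤ (3 ℕ.+ r) ^ suc k
2≤power r k = ℕ.≤-trans (ℕ.s≤s (ℕ.s≤s ℕ.z≤n)) (ℕ.≤-trans (ℕ.≤-reflexive (sym (ℕ.*-identityʳ (3 ℕ.+ r)))) (ℕ.*-monoʳ-≤ (3 ℕ.+ r) (ℕ.m^n>0 (3 ℕ.+ r) k)))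

theorem7p3 : (q : ℕ) → 2 < q → IsPrimePower q → (F : FiniteField q) →
    (c d : Fin q) → Geometry.Irreducible F c d →
    (n : ℕ) → 3 ≤ n →
    (a : Vec (Fin q × Fin q) n) → Geometry.isZero F c d a ≡ false →
    Geometry.Hyperplane.NondegenerateSection F c d a →
    let open Geometry F c d
        open Hyperplane a
        open Scheme Ω
    in IsAssociationScheme 4 R ×
       ∃[ E ] HasEigenmatrix 4 _==v_ R (eigenmatrix q n) E
theorem7p3 (suc (suc (suc r))) 2<q _ F c d irreducible (suc (suc (suc k))) 3≤n a a≢0 section =
  -- Here n = 3 + k and a = q^(k + 1), and a ≥ 2 allows a to be written as 2 + (a ∸ 2).
  scheme {r = r} (eigenmatrix q (suc (suc (suc k)))) (sym (ℕ.m+[n∸m]≡n (2≤power r k))) geometry (Entries.eigenmatrix≡ q k)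
  where
  q : ℕ
  q = 3 ℕ.+ r
  open StandardSpace F c d irreducible (suc k)
  open Relations F c d irreducible (suc (suc (suc k))) (pos (q ^ suc k)) elliptic hyperbolicPair a a≢0 section using (geometry)
theorem7p3 (suc (suc zero)) (ℕ.s≤s (ℕ.s≤s ()))
theorem7p3 (suc zero) (ℕ.s≤s ())
theorem7p3 (suc (suc (suc r))) _ _ _ _ _ _ (suc (suc zero)) (ℕ.s≤s (ℕ.s≤s ()))
theorem7p3 (suc (suc (suc r))) _ _ _ _ _ _ (suc zero) (ℕ.s≤s ())
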